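{- There is an algorithm that, given a finite set $D\subseteq\mathbb{Z}^2$ and non-negative integers $b,a$ such that the polynomial $g=f_D-(b-a)\in\mathbb{Z}[x^{\pm1},y^{\pm1}]$ has line polynomial factors in at most one primitive direction, determines whether there exists a $(D,b,a)$-covering.
   Context: Write $X^{\vec u}=x^{u_1}y^{u_2}$ and $f_D=\sum_{\vec u\in D}X^{ -\vec u}$. A line polynomial is a Laurent polynomial in $\mathbb{C}[x^{\pm1},y^{\pm1}]$ whose support has at least two points, all on a line $\vec u+\mathbb{Q}\vec v$; it is then in direction $\vec v$. Parallel directions are identified. Having line polynomial factors in at most one primitive direction means all line polynomial divisors of $g$ are in directions parallel to a single vector. A $(D,b,a)$-covering is a configuration $c\in\{0,1\}^{\mathbb{Z}^2}$ such that for every $\vec u$, the number of $\vec v\in\vec u+D$ with $c_{\vec v}=1$ equals $a$ if $c_{\vec u}=0$ and $b$ if $c_{\vec u}=1$. -}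

module Defs where

open import Level using (Level; _⊔_) renaming (suc to lsuc)
open import Algebra.Bundles using (CommutativeRing)
open import Data.Bool using (Bool; true; false; if_then_else_; T)
open import Data.Bool.Properties using (T?)
open import Data.Nat using (ℕ; zero; suc)
open import Data.Integer as ℤ using (ℤ; +_; -[1+_])
import Data.Integer.Properties as ℤP
open import Data.Product using (Σ; ∃; _×_; _,_; proj₁; proj₂)
open import Data.Product.Properties using (≡-dec)
open import Data.List using (List; []; _∷_; _∷ʳ_; _++_; map; filter; length; concatMap)
open import Data.List.Relation.Unary.Unique.Propositional using (Unique)
open import Relation.Nullary using (¬_; Dec; yes; no)
open import Relation.Binary.PropositionalEquality using (_≡_)

ℤ² : Set
ℤ² = ℤ × ℤ

_≟²_ : (u v : ℤ²) → Dec (u ≡ v)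
_≟²_ = ≡-dec ℤP._≟_ ℤP._≟_

_+²_ : ℤ² → ℤ² → ℤ²
(a , b) +² (c , d) = (a ℤ.+ c , b ℤ.+ d)

_-²_ : ℤ² → ℤ² → ℤ²
(a , b) -² (c , d) = (a ℤ.- c , b ℤ.- d)

neg² : ℤ² → ℤ²
neg² (a , b) = (ℤ.- a , ℤ.- b)

0² : ℤ²
0² = (+ 0 , + 0)

cross : ℤ² → ℤ² → ℤ
cross (a , b) (c , d) = a ℤ.* d ℤ.- b ℤ.* c

Parallel : ℤ² → ℤ² → Set
Parallel u v = cross u v ≡ + 0

-- (D,b,a)-coverings.  A finite set D ⊆ ℤ² is a duplicate-free list.

Configuration : Set
Configuration = ℤ² → Bool

count : List ℤ² → Configuration → ℤ² → ℕ
count D c u = length (filter (λ d → T? (c (u +² d))) D)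

IsCovering : List ℤ² → ℕ → ℕ → Configuration → Set
IsCovering D b a c = ∀ u → count D c u ≡ (if c u then b else a)

-- An algebraically closed field of characteristic 0 (stand-in for ℂ)

module RingHelpers {c ℓ : Level} (R : CommutativeRing c ℓ) where
  open CommutativeRing R

  fromℕ : ℕ → Carrier
  fromℕ zero    = 0#
  fromℕ (suc n) = 1# + fromℕ n

  fromℤ : ℤ → Carrier
  fromℤ (+ n)      = fromℕ n
  fromℤ -[1+ n ]   = - fromℕ (suc n)

  evalU : List Carrier → Carrier → Carrier
  evalU []       t = 0#
  evalU (k ∷ ks) t = k + t * evalU ks t

record ACF0 (c ℓ : Level) : Set (lsuc (c ⊔ ℓ)) where
  field
    commRing : CommutativeRing c ℓ
  open CommutativeRing commRing public
  open RingHelpers commRing public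
  field
    1≉0      : ¬ (1# ≈ 0#)
    inverse  : ∀ x → ¬ (x ≈ 0#) → ∃ λ y → x * y ≈ 1#
    char0    : ∀ n → ¬ (fromℕ (suc n) ≈ 0#)
    algClosed : ∀ (k₀ : Carrier) (ks : List Carrier) (lead : Carrier) →
                ¬ (lead ≈ 0#) → ∃ λ t → evalU (k₀ ∷ (ks ∷ʳ lead)) t ≈ 0#

-- Laurent polynomials over K in x, y: finite lists of terms
-- (coefficient , exponent vector); the polynomial is Σ k X^e.

module Laurent {c ℓ : Level} (K : ACF0 c ℓ) where
  open ACF0 K

  LPoly : Set c
  LPoly = List (Carrier × ℤ²)

  coeff : LPoly → ℤ² → Carrier
  coeff []             e = 0#
  coeff ((k , e′) ∷ p) e with e′ ≟² e
  ... | yes _ = k + coeff p e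
  ... | no  _ = coeff p e

  _*L_ : LPoly → LPoly → LPoly
  p *L q = concatMap (λ { (k , e) → map (λ { (k′ , e′) → (k * k′ , e +² e′) }) q }) p

  _≈L_ : LPoly → LPoly → Set ℓ
  p ≈L q = ∀ e → coeff p e ≈ coeff q e

  _∣L_ : LPoly → LPoly → Set (c ⊔ ℓ)
  h ∣L g = ∃ λ q → (h *L q) ≈L g

  InSupp : ℤ² → LPoly → Set ℓ
  InSupp e p = ¬ (coeff p e ≈ 0#)

  IsLinePoly : LPoly → ℤ² → Set ℓ
  IsLinePoly p v =
      ¬ (v ≡ 0²)
    × (Σ ℤ² λ e₁ → Σ ℤ² λ e₂ → ¬ (e₁ ≡ e₂) × InSupp e₁ p × InSupp e₂ p)
    × (∀ e₁ e₂ → InSupp e₁ p → InSupp e₂ p → Parallel (e₁ -² e₂) v)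

  LineFactorsAtMostOneDirection : LPoly → Set (c ⊔ ℓ)
  LineFactorsAtMostOneDirection g =
    ∀ h₁ h₂ v₁ v₂ → IsLinePoly h₁ v₁ → h₁ ∣L g → IsLinePoly h₂ v₂ → h₂ ∣L g →
    Parallel v₁ v₂

  fD : List ℤ² → LPoly
  fD D = map (λ u → (1# , neg² u)) D

  gPoly : List ℤ² → ℕ → ℕ → LPoly
  gPoly D b a = fD D ++ ((- fromℤ ((+ b) ℤ.- (+ a)) , 0²) ∷ [])

module Submission where

-- Let G = f_D - (b - a), so that G c is constant for every covering c.  For a large prime p, G(X)^p and
-- G(X^p) agree modulo p while their values on c are too small to differ by a multiple of p; hence G(X^k) c is
-- constant for all k ≡ 1 modulo some m, and Vandermonde elimination over these k yields an annihilator of c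
-- that is a product of binomials X^w - 1 with computable w.  If G has no line factor in direction w, then a
-- bounded w-periodic configuration killed by G is determined by finitely many consecutive rows (split
-- X^w - 1 into linear factors over K and compare leading rows), so the pigeonhole principle gives it periods
-- in every direction, with a computable bound.  As the line factors of G have at most one direction v, all
-- binomials can be traded for ones in direction v, and boundedness of c makes c itself periodic in direction v.
-- Which candidate direction is v is known only up to double negation, so a period is computed for each of the
-- finitely many candidates.  A periodic covering can be folded into a doubly periodic one of bounded period,
-- which leaves a finite search.

open import Defs
open import Level using (Level)
open import Algebra.Bundles using (CommutativeRing; RawRing)
open import Data.Nat using (ℕ)
open import Data.Product using (∃)
open import Data.List using (List)
open import Data.List.Relation.Unary.Unique.Propositional using (Unique)
open import Relation.Nullary using (Dec; ¬_)

-- A `Dec` obtained without postulates is the algorithm, so every search bound must be computed from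
-- `D`, `b` and `a`. Equality in `K` cannot be tested, hence neither can divisibility by a line
-- polynomial. This shapes the proof: `K` is consulted only for equations between integers, which
-- survive a double negation, and for refutations, while the search bounds are built from
-- coefficient sizes, lattice indices, window counts and factorials. Factorials arise wherever a
-- period or a prime is known only to be bounded: N! serves all possible values at once. In
-- particular m is N! with N twice the sum of the absolute values of the coefficients of G, since a
-- number congruent to 1 modulo N! has no prime factor up to N; dilation keeps that sum, so a
-- composite k is reached one prime factor at a time. As G c is constant but in general not 0, the
-- annihilator contains one binomial more than elimination supplies; its direction is free and is
-- taken to be the candidate for v.

-- Integers in a commutative ring, and a ring solver with integer coefficients

module IntegersIn {c ℓ} (R : CommutativeRing c ℓ) where
  open CommutativeRing R
  open RingHelpers R
  open import Algebra.Properties.Ring ring using (-‿distribˡ-*; -‿distribʳ-*; -‿involutive; -0#≈0#; -‿+-comm)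
  open import Algebra.Properties.CommutativeSemigroup +-commutativeSemigroup using (interchange)
  open import Relation.Binary.Reasoning.Setoid setoid
  open import Data.Nat as ℕ using (ℕ; zero; suc)
  open import Data.Integer as ℤ using (ℤ; +_; -[1+_]; _⊖_)
  import Data.Integer.Properties as ℤₚ
  open import Data.Maybe using (Maybe; just; nothing)
  open import Relation.Nullary using (yes; no)
  import Relation.Binary.PropositionalEquality as ≡
  import Algebra.Solver.Ring as RingSolver
  open import Algebra.Solver.Ring.AlmostCommutativeRing using (AlmostCommutativeRing; fromCommutativeRing; _-Raw-AlmostCommutative⟶_)

  fromℕ-+ : ∀ m n → fromℕ (m ℕ.+ n) ≈ fromℕ m + fromℕ n
  fromℕ-+ zero n = sym (+-identityˡ _)
  fromℕ-+ (suc m) n = trans (+-congˡ (fromℕ-+ m n)) (sym (+-assoc _ _ _))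

  fromℕ-* : ∀ m n → fromℕ (m ℕ.* n) ≈ fromℕ m * fromℕ n
  fromℕ-* zero n = sym (zeroˡ _)
  fromℕ-* (suc m) n = begin
    fromℕ (n ℕ.+ m ℕ.* n)               ≈⟨ fromℕ-+ n (m ℕ.* n) ⟩
    fromℕ n + fromℕ (m ℕ.* n)           ≈⟨ +-cong (sym (*-identityˡ _)) (fromℕ-* m n) ⟩
    1# * fromℕ n + fromℕ m * fromℕ n    ≈⟨ sym (distribʳ _ _ _) ⟩
    (1# + fromℕ m) * fromℕ n            ∎

  fromℤ-⊖ : ∀ m n → fromℤ (m ⊖ n) ≈ fromℕ m + - fromℕ n
  fromℤ-⊖ m zero = begin
    fromℤ (m ⊖ 0)     ≡⟨ ≡.cong fromℤ (ℤₚ.⊖-≥ {m} {0} ℕ.z≤n) ⟩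
    fromℕ m           ≈⟨ sym (+-identityʳ _) ⟩
    fromℕ m + 0#      ≈⟨ +-congˡ (sym -0#≈0#) ⟩
    fromℕ m + - 0#    ∎
  fromℤ-⊖ zero (suc n) = sym (+-identityˡ _)
  fromℤ-⊖ (suc m) (suc n) = begin
    fromℤ (suc m ⊖ suc n)                        ≡⟨ ≡.cong fromℤ (ℤₚ.[1+m]⊖[1+n]≡m⊖n m n) ⟩
    fromℤ (m ⊖ n)                                ≈⟨ fromℤ-⊖ m n ⟩
    fromℕ m + - fromℕ n                          ≈⟨ sym (+-identityˡ _) ⟩
    0# + (fromℕ m + - fromℕ n)                   ≈⟨ +-congʳ (sym (-‿inverseʳ 1#)) ⟩
    (1# + - 1#) + (fromℕ m + - fromℕ n)          ≈⟨ interchange _ _ _ _ ⟩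
    (1# + fromℕ m) + (- 1# + - fromℕ n)          ≈⟨ +-congˡ (-‿+-comm _ _) ⟩
    (1# + fromℕ m) + - (1# + fromℕ n)            ∎

  fromℤ-neg : ∀ i → fromℤ (ℤ.- i) ≈ - fromℤ i
  fromℤ-neg (+ zero) = sym -0#≈0#
  fromℤ-neg (+ suc n) = refl
  fromℤ-neg -[1+ n ] = sym (-‿involutive _)

  fromℤ-+ : ∀ i j → fromℤ (i ℤ.+ j) ≈ fromℤ i + fromℤ j
  fromℤ-+ (+ m) (+ n) = fromℕ-+ m n
  fromℤ-+ (+ m) -[1+ n ] = fromℤ-⊖ m (suc n)
  fromℤ-+ -[1+ m ] (+ n) = trans (fromℤ-⊖ n (suc m)) (+-comm _ _)
  fromℤ-+ -[1+ m ] -[1+ n ] = begin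
    - fromℕ (suc (suc (m ℕ.+ n)))       ≡⟨ ≡.cong (λ k → - fromℕ k) (≡.sym (≡.cong suc (ℕₚ.+-suc m n))) ⟩
    - fromℕ (suc m ℕ.+ suc n)           ≈⟨ -‿cong (fromℕ-+ (suc m) (suc n)) ⟩
    - (fromℕ (suc m) + fromℕ (suc n))   ≈⟨ sym (-‿+-comm _ _) ⟩
    - fromℕ (suc m) + - fromℕ (suc n)   ∎
    where import Data.Nat.Properties as ℕₚ

  fromℤ-*-+ : ∀ m j → fromℤ (+ m ℤ.* j) ≈ fromℕ m * fromℤ j
  fromℤ-*-+ m (+ n) = trans (reflexive (≡.cong fromℤ (≡.sym (ℤₚ.pos-* m n)))) (fromℕ-* m n)
  fromℤ-*-+ m -[1+ n ] = begin
    fromℤ (+ m ℤ.* -[1+ n ])         ≡⟨ ≡.cong fromℤ (≡.sym (ℤₚ.neg-distribʳ-* (+ m) (+ suc n))) ⟩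
    fromℤ (ℤ.- (+ m ℤ.* + suc n))    ≈⟨ fromℤ-neg (+ m ℤ.* + suc n) ⟩
    - fromℤ (+ m ℤ.* + suc n)        ≈⟨ -‿cong (fromℤ-*-+ m (+ suc n)) ⟩
    - (fromℕ m * fromℕ (suc n))      ≈⟨ -‿distribʳ-* _ _ ⟩
    fromℕ m * - fromℕ (suc n)        ∎

  fromℤ-* : ∀ i j → fromℤ (i ℤ.* j) ≈ fromℤ i * fromℤ j
  fromℤ-* (+ m) j = fromℤ-*-+ m j
  fromℤ-* -[1+ m ] j = begin
    fromℤ (-[1+ m ] ℤ.* j)           ≡⟨ ≡.cong fromℤ (≡.sym (ℤₚ.neg-distribˡ-* (+ suc m) j)) ⟩
    fromℤ (ℤ.- (+ suc m ℤ.* j))      ≈⟨ fromℤ-neg (+ suc m ℤ.* j) ⟩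
    - fromℤ (+ suc m ℤ.* j)          ≈⟨ -‿cong (fromℤ-*-+ (suc m) j) ⟩
    - (fromℕ (suc m) * fromℤ j)      ≈⟨ -‿distribˡ-* _ _ ⟩
    - fromℕ (suc m) * fromℤ j        ∎

  fromℤ-1 : fromℤ (+ 1) ≈ 1#
  fromℤ-1 = +-identityʳ 1#

  private
    almost : AlmostCommutativeRing c ℓ
    almost = fromCommutativeRing R

    integers : RawRing _ _
    integers = CommutativeRing.rawRing ℤₚ.+-*-commutativeRing

    hom : integers -Raw-AlmostCommutative⟶ almost
    hom = record { ⟦_⟧ = fromℤ ; +-homo = fromℤ-+ ; *-homo = fromℤ-* ; -‿homo = fromℤ-neg ; 0-homo = refl ; 1-homo = fromℤ-1 }

    -- Coefficients are compared as integers, so the solver can cancel terms although equality in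
    -- `R` is undecidable.
    _≟_ : ∀ i j → Maybe (fromℤ i ≈ fromℤ j)
    i ≟ j with i ℤ.≟ j
    ... | yes p = just (reflexive (≡.cong fromℤ p))
    ... | no _  = nothing

  open RingSolver integers almost hom _≟_ public using (solve; _:=_; _:+_; _:*_; :-_; con)

-- Primes, factorials and binomial coefficients

module Binomials where
  open import Data.Nat
  open import Data.Nat.Properties
  open import Data.Nat.Divisibility using (_∣_; ∣⇒≤; ∣-trans; m∣m*n; m≤n⇒m!∣n!)
  open import Data.Nat.DivMod using (m/n*n≡m)
  open import Data.Nat.Combinatorics using (_C_; nCk≡n!/k![n-k]!; k![n∸k]!∣n!)
  open import Data.Nat.Primality using (Prime; euclidsLemma; ¬prime[1])
  open import Data.Sum using (inj₁; inj₂)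
  open import Relation.Nullary using (contradiction; ¬_)
  open import Relation.Binary.PropositionalEquality using (sym; subst; cong; module ≡-Reasoning)

  prime∤1 : ∀ {p} → Prime p → ¬ (p ∣ 1)
  prime∤1 {suc zero} pr d = ¬prime[1] pr
  prime∤1 {suc (suc p)} pr d with ∣⇒≤ d
  ... | s≤s ()

  prime∣!⇒≤ : ∀ {p} → Prime p → ∀ n → p ∣ n ! → p ≤ n
  prime∣!⇒≤ {p} pr zero d = contradiction d (prime∤1 pr)
  prime∣!⇒≤ {p} pr (suc n) d with euclidsLemma (suc n) (n !) pr d
  ... | inj₁ p∣ = ∣⇒≤ p∣
  ... | inj₂ p∣ = m≤n⇒m≤1+n (prime∣!⇒≤ pr n p∣)

  ≤⇒∣! : ∀ {m n} → 1 ≤ m → m ≤ n → m ∣ n !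
  ≤⇒∣! {suc m} _ m≤n = ∣-trans (m∣m*n (m !)) (m≤n⇒m!∣n! m≤n)

  -- The prime divides p! = C(p,k) k! (p-k)!, but neither factorial on the right, because k and p-k
  -- are both below p.
  prime∣C : ∀ {p} → Prime p → ∀ {k} → 0 < k → k < p → p ∣ p C k
  prime∣C {p@(suc p′)} pr {k} 0<k k<p with euclidsLemma (p C k) (k ! * (p ∸ k) !) pr p∣
    where
    instance _ = k !* (p ∸ k) !≢0
    p∣ : p ∣ (p C k) * (k ! * (p ∸ k) !)
    p∣ = subst (p ∣_) (sym (begin
      (p C k) * (k ! * (p ∸ k) !)                          ≡⟨ cong (_* (k ! * (p ∸ k) !)) (nCk≡n!/k![n-k]! (<⇒≤ k<p)) ⟩
      (p ! / (k ! * (p ∸ k) !)) * (k ! * (p ∸ k) !)       ≡⟨ m/n*n≡m (k![n∸k]!∣n! (<⇒≤ k<p)) ⟩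
      p !                                                ∎)) (≤⇒∣! (s≤s z≤n) ≤-refl)
      where open ≡-Reasoning
  ... | inj₁ d = d
  ... | inj₂ d with euclidsLemma (k !) ((p ∸ k) !) pr d
  ...   | inj₁ d′ = contradiction (prime∣!⇒≤ pr k d′) (<⇒≱ k<p)
  ...   | inj₂ d′ = contradiction (prime∣!⇒≤ pr (p ∸ k) d′) (<⇒≱ (∸-monoʳ-< 0<k (<⇒≤ k<p)))

-- The freshman's dream in a commutative ring

module FreshmansDream {c ℓ} (R : CommutativeRing c ℓ) where
  open CommutativeRing R hiding (zero)
  open import Data.Nat as ℕ using (ℕ; zero; suc; z≤n; s≤s)
  import Data.Nat.Properties as ℕₚ
  open import Data.Nat.Divisibility using (divides)
  open import Data.Nat.Combinatorics using (_C_; nCn≡1)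
  open import Data.Nat.Primality using (Prime; ¬prime[0])
  open import Data.Fin using (Fin; zero; suc; toℕ; fromℕ; inject₁)
  import Data.Fin.Properties as Finₚ
  open import Data.Product using (∃; _,_; proj₁; proj₂)
  open import Level using (_⊔_)
  open import Relation.Nullary using (contradiction)
  import Relation.Binary.PropositionalEquality as ≡
  open import Relation.Binary.Reasoning.Setoid setoid
  open import Algebra.Properties.CommutativeSemiring.Binomial commutativeSemiring using (theorem; binomialTerm)
  open import Algebra.Properties.Semiring.Sum semiring using (sum; sum-init-last)
  open import Algebra.Properties.Semiring.Mult semiring public using (_×_; ×-congˡ; ×-homo-1; ×-assocˡ)
  open import Algebra.Properties.CommutativeMonoid.Mult +-commutativeMonoid public using (×-distrib-+)
  open import Algebra.Properties.Semiring.Exp semiring public using (_^_)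
  open import Algebra.Properties.Ring ring using (-‿+-comm; -0#≈0#)
  open Binomials using (prime∣C)

  infix 4 _≈_mod_
  -- The factor is kept as data: in the ring of operators it is applied to a configuration, where
  -- the error becomes p times an integer-valued function.
  record _≈_mod_ (x y : Carrier) (n : ℕ) : Set (c ⊔ ℓ) where
    constructor _,_
    field
      factor   : Carrier
      equation : x ≈ y + n × factor

  open _≈_mod_ public

  ≈⇒mod : ∀ {n x y} → x ≈ y → x ≈ y mod n
  ≈⇒mod {n} {x} {y} eq = 0# , (begin
    x            ≈⟨ eq ⟩
    y            ≈⟨ sym (+-identityʳ y) ⟩
    y + 0#       ≈⟨ +-congˡ (sym (n×0 n)) ⟩
    y + n × 0#   ∎)
    where
    n×0 : ∀ n → n × 0# ≈ 0#
    n×0 zero = refl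
    n×0 (suc n) = trans (+-identityˡ _) (n×0 n)

  mod-trans : ∀ {n x y z} → x ≈ y mod n → y ≈ z mod n → x ≈ z mod n
  mod-trans {n} {x} {y} {z} (r , p) (s , q) = s + r , (begin
    x                     ≈⟨ p ⟩
    y + n × r             ≈⟨ +-congʳ q ⟩
    (z + n × s) + n × r   ≈⟨ +-assoc _ _ _ ⟩
    z + (n × s + n × r)   ≈⟨ +-congˡ (sym (×-distrib-+ s r n)) ⟩
    z + n × (s + r)       ∎)

  mod-+ : ∀ {n x y x′ y′} → x ≈ y mod n → x′ ≈ y′ mod n → x + x′ ≈ y + y′ mod n
  mod-+ {n} {x} {y} {x′} {y′} (r , p) (s , q) = r + s , (begin
    x + x′                          ≈⟨ +-cong p q ⟩
    (y + n × r) + (y′ + n × s)      ≈⟨ interchange _ _ _ _ ⟩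
    (y + y′) + (n × r + n × s)      ≈⟨ +-congˡ (sym (×-distrib-+ r s n)) ⟩
    (y + y′) + n × (r + s)          ∎)
    where open import Algebra.Properties.CommutativeSemigroup +-commutativeSemigroup using (interchange)

  sum-mod : ∀ n {m} (f : Fin m → Carrier) → (∀ i → ∃ λ r → f i ≈ n × r) → ∃ λ r → sum f ≈ n × r
  sum-mod n {zero} f h = 0# , trans (equation (≈⇒mod {n} {0#} {0#} refl)) (+-identityˡ _)
  sum-mod n {suc m} f h with h zero | sum-mod n (λ i → f (suc i)) (λ i → h (suc i))
  ... | r , p | s , q = r + s , trans (+-cong p q) (sym (×-distrib-+ r s n))

  -- In the binomial theorem the first and last terms are the two powers; every inner coefficient is
  -- divisible by p.
  freshman : ∀ {p} → Prime p → ∀ x y → (x + y) ^ p ≈ x ^ p + y ^ p mod p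
  freshman {zero} pr = contradiction pr ¬prime[0]
  freshman {suc m} pr x y = proj₁ inner , (begin
      (x + y) ^ p                                               ≈⟨ theorem p x y ⟩
      t zero + sum (λ i → t (suc i))                            ≈⟨ +-congˡ (sum-init-last (λ i → t (suc i))) ⟩
      t zero + (sum (λ i → t (suc (inject₁ i))) + t (fromℕ p))  ≈⟨ +-cong t0 (+-cong (proj₂ inner) tp) ⟩
      y ^ p + (p × proj₁ inner + x ^ p)                         ≈⟨ +-congˡ (+-comm _ _) ⟩
      y ^ p + (x ^ p + p × proj₁ inner)                         ≈⟨ sym (+-assoc _ _ _) ⟩
      (y ^ p + x ^ p) + p × proj₁ inner                         ≈⟨ +-congʳ (+-comm _ _) ⟩
      (x ^ p + y ^ p) + p × proj₁ inner                         ∎)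
    where
    p = suc m

    t : Fin (suc p) → Carrier
    t = binomialTerm x y p

    t0 : t zero ≈ y ^ p
    t0 = trans (×-homo-1 _) (*-identityˡ _)

    last-term : ∀ k → k ≡.≡ p → (p C k) × (x ^ k * y ^ (p ℕ.∸ k)) ≈ x ^ p
    last-term k ≡.refl = begin
      (p C p) × (x ^ p * y ^ (p ℕ.∸ p))   ≈⟨ ×-congˡ (nCn≡1 p) ⟩
      1 × (x ^ p * y ^ (p ℕ.∸ p))         ≈⟨ ×-homo-1 _ ⟩
      x ^ p * y ^ (p ℕ.∸ p)               ≡⟨ ≡.cong (λ j → x ^ p * y ^ j) (ℕₚ.n∸n≡0 p) ⟩
      x ^ p * 1#                          ≈⟨ *-identityʳ _ ⟩
      x ^ p                               ∎

    tp : t (fromℕ p) ≈ x ^ p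
    tp = last-term (toℕ (fromℕ p)) (Finₚ.toℕ-fromℕ p)

    multiple : ∀ k → 0 ℕ.< k → k ℕ.< p → ∀ z → ∃ λ r → (p C k) × z ≈ p × r
    multiple k 0<k k<p z with prime∣C pr 0<k k<p
    ... | divides q eq = q × z , (begin
        (p C k) × z      ≈⟨ ×-congˡ (≡.trans eq (ℕₚ.*-comm q p)) ⟩
        (p ℕ.* q) × z    ≈⟨ sym (×-assocˡ z p q) ⟩
        p × (q × z)      ∎)

    inner : ∃ λ r → sum (λ (i : Fin m) → t (suc (inject₁ i))) ≈ p × r
    inner = sum-mod p (λ (i : Fin m) → t (suc (inject₁ i))) λ i →
      multiple (suc (toℕ (inject₁ i))) (s≤s z≤n)
        (s≤s (ℕₚ.≤-trans (ℕₚ.≤-reflexive (≡.cong suc (Finₚ.toℕ-inject₁ i))) (Finₚ.toℕ<n i))) _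

  isolate : ∀ x r b s → 0# ≈ (x + r) + b + s → b ≈ - x + - (r + s)
  isolate x r b s eq = begin
    b                                           ≈⟨ solve 4 (λ x r b s → b := (:- x :+ :- (r :+ s)) :+ ((x :+ r) :+ b :+ s)) refl x r b s ⟩
    (- x + - (r + s)) + ((x + r) + b + s)       ≈⟨ +-congˡ (sym eq) ⟩
    (- x + - (r + s)) + 0#                      ≈⟨ +-identityʳ _ ⟩
    - x + - (r + s)                             ∎
    where open IntegersIn R

  ×-neg : ∀ n y → n × (- y) ≈ - (n × y)
  ×-neg zero y = sym -0#≈0#
  ×-neg (suc n) y = trans (+-congˡ (×-neg n y)) (-‿+-comm _ _)

  -- Expanding 0 = (x + - x)^p yields the power of - x from that of x, with no case distinction on
  -- the parity of p.
  frobenius-neg : ∀ {p} → Prime p → ∀ x → x ^ p ≈ x mod p → (- x) ^ p ≈ - x mod p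
  frobenius-neg {zero} pr = contradiction pr ¬prime[0]
  frobenius-neg {suc m} pr x (r , eq) = - (r + s) , (begin
      (- x) ^ p                      ≈⟨ isolate x (p × r) ((- x) ^ p) (p × s) zero-sum ⟩
      - x + - (p × r + p × s)        ≈⟨ +-congˡ (-‿cong (sym (×-distrib-+ r s p))) ⟩
      - x + - (p × (r + s))          ≈⟨ +-congˡ (sym (×-neg p (r + s))) ⟩
      - x + p × (- (r + s))          ∎)
    where
    p = suc m
    s = factor (freshman pr x (- x))
    zero-sum : 0# ≈ (x + p × r) + (- x) ^ p + p × s
    zero-sum = begin
      0#                                       ≈⟨ sym (zeroˡ _) ⟩
      0# * (x + - x) ^ m                       ≈⟨ *-congʳ (sym (-‿inverseʳ x)) ⟩
      (x + - x) ^ p                            ≈⟨ equation (freshman pr x (- x)) ⟩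
      (x ^ p + (- x) ^ p) + p × s              ≈⟨ +-congʳ (+-congʳ eq) ⟩
      (x + p × r) + (- x) ^ p + p × s          ∎

-- Arithmetic of the lattice

module Plane where
  open import Data.Integer
  open import Data.Integer.Properties
  open import Data.Integer.Tactic.RingSolver using (solve-∀)
  open import Data.Product using (_,_; proj₁; proj₂)
  open import Relation.Binary.PropositionalEquality

  infixr 21 _·_
  _·_ : ℤ → ℤ² → ℤ²
  n · (a , b) = n * a , n * b

  +²-assoc : ∀ u v w → (u +² v) +² w ≡ u +² (v +² w)
  +²-assoc (a , b) (c , d) (e , f) = cong₂ _,_ (+-assoc a c e) (+-assoc b d f)

  +²-comm : ∀ u v → u +² v ≡ v +² u
  +²-comm (a , b) (c , d) = cong₂ _,_ (+-comm a c) (+-comm b d)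

  +²-identityʳ : ∀ u → u +² 0² ≡ u
  +²-identityʳ (a , b) = cong₂ _,_ (+-identityʳ a) (+-identityʳ b)

  -²-identityʳ : ∀ u → u -² 0² ≡ u
  -²-identityʳ (a , b) = cong₂ _,_ (+-identityʳ a) (+-identityʳ b)

  -²-neg² : ∀ u v → u -² neg² v ≡ u +² v
  -²-neg² (a , b) (c , d) = cong₂ _,_ (cong (_+_ a) (neg-involutive c)) (cong (_+_ b) (neg-involutive d))

  -²+² : ∀ u v w → (u -² v) +² w ≡ (u +² w) -² v
  -²+² (a , b) (c , d) (e , f) = cong₂ _,_ (l a c e) (l b d f)
    where l : ∀ a c e → a - c + e ≡ a + e - c
          l = solve-∀

  -²-comm : ∀ u v w → (u -² v) -² w ≡ (u -² w) -² v
  -²-comm (a , b) (c , d) (e , f) = cong₂ _,_ (l a c e) (l b d f)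
    where l : ∀ a c e → a - c - e ≡ a - e - c
          l = solve-∀

  -²-+² : ∀ u v w → u -² (v +² w) ≡ (u -² v) -² w
  -²-+² (a , b) (c , d) (e , f) = cong₂ _,_ (l a c e) (l b d f)
    where l : ∀ a c e → a - (c + e) ≡ a - c - e
          l = solve-∀

  +²-cancel-²  : ∀ u v → (u -² v) +² v ≡ u
  +²-cancel-² (a , b) (c , d) = cong₂ _,_ (l a c) (l b d)
    where l : ∀ a c → a - c + c ≡ a
          l = solve-∀

  -²-cancel+² : ∀ u v → (u +² v) -² v ≡ u
  -²-cancel+² (a , b) (c , d) = cong₂ _,_ (l a c) (l b d)
    where l : ∀ a c → a + c - c ≡ a
          l = solve-∀

  -²+²-² : ∀ u v w → (u -² v) +² (v -² w) ≡ u -² w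
  -²+²-² (a , b) (c , d) (e , f) = cong₂ _,_ (l a c e) (l b d f)
    where l : ∀ a c e → a - c + (c - e) ≡ a - e
          l = solve-∀

  -²-self : ∀ u → u -² u ≡ 0²
  -²-self (a , b) = cong₂ _,_ (+-inverseʳ a) (+-inverseʳ b)

  -²≡0⇒≡ : ∀ u v → u -² v ≡ 0² → v ≡ u
  -²≡0⇒≡ (a , b) (c , d) eq = cong₂ _,_ (sym (i-j≡0⇒i≡j a c (cong proj₁ eq))) (sym (i-j≡0⇒i≡j b d (cong proj₂ eq)))

  cross-+ˡ : ∀ u v w → cross (u +² v) w ≡ cross u w + cross v w
  cross-+ˡ (a , b) (x , y) (e , f) = l a b x y e f
    where l : ∀ a b x y e f → (a + x) * f - (b + y) * e ≡ (a * f - b * e) + (x * f - y * e)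
          l = solve-∀

  cross-+ʳ : ∀ w u v → cross w (u +² v) ≡ cross w u + cross w v
  cross-+ʳ (e , f) (a , b) (x , y) = l a b x y e f
    where l : ∀ a b x y e f → e * (b + y) - f * (a + x) ≡ (e * b - f * a) + (e * y - f * x)
          l = solve-∀

  ·-distribʳ : ∀ m n u → (m + n) · u ≡ m · u +² n · u
  ·-distribʳ m n (a , b) = cong₂ _,_ (*-distribʳ-+ a m n) (*-distribʳ-+ b m n)

  ·-distribˡ-² : ∀ m u v → m · (u -² v) ≡ m · u -² m · v
  ·-distribˡ-² m (a , b) (c , d) = cong₂ _,_ (l m a c) (l m b d)
    where l : ∀ m a c → m * (a - c) ≡ m * a - m * c
          l = solve-∀

  ·-assoc : ∀ m n u → (m * n) · u ≡ m · (n · u)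
  ·-assoc m n (a , b) = cong₂ _,_ (*-assoc m n a) (*-assoc m n b)

  1· : ∀ u → (+ 1) · u ≡ u
  1· (a , b) = cong₂ _,_ (*-identityˡ a) (*-identityˡ b)

  0· : ∀ u → (+ 0) · u ≡ 0²
  0· (a , b) = refl

-- Laurent polynomials as operators on functions on the lattice

module Action {c ℓ} (R : CommutativeRing c ℓ) where
  open CommutativeRing R hiding (zero)
  open Plane
  open import Data.List using (List; []; _∷_; _++_; map)
  open import Data.Product using (_×_; _,_)
  open import Level using (_⊔_)
  import Relation.Binary.PropositionalEquality as ≡
  open import Relation.Binary.Reasoning.Setoid setoid
  open import Algebra.Properties.CommutativeSemigroup +-commutativeSemigroup using (interchange)
  open import Algebra.Properties.CommutativeSemigroup *-commutativeSemigroup using (x∙yz≈y∙xz)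
  open import Algebra.Properties.Ring ring using (-‿distribˡ-*; -‿+-comm; -0#≈0#)

  Terms : Set c
  Terms = List (Carrier × ℤ²)

  Fun : Set c
  Fun = ℤ² → Carrier

  -- Convolution: X^e translates a function by e. Thus X^(-d) in f_D reads the cell u + d, as
  -- `count` does.
  act : Terms → Fun → Fun
  act [] z u = 0#
  act ((k , e) ∷ p) z u = k * z (u -² e) + act p z u

  act-cong : ∀ p {y z : Fun} → (∀ u → y u ≈ z u) → ∀ u → act p y u ≈ act p z u
  act-cong [] h u = refl
  act-cong ((k , e) ∷ p) h u = +-cong (*-congˡ (h (u -² e))) (act-cong p h u)

  act-0 : ∀ p {z : Fun} → (∀ u → z u ≈ 0#) → ∀ u → act p z u ≈ 0#
  act-0 [] h u = refl
  act-0 ((k , e) ∷ p) h u = trans (+-cong (trans (*-congˡ (h _)) (zeroʳ k)) (act-0 p h u)) (+-identityˡ 0#)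

  act-++ : ∀ p q z u → act (p ++ q) z u ≈ act p z u + act q z u
  act-++ [] q z u = sym (+-identityˡ _)
  act-++ ((k , e) ∷ p) q z u = trans (+-congˡ (act-++ p q z u)) (sym (+-assoc _ _ _))

  act-+ : ∀ p y z u → act p (λ v → y v + z v) u ≈ act p y u + act p z u
  act-+ [] y z u = sym (+-identityˡ _)
  act-+ ((k , e) ∷ p) y z u = trans (+-cong (distribˡ _ _ _) (act-+ p y z u)) (interchange _ _ _ _)

  act-* : ∀ p k z u → act p (λ v → k * z v) u ≈ k * act p z u
  act-* [] k z u = sym (zeroʳ k)
  act-* ((k′ , e) ∷ p) k z u = trans (+-cong (x∙yz≈y∙xz k′ k _) (act-* p k z u)) (sym (distribˡ k _ _))

  act-neg : ∀ p z u → act p (λ v → - z v) u ≈ - act p z u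
  act-neg [] z u = sym -0#≈0#
  act-neg ((k , e) ∷ p) z u = trans (+-cong (sym (-‿distribʳ-* k _)) (act-neg p z u)) (-‿+-comm _ _)
    where open import Algebra.Properties.Ring ring using (-‿distribʳ-*)

  act-shift : ∀ p z v u → act p (λ w → z (w +² v)) u ≈ act p z (u +² v)
  act-shift [] z v u = refl
  act-shift ((k , e) ∷ p) z v u = +-cong (*-congˡ (reflexive (≡.cong z (-²+² u e v)))) (act-shift p z v u)

  act-shift⁻ : ∀ p z v u → act p (λ w → z (w -² v)) u ≈ act p z (u -² v)
  act-shift⁻ [] z v u = refl
  act-shift⁻ ((k , e) ∷ p) z v u = +-cong (*-congˡ (reflexive (≡.cong z (-²-comm u e v)))) (act-shift⁻ p z v u)

  act-comm : ∀ p q z u → act p (act q z) u ≈ act q (act p z) u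
  act-comm p [] z u = act-0 p (λ _ → refl) u
  act-comm p ((k , e) ∷ q) z u = begin
    act p (λ v → k * z (v -² e) + act q z v) u                ≈⟨ act-+ p _ _ u ⟩
    act p (λ v → k * z (v -² e)) u + act p (act q z) u         ≈⟨ +-cong (act-* p k _ u) (act-comm p q z u) ⟩
    k * act p (λ v → z (v -² e)) u + act q (act p z) u         ≈⟨ +-congʳ (*-congˡ (act-shift⁻ p z e u)) ⟩
    k * act p z (u -² e) + act q (act p z) u                   ∎

  _⊙_ : Carrier × ℤ² → Carrier × ℤ² → Carrier × ℤ²
  (k , e) ⊙ (k′ , e′) = k * k′ , e +² e′

  act-⊙ : ∀ k e q z u → act (map ((k , e) ⊙_) q) z u ≈ k * act q z (u -² e)
  act-⊙ k e [] z u = sym (zeroʳ k)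
  act-⊙ k e ((k′ , e′) ∷ q) z u = begin
    (k * k′) * z (u -² (e +² e′)) + act (map ((k , e) ⊙_) q) z u
      ≈⟨ +-cong (trans (*-assoc _ _ _) (*-congˡ (*-congˡ (reflexive (≡.cong z (-²-+² u e e′)))))) (act-⊙ k e q z u) ⟩
    k * (k′ * z ((u -² e) -² e′)) + k * act q z (u -² e)
      ≈⟨ sym (distribˡ _ _ _) ⟩
    k * (k′ * z ((u -² e) -² e′) + act q z (u -² e)) ∎

  mul : Terms → Terms → Terms
  mul [] q = []
  mul (t ∷ p) q = map (t ⊙_) q ++ mul p q

  act-mul : ∀ p q z u → act (mul p q) z u ≈ act p (act q z) u
  act-mul [] q z u = refl
  act-mul ((k , e) ∷ p) q z u = trans (act-++ (map ((k , e) ⊙_) q) (mul p q) z u) (+-cong (act-⊙ k e q z u) (act-mul p q z u))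

  infix 4 _≋_
  -- Term lists are compared through their action, not their coefficients. The ring laws then reduce
  -- to facts about composed operators, and lists never have to be normalised.
  _≋_ : Terms → Terms → Set (c ⊔ ℓ)
  p ≋ q = ∀ z u → act p z u ≈ act q z u

  negate : Terms → Terms
  negate = map λ (k , e) → - k , e

  act-negate : ∀ p z u → act (negate p) z u ≈ - act p z u
  act-negate [] z u = sym -0#≈0#
  act-negate ((k , e) ∷ p) z u = trans (+-cong (sym (-‿distribˡ-* k _)) (act-negate p z u)) (-‿+-comm _ _)

  one : Terms
  one = (1# , 0²) ∷ []

  act-one : ∀ z u → act one z u ≈ z u
  act-one z u = trans (+-identityʳ _) (trans (*-identityˡ _) (reflexive (≡.cong z (-²-identityʳ u))))

  ++-cong : ∀ {p p′ q q′} → p ≋ p′ → q ≋ q′ → p ++ q ≋ p′ ++ q′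
  ++-cong {p} {p′} {q} {q′} h h′ z u = trans (act-++ p q z u) (trans (+-cong (h z u) (h′ z u)) (sym (act-++ p′ q′ z u)))

  mul-cong : ∀ {p p′ q q′} → p ≋ p′ → q ≋ q′ → mul p q ≋ mul p′ q′
  mul-cong {p} {p′} {q} {q′} h h′ z u =
    trans (act-mul p q z u) (trans (act-cong p (h′ z) u) (trans (h (act q′ z) u) (sym (act-mul p′ q′ z u))))

  mul-comm : ∀ p q → mul p q ≋ mul q p
  mul-comm p q z u = trans (act-mul p q z u) (trans (act-comm p q z u) (sym (act-mul q p z u)))

  mul-identityˡ : ∀ p → mul one p ≋ p
  mul-identityˡ p z u = trans (act-mul one p z u) (act-one (act p z) u)

  mul-distribʳ : ∀ p q r → mul (q ++ r) p ≋ mul q p ++ mul r p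
  mul-distribʳ p q r z u = begin
    act (mul (q ++ r) p) z u                      ≈⟨ act-mul (q ++ r) p z u ⟩
    act (q ++ r) (act p z) u                      ≈⟨ act-++ q r (act p z) u ⟩
    act q (act p z) u + act r (act p z) u         ≈⟨ sym (+-cong (act-mul q p z u) (act-mul r p z u)) ⟩
    act (mul q p) z u + act (mul r p) z u         ≈⟨ sym (act-++ (mul q p) (mul r p) z u) ⟩
    act (mul q p ++ mul r p) z u                  ∎

  mul-assoc : ∀ p q r → mul (mul p q) r ≋ mul p (mul q r)
  mul-assoc p q r z u = begin
    act (mul (mul p q) r) z u         ≈⟨ act-mul (mul p q) r z u ⟩
    act (mul p q) (act r z) u         ≈⟨ act-mul p q (act r z) u ⟩
    act p (act q (act r z)) u         ≈⟨ sym (act-cong p (act-mul q r z) u) ⟩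
    act p (act (mul q r) z) u         ≈⟨ sym (act-mul p (mul q r) z u) ⟩
    act (mul p (mul q r)) z u         ∎

  -- Packaged as a ring so that `FreshmansDream` applies to Laurent polynomials themselves.
  operators : CommutativeRing c (c ⊔ ℓ)
  operators = record
    { Carrier = Terms ; _≈_ = _≋_ ; _+_ = _++_ ; _*_ = mul ; -_ = negate ; 0# = [] ; 1# = one
    ; isCommutativeRing = isCommutativeRingˡ }
    where
    ++-comm : ∀ p q → p ++ q ≋ q ++ p
    ++-comm p q z u = trans (act-++ p q z u) (trans (+-comm _ _) (sym (act-++ q p z u)))
    open import Algebra.Structures _≋_ using (IsCommutativeRing)
    isCommutativeRingˡ : IsCommutativeRing _++_ mul negate [] one
    isCommutativeRingˡ = record
      { isRing = record
        { +-isAbelianGroup = record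
          { isGroup = record
            { isMonoid = record
              { isSemigroup = record
                { isMagma = record
                  { isEquivalence = record
                    { refl = λ z u → refl ; sym = λ h z u → sym (h z u) ; trans = λ h h′ z u → trans (h z u) (h′ z u) }
                  ; ∙-cong = λ {p} {p′} {q} {q′} → ++-cong {p} {p′} {q} {q′} }
                ; assoc = λ p q r z u → reflexive (≡.cong (λ l → act l z u) (++-assoc p q r)) }
              ; identity = (λ p z u → refl) , (λ p z u → reflexive (≡.cong (λ l → act l z u) (++-identityʳ p))) }
            ; inverse = invˡ , (λ p z u → trans (++-comm p (negate p) z u) (invˡ p z u))
            ; ⁻¹-cong = λ {p} {q} h z u → trans (act-negate p z u) (trans (-‿cong (h z u)) (sym (act-negate q z u))) }
          ; comm = ++-comm }
        ; *-cong = λ {p} {p′} {q} {q′} → mul-cong {p} {p′} {q} {q′}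
        ; *-assoc = mul-assoc
        ; *-identity = mul-identityˡ , (λ p z u → trans (mul-comm p one z u) (mul-identityˡ p z u))
        ; distrib = (λ p q r z u → trans (mul-comm p (q ++ r) z u) (trans (mul-distribʳ p q r z u) (++-cong {mul q p} {mul p q} {mul r p} {mul p r} (mul-comm q p) (mul-comm r p) z u))) , mul-distribʳ }
      ; *-comm = mul-comm }
      where
      open import Data.List.Properties using (++-assoc; ++-identityʳ)
      invˡ : ∀ p → negate p ++ p ≋ []
      invˡ p z u = trans (act-++ (negate p) p z u) (trans (+-congʳ (act-negate p z u)) (-‿inverseˡ _))

-- Dilated polynomials acting on a bounded configuration

module Dilation where
  open Plane
  open Binomials using (≤⇒∣!; prime∤1)
  open import Data.Integer using (+_; -[1+_]; ∣_∣) renaming (_+_ to _+ℤ_; _*_ to _*ℤ_; -_ to -ℤ_; _-_ to _-ℤ_)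
  import Data.Integer.Properties as ℤₚ
  open import Data.Integer.Tactic.RingSolver using (solve-∀)
  open import Data.Nat using (ℕ; zero; suc; _+_; _*_; _≤_; _<_; z≤n; _!)
  open import Data.Nat.Properties
  open import Data.Nat.Divisibility using (_∣_; divides; ∣m+n∣m⇒∣n; ∣n⇒∣m*n; ∣-trans; m∣m*n)
  open import Data.Nat.Primality using (Prime; ¬prime[0])
  open import Data.Nat.Primality.Factorisation using (PrimeFactorisation; factorise)
  open import Data.Nat.ListAction using (product)
  open import Data.List using ([]; _∷_; _++_; map)
  open import Data.List.Relation.Unary.All using (All; []; _∷_)
  open import Data.Product using (_,_)
  open import Relation.Nullary using (contradiction; yes; no)
  open import Relation.Binary.PropositionalEquality

  module ℤMod = FreshmansDream ℤₚ.+-*-commutativeRing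
  open Action ℤₚ.+-*-commutativeRing public
  module OpMod = FreshmansDream operators
  open ℤMod using (_≈_mod_; _,_)

  fermat-ℕ : ∀ {p} → Prime p → ∀ n → (+ n) ℤMod.^ p ≈ + n mod p
  fermat-ℕ {zero} pr = contradiction pr ¬prime[0]
  fermat-ℕ {suc m} pr zero = ℤMod.≈⇒mod {suc m} refl
  fermat-ℕ {suc m} pr (suc n) =
    ℤMod.mod-trans {suc m} (ℤMod.freshman pr (+ 1) (+ n))
      (ℤMod.mod-+ {suc m} (ℤMod.≈⇒mod {suc m} (1^ (suc m))) (fermat-ℕ pr n))
    where
    1^ : ∀ k → (+ 1) ℤMod.^ k ≡ + 1
    1^ zero = refl
    1^ (suc k) = trans (ℤₚ.*-identityˡ _) (1^ k)

  fermat : ∀ {p} → Prime p → ∀ k → k ℤMod.^ p ≈ k mod p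
  fermat pr (+ n) = fermat-ℕ pr n
  fermat pr -[1+ n ] = ℤMod.frobenius-neg pr (+ suc n) (fermat-ℕ pr (suc n))

  ×≡* : ∀ n r → n ℤMod.× r ≡ + n *ℤ r
  ×≡* zero r = refl
  ×≡* (suc n) r = trans (cong (r +ℤ_) (×≡* n r)) (l r (+ n))
    where l : ∀ r n → r +ℤ n *ℤ r ≡ (+ 1 +ℤ n) *ℤ r
          l = solve-∀

  act-× : ∀ n q z u → act (n OpMod.× q) z u ≡ + n *ℤ act q z u
  act-× zero q z u = refl
  act-× (suc n) q z u = trans (act-++ q (n OpMod.× q) z u)
    (trans (cong (act q z u +ℤ_) (act-× n q z u)) (l (act q z u) (+ n)))
    where l : ∀ r n → r +ℤ n *ℤ r ≡ (+ 1 +ℤ n) *ℤ r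
          l = solve-∀

  dilate : ℕ → Terms → Terms
  dilate n = map λ (k , e) → k , (+ n) · e

  monomial-^ : ∀ k e n → ((k , e) ∷ []) OpMod.^ n ≋ (k ℤMod.^ n , (+ n) · e) ∷ []
  monomial-^ k e zero z u = cong (λ v → + 1 *ℤ z (u -² v) +ℤ + 0) (sym (0· e))
  monomial-^ k e (suc n) z u = begin
    act (mul ((k , e) ∷ []) (((k , e) ∷ []) OpMod.^ n)) z u
      ≡⟨ act-mul ((k , e) ∷ []) (((k , e) ∷ []) OpMod.^ n) z u ⟩
    act ((k , e) ∷ []) (act (((k , e) ∷ []) OpMod.^ n) z) u
      ≡⟨ act-cong ((k , e) ∷ []) (monomial-^ k e n z) u ⟩
    k *ℤ (k ℤMod.^ n *ℤ z ((u -² e) -² ((+ n) · e)) +ℤ + 0) +ℤ + 0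
      ≡⟨ l k (k ℤMod.^ n) (z ((u -² e) -² ((+ n) · e))) ⟩
    k *ℤ k ℤMod.^ n *ℤ z ((u -² e) -² ((+ n) · e)) +ℤ + 0
      ≡⟨ cong (λ v → k *ℤ k ℤMod.^ n *ℤ z v +ℤ + 0) (sym (trans (cong (u -²_) eq) (-²-+² u e ((+ n) · e)))) ⟩
    k *ℤ k ℤMod.^ n *ℤ z (u -² ((+ suc n) · e)) +ℤ + 0 ∎
    where
    open ≡-Reasoning
    l : ∀ k a y → k *ℤ (a *ℤ y +ℤ + 0) +ℤ + 0 ≡ k *ℤ a *ℤ y +ℤ + 0
    l = solve-∀
    eq : (+ suc n) · e ≡ e +² ((+ n) · e)
    eq = trans (·-distribʳ (+ 1) (+ n) e) (cong (_+² ((+ n) · e)) (1· e))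

  -- The freshman's dream splits G^p into the powers (k X^e)^p = k^p X^(p e), and Fermat's little
  -- theorem replaces k^p by k.
  frobenius : ∀ {p} → Prime p → ∀ G → G OpMod.^ p OpMod.≈ dilate p G mod p
  frobenius {zero} pr = contradiction pr ¬prime[0]
  frobenius {suc m} pr [] = OpMod.≈⇒mod {suc m} {[] OpMod.^ suc m} {[]} λ z u → refl
  frobenius {suc m} pr ((k , e) ∷ G) =
    OpMod.mod-trans {p} {((k , e) ∷ G) OpMod.^ p} {((k , e) ∷ []) OpMod.^ p ++ G OpMod.^ p} {dilate p ((k , e) ∷ G)}
      (OpMod.freshman pr ((k , e) ∷ []) G)
      (OpMod.mod-+ {p} {((k , e) ∷ []) OpMod.^ p} {(k , (+ p) · e) ∷ []} {G OpMod.^ p} {dilate p G} head-term (frobenius pr G))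
    where
    p = suc m
    open ≡-Reasoning
    head-term : ((k , e) ∷ []) OpMod.^ p OpMod.≈ (k , (+ p) · e) ∷ [] mod p
    head-term with fermat pr k
    ... | r , eq = ((r , (+ p) · e) ∷ []) OpMod., λ z u → begin
      act (((k , e) ∷ []) OpMod.^ p) z u           ≡⟨ monomial-^ k e p z u ⟩
      k ℤMod.^ p *ℤ z (u -² ((+ p) · e)) +ℤ + 0
        ≡⟨ cong (λ a → a *ℤ z (u -² ((+ p) · e)) +ℤ + 0) (trans eq (cong (k +ℤ_) (×≡* p r))) ⟩
      (k +ℤ + p *ℤ r) *ℤ z (u -² ((+ p) · e)) +ℤ + 0
        ≡⟨ l k (+ p) r (z (u -² ((+ p) · e))) ⟩
      k *ℤ z (u -² ((+ p) · e)) +ℤ + p *ℤ (r *ℤ z (u -² ((+ p) · e)) +ℤ + 0)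
        ≡⟨ cong (k *ℤ z (u -² ((+ p) · e)) +ℤ_) (sym (act-× p ((r , (+ p) · e) ∷ []) z u)) ⟩
      k *ℤ z (u -² ((+ p) · e)) +ℤ act (p OpMod.× ((r , (+ p) · e) ∷ [])) z u ∎
      where l : ∀ k p r y → (k +ℤ p *ℤ r) *ℤ y +ℤ + 0 ≡ k *ℤ y +ℤ p *ℤ (r *ℤ y +ℤ + 0)
            l = solve-∀

  -- This norm bounds the growth of values under the action. Since dilation leaves it unchanged, one
  -- bound on the primes works for all iterated dilations.
  weight : Terms → ℕ
  weight [] = 0
  weight ((k , e) ∷ G) = ∣ k ∣ + weight G

  weight-dilate : ∀ n G → weight (dilate n G) ≡ weight G
  weight-dilate n [] = refl
  weight-dilate n ((k , e) ∷ G) = cong (λ w → ∣ k ∣ + w) (weight-dilate n G)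

  act-bounded : ∀ G {z : Fun} {B} → (∀ u → ∣ z u ∣ ≤ B) → ∀ u → ∣ act G z u ∣ ≤ weight G * B
  act-bounded [] h u = z≤n
  act-bounded ((k , e) ∷ G) {z} {B} h u = begin
    ∣ k *ℤ z (u -² e) +ℤ act G z u ∣             ≤⟨ ℤₚ.∣i+j∣≤∣i∣+∣j∣ (k *ℤ z (u -² e)) (act G z u) ⟩
    ∣ k *ℤ z (u -² e) ∣ + ∣ act G z u ∣           ≡⟨ cong (_+ ∣ act G z u ∣) (ℤₚ.abs-* k (z (u -² e))) ⟩
    ∣ k ∣ * ∣ z (u -² e) ∣ + ∣ act G z u ∣        ≤⟨ +-mono-≤ (*-monoʳ-≤ ∣ k ∣ (h (u -² e))) (act-bounded G h u) ⟩
    ∣ k ∣ * B + weight G * B                      ≡⟨ *-distribʳ-+ B ∣ k ∣ (weight G) ⟨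
    (∣ k ∣ + weight G) * B                        ∎
    where open ≤-Reasoning

  Const : Fun → Set
  Const z = ∀ u v → z u ≡ z v

  act-const : ∀ G {z} → Const z → Const (act G z)
  act-const [] h u v = refl
  act-const ((k , e) ∷ G) h u v = cong₂ (λ a b → k *ℤ a +ℤ b) (h (u -² e) (v -² e)) (act-const G h u v)

  small-multiple : ∀ p x y → ∣ p *ℤ x ∣ ≤ y → y < ∣ p ∣ → p *ℤ x ≡ + 0
  small-multiple p x y h h′ = by-size ∣ x ∣ refl
    where
    by-size : ∀ n → ∣ x ∣ ≡ n → p *ℤ x ≡ + 0
    by-size zero eq = trans (cong (p *ℤ_) (ℤₚ.∣i∣≡0⇒i≡0 eq)) (ℤₚ.*-zeroʳ p)
    by-size (suc n) eq = contradiction h′ (≤⇒≯ (begin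
      ∣ p ∣             ≤⟨ m≤m*n ∣ p ∣ (suc n) ⟩
      ∣ p ∣ * suc n     ≡⟨ cong (∣ p ∣ *_) (sym eq) ⟩
      ∣ p ∣ * ∣ x ∣     ≡⟨ sym (ℤₚ.abs-* p x) ⟩
      ∣ p *ℤ x ∣        ≤⟨ h ⟩
      y                ∎))
      where open ≤-Reasoning

  dilate-dilate : ∀ m n G → dilate m (dilate n G) ≡ dilate (m * n) G
  dilate-dilate m n [] = refl
  dilate-dilate m n ((k , e) ∷ G) = cong₂ (λ v l → (k , v) ∷ l)
    (trans (sym (·-assoc (+ m) (+ n) e)) (cong (_· e) (sym (ℤₚ.pos-* m n)))) (dilate-dilate m n G)

  dilate-1 : ∀ G → dilate 1 G ≡ G
  dilate-1 [] = refl
  dilate-1 ((k , e) ∷ G) = cong₂ (λ v l → (k , v) ∷ l) (1· e) (dilate-1 G)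

  -- A prime up to N divides N!; dividing 1 + j N! as well, it would divide 1.
  large-factors : ∀ N j ps → All Prime ps → product ps ∣ suc (j * N !) → All (N <_) ps
  large-factors N j [] [] d = []
  large-factors N j (p ∷ ps) (pr ∷ prs) d with p ≤? N
  ... | no p≰N = ≰⇒> p≰N ∷ large-factors N j ps prs (∣-trans (divides p refl) d)
  ... | yes p≤N = contradiction
    (∣m+n∣m⇒∣n (subst (p ∣_) (+-comm 1 (j * N !)) (∣-trans (m∣m*n (product ps)) d)) (∣n⇒∣m*n j (≤⇒∣! (n≢0⇒n>0 (λ { refl → ¬prime[0] pr })) p≤N)))
    (prime∤1 pr)

  module _ {c : Fun} (bounded : ∀ u → ∣ c u ∣ ≤ 1) where

    -- G(X)^p and G(X^p) agree modulo p, and the values of G(X^p) c are too small to differ by a multiple of p.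
    dilate-prime : ∀ {p} → Prime p → ∀ G → weight G + weight G < p → Const (act G c) → Const (act (dilate p G) c)
    dilate-prime {zero} pr = contradiction pr ¬prime[0]
    dilate-prime {p@(suc m)} pr G small const u v = ℤₚ.i-j≡0⇒i≡j x y (trans x-y≡ (small-multiple (+ p) (s v -ℤ s u) (weight G + weight G) bound small))
      where
      R = OpMod.factor (frobenius pr G)
      s : Fun
      s = act R c
      x = act (dilate p G) c u
      y = act (dilate p G) c v
      power : ∀ u → act (G OpMod.^ p) c u ≡ act (dilate p G) c u +ℤ + p *ℤ s u
      power u = trans (OpMod.equation (frobenius pr G) c u)
        (trans (act-++ (dilate p G) (p OpMod.× R) c u) (cong (act (dilate p G) c u +ℤ_) (act-× p R c u)))
      power-const : Const (act (G OpMod.^ p) c)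
      power-const u v = trans (flip-mul u) (trans (act-const (G OpMod.^ m) const u v) (sym (flip-mul v)))
        where
        flip-mul : ∀ u → act (mul G (G OpMod.^ m)) c u ≡ act (G OpMod.^ m) (act G c) u
        flip-mul u = trans (act-mul G (G OpMod.^ m) c u) (act-comm G (G OpMod.^ m) c u)
      x-y≡ : x -ℤ y ≡ + p *ℤ (s v -ℤ s u)
      x-y≡ = begin
        x -ℤ y                                          ≡⟨ l x y (+ p) (s u) (s v) ⟩
        (x +ℤ + p *ℤ s u) -ℤ (y +ℤ + p *ℤ s v) +ℤ + p *ℤ (s v -ℤ s u)
          ≡⟨ cong (_+ℤ + p *ℤ (s v -ℤ s u)) (ℤₚ.i≡j⇒i-j≡0 (trans (sym (power u)) (trans (power-const u v) (power v)))) ⟩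
        + 0 +ℤ + p *ℤ (s v -ℤ s u)                      ≡⟨ ℤₚ.+-identityˡ _ ⟩
        + p *ℤ (s v -ℤ s u) ∎
        where
        open ≡-Reasoning
        l : ∀ x y p a b → x -ℤ y ≡ (x +ℤ p *ℤ a) -ℤ (y +ℤ p *ℤ b) +ℤ p *ℤ (b -ℤ a)
        l = solve-∀
      bound : ∣ + p *ℤ (s v -ℤ s u) ∣ ≤ weight G + weight G
      bound = begin
        ∣ + p *ℤ (s v -ℤ s u) ∣    ≡⟨ cong ∣_∣ (sym x-y≡) ⟩
        ∣ x -ℤ y ∣                 ≤⟨ ℤₚ.∣i-j∣≤∣i∣+∣j∣ x y ⟩
        ∣ x ∣ + ∣ y ∣              ≤⟨ +-mono-≤ (le u) (le v) ⟩
        weight G + weight G        ∎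
        where
        open ≤-Reasoning
        le : ∀ u → ∣ act (dilate p G) c u ∣ ≤ weight G
        le u = ≤-trans (act-bounded (dilate p G) bounded u) (≤-reflexive (trans (*-identityʳ _) (weight-dilate p G)))

    module _ (G : Terms) (const : Const (act G c)) where

      dilate-primes : ∀ ps → All Prime ps → All (weight G + weight G <_) ps → Const (act (dilate (product ps) G) c)
      dilate-primes [] [] [] = subst (λ H → Const (act H c)) (sym (dilate-1 G)) const
      dilate-primes (p ∷ ps) (pr ∷ prs) (lt ∷ lts) =
        subst (λ H → Const (act H c)) (dilate-dilate p (product ps) G)
          (dilate-prime pr (dilate (product ps) G)
            (subst (λ w → w + w < p) (sym (weight-dilate (product ps) G)) lt)
            (dilate-primes ps prs lts))

      -- The exponent is a product of primes above twice the weight, and the dilations by them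
      -- compose. An arithmetic progression of exponents is what elimination needs: the monomials
      -- then run through geometric progressions in j.
      dilate-progression : ∀ j → Const (act (dilate (suc (j * (weight G + weight G) !)) G) c)
      dilate-progression j = subst (λ k → Const (act (dilate k G) c)) (sym isFactorisation)
          (dilate-primes factors factorsPrime (large-factors (weight G + weight G) j factors factorsPrime (divides 1 (trans isFactorisation (sym (*-identityˡ _))))))
        where open PrimeFactorisation (factorise (suc (j * (weight G + weight G) !)))

-- Difference operators and Vandermonde elimination

module Differences where
  open Plane
  open Dilation
  open import Data.Integer using (ℤ; +_; ∣_∣) renaming (_+_ to _+ℤ_; _*_ to _*ℤ_; -_ to -ℤ_; _-_ to _-ℤ_)
  import Data.Integer.Properties as ℤₚ
  open import Data.Integer.Tactic.RingSolver using (solve-∀)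
  open import Data.Nat using (ℕ; suc; _+_; _*_; _^_; _≤_; _!)
  open import Data.Nat.Properties using (≤-trans; ≤-reflexive; +-mono-≤; +-identityʳ; *-assoc; *-identityˡ; module ≤-Reasoning)
  open import Data.List using (List; []; _∷_; _++_; map; length; filter)
  open import Data.List.Relation.Unary.All as All using (All; []; _∷_)
  open import Data.List.Relation.Unary.Any using (here; there)
  open import Data.List.Membership.Propositional using (_∈_)
  open import Data.List.Membership.Propositional.Properties using (∈-filter⁺)
  import Data.List.Relation.Unary.All.Properties as Allₚ
  open import Data.Product using (_,_; proj₁; proj₂)
  open import Data.Sum using (inj₁; inj₂)
  open import Relation.Nullary using (¬_; ¬?; contradiction; yes; no)
  open import Relation.Binary.PropositionalEquality

  -- The operator X^(-w) - 1, which is the binomial X^w - 1 up to a unit; its kernel consists of the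
  -- functions of period w.
  Δ : ℤ² → Fun → Fun
  Δ w z u = z (u +² w) -ℤ z u

  Δs : List ℤ² → Fun → Fun
  Δs [] z = z
  Δs (w ∷ ws) z = Δ w (Δs ws z)

  Δ-cong : ∀ w {y z} → y ≗ z → Δ w y ≗ Δ w z
  Δ-cong w h u = cong₂ _-ℤ_ (h (u +² w)) (h u)

  Δs-cong : ∀ ws {y z} → y ≗ z → Δs ws y ≗ Δs ws z
  Δs-cong [] h = h
  Δs-cong (w ∷ ws) h = Δ-cong w (Δs-cong ws h)

  Δ-comm : ∀ v w z → Δ v (Δ w z) ≗ Δ w (Δ v z)
  Δ-comm v w z u rewrite trans (+²-assoc u v w) (trans (cong (u +²_) (+²-comm v w)) (sym (+²-assoc u w v))) =
    l (z ((u +² w) +² v)) (z (u +² v)) (z (u +² w)) (z u)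
    where l : ∀ a b c d → a -ℤ b -ℤ (c -ℤ d) ≡ a -ℤ c -ℤ (b -ℤ d)
          l = solve-∀

  Δs-Δ : ∀ ws w z → Δs ws (Δ w z) ≗ Δ w (Δs ws z)
  Δs-Δ [] w z u = refl
  Δs-Δ (v ∷ ws) w z u = trans (Δ-cong v (Δs-Δ ws w z) u) (Δ-comm v w (Δs ws z) u)

  Δs-move : ∀ vs w ws z → Δs (vs ++ w ∷ ws) z ≗ Δ w (Δs (vs ++ ws) z)
  Δs-move [] w ws z u = refl
  Δs-move (v ∷ vs) w ws z u = trans (Δ-cong v (Δs-move vs w ws z) u) (Δ-comm v w (Δs (vs ++ ws) z) u)

  Vanishes : Fun → Set
  Vanishes z = ∀ u → z u ≡ + 0

  Δ-0 : ∀ w {z} → Vanishes z → Vanishes (Δ w z)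
  Δ-0 w h u = cong₂ _-ℤ_ (h (u +² w)) (h u)

  act-Δ : ∀ p w z → act p (Δ w z) ≗ Δ w (act p z)
  act-Δ p w z u = trans (act-+ p (λ v → z (v +² w)) (λ v → -ℤ z v) u) (cong₂ _+ℤ_ (act-shift p z w u) (act-neg p z u))

  act-Δs : ∀ p ws z → act p (Δs ws z) ≗ Δs ws (act p z)
  act-Δs p [] z u = refl
  act-Δs p (w ∷ ws) z u = trans (act-Δ p w (Δs ws z) u) (Δ-cong w (act-Δs p ws z) u)

  Δs-0 : ∀ ws {z} → Vanishes z → Vanishes (Δs ws z)
  Δs-0 [] h = h
  Δs-0 (w ∷ ws) h = Δ-0 w (Δs-0 ws h)

  Δs-bounded : ∀ ws {z B} → (∀ u → ∣ z u ∣ ≤ B) → ∀ u → ∣ Δs ws z u ∣ ≤ 2 ^ length ws * B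
  Δs-bounded [] h u = ≤-trans (h u) (≤-reflexive (sym (*-identityˡ _)))
  Δs-bounded (w ∷ ws) {z} {B} h u = begin
    ∣ y (u +² w) -ℤ y u ∣          ≤⟨ ℤₚ.∣i-j∣≤∣i∣+∣j∣ (y (u +² w)) (y u) ⟩
    ∣ y (u +² w) ∣ + ∣ y u ∣       ≤⟨ +-mono-≤ (Δs-bounded ws h (u +² w)) (Δs-bounded ws h u) ⟩
    K * B + K * B                  ≡⟨ cong (λ k → K * B + k) (sym (+-identityʳ (K * B))) ⟩
    2 * (K * B)                    ≡⟨ sym (*-assoc 2 K B) ⟩
    2 ^ suc (length ws) * B        ∎
    where
    open ≤-Reasoning
    y = Δs ws z
    K = 2 ^ length ws

  Δs-const : ∀ ws {z} → Const z → Const (Δs ws z)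
  Δs-const [] h = h
  Δs-const (w ∷ ws) h u v = cong₂ _-ℤ_ (Δs-const ws h (u +² w) (v +² w)) (Δs-const ws h u v)

  coef : Terms → ℤ² → ℤ
  coef [] x = + 0
  coef ((k , e) ∷ p) x with e ≟² x
  ... | yes _ = k +ℤ coef p x
  ... | no _  = coef p x

  others : Terms → ℤ² → List ℤ²
  others G x = filter (λ v → ¬? (v ≟² x)) (map proj₂ G)

  -- The directions of the binomials left by eliminating all exponents but `x`. An exponent that
  -- occurs in several terms is listed repeatedly, which only lengthens the product.
  gaps : Terms → ℤ² → ℕ → List ℤ²
  gaps G x m = map (λ v → (+ m) · (v -² x)) (others G x)

  module Elimination (m : ℕ) where

    private
      step : ℤ² → ℤ² → Fun → Fun
      step x v f u = f (u -² ((+ m) · x)) -ℤ f (u -² ((+ m) · v))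

      steps : ℤ² → List ℤ² → Fun → Fun
      steps x [] f = f
      steps x (v ∷ V) f = steps x V (step x v f)

      -- The j-th equation, the sum of k Y^j E(x) with Y = X^(m x). The family `E`, initially X^x z,
      -- is left arbitrary so that it can absorb the factors of the elimination.
      total : (ℤ² → Fun) → Terms → ℕ → Fun
      total E [] j u = + 0
      total E ((k , x) ∷ G) j u = k *ℤ E x (u -² ((+ (j * m)) · x)) +ℤ total E G j u

      -- With Y and V for X^(m x) and X^(m v), one has (Y - V) Y^j = Y^(j+1) - V Y^j. As V is the
      -- same for all terms, the new system is a combination of consecutive old equations.
      total-step : ∀ E v G j u → total (λ x → step x v (E x)) G j u ≡ total E G (suc j) u -ℤ total E G j (u -² ((+ m) · v))
      total-step E v [] j u = refl
      total-step E v ((k , x) ∷ G) j u = begin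
        k *ℤ (E x ((u -² jx) -² mx) -ℤ E x ((u -² jx) -² mv)) +ℤ total (λ x → step x v (E x)) G j u
          ≡⟨ cong₂ (λ a b → k *ℤ (E x a -ℤ E x b) +ℤ total (λ x → step x v (E x)) G j u) merge (-²-comm u jx mv) ⟩
        k *ℤ (E x (u -² sx) -ℤ E x ((u -² mv) -² jx)) +ℤ total (λ x → step x v (E x)) G j u
          ≡⟨ cong (λ t → k *ℤ (E x (u -² sx) -ℤ E x ((u -² mv) -² jx)) +ℤ t) (total-step E v G j u) ⟩
        k *ℤ (E x (u -² sx) -ℤ E x ((u -² mv) -² jx)) +ℤ (total E G (suc j) u -ℤ total E G j (u -² mv))
          ≡⟨ l k (E x (u -² sx)) (E x ((u -² mv) -² jx)) (total E G (suc j) u) (total E G j (u -² mv)) ⟩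
        (k *ℤ E x (u -² sx) +ℤ total E G (suc j) u) -ℤ (k *ℤ E x ((u -² mv) -² jx) +ℤ total E G j (u -² mv)) ∎
        where
        open ≡-Reasoning
        jx = (+ (j * m)) · x
        sx = (+ (suc j * m)) · x
        mx = (+ m) · x
        mv = (+ m) · v
        merge : (u -² jx) -² mx ≡ u -² sx
        merge = trans (-²-comm u jx mx) (trans (sym (-²-+² u mx jx)) (cong (u -²_) (sym (·-distribʳ (+ m) (+ (j * m)) x))))
        l : ∀ k a b s t → k *ℤ (a -ℤ b) +ℤ (s -ℤ t) ≡ (k *ℤ a +ℤ s) -ℤ (k *ℤ b +ℤ t)
        l = solve-∀

      total-steps : ∀ V E G → (∀ j u → total E G j u ≡ + 0) → ∀ j u → total (λ x → steps x V (E x)) G j u ≡ + 0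
      total-steps [] E G h = h
      total-steps (v ∷ V) E G h = total-steps V (λ x → step x v (E x)) G
        λ j u → trans (total-step E v G j u) (cong₂ _-ℤ_ (h (suc j) u) (h j (u -² ((+ m) · v))))

      steps-0 : ∀ x V f → Vanishes f → Vanishes (steps x V f)
      steps-0 x [] f h = h
      steps-0 x (v ∷ V) f h = steps-0 x V (step x v f) λ u → cong₂ _-ℤ_ (h (u -² ((+ m) · x))) (h (u -² ((+ m) · v)))

      steps-∈ : ∀ {x V} → x ∈ V → ∀ f → Vanishes (steps x V f)
      steps-∈ {x} {_ ∷ V} (here refl) f = steps-0 x V (step x x f) λ u → ℤₚ.+-inverseʳ (f (u -² ((+ m) · x)))
      steps-∈ {x} {v ∷ V} (there x∈V) f = steps-∈ x∈V (step x v f)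

      origin : ∀ u x → u -² ((+ (0 * m)) · x) ≡ u
      origin u x = trans (cong (u -²_) (0· x)) (-²-identityʳ u)

      -- Read at j = 0, where no power of Y is left; the terms with exponent `x` may be several, and
      -- their coefficients add up.
      total-survivor : ∀ F x G → (∀ {y} → y ∈ map proj₂ G → ¬ (y ≡ x) → Vanishes (F y)) → ∀ u → total F G 0 u ≡ coef G x *ℤ F x u
      total-survivor F x [] h u = refl
      total-survivor F x ((k , e) ∷ G) h u with e ≟² x
      ... | yes refl = begin
            k *ℤ F e (u -² ((+ (0 * m)) · e)) +ℤ total F G 0 u   ≡⟨ cong₂ (λ a b → k *ℤ F e a +ℤ b) (origin u e) (total-survivor F e G (λ y∈ → h (there y∈)) u) ⟩
            k *ℤ F e u +ℤ coef G e *ℤ F e u                      ≡⟨ sym (ℤₚ.*-distribʳ-+ (F e u) k (coef G e)) ⟩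
            (k +ℤ coef G e) *ℤ F e u                             ∎
            where open ≡-Reasoning
      ... | no e≢x = begin
            k *ℤ F e (u -² ((+ (0 * m)) · e)) +ℤ total F G 0 u   ≡⟨ cong₂ (λ a b → k *ℤ a +ℤ b) (h (here refl) e≢x _) (total-survivor F x G (λ y∈ → h (there y∈)) u) ⟩
            k *ℤ + 0 +ℤ coef G x *ℤ F x u                        ≡⟨ cong (_+ℤ coef G x *ℤ F x u) (ℤₚ.*-zeroʳ k) ⟩
            + 0 +ℤ coef G x *ℤ F x u                             ≡⟨ ℤₚ.+-identityˡ _ ⟩
            coef G x *ℤ F x u                                    ∎
            where open ≡-Reasoning

      offset : List ℤ² → ℤ²
      offset [] = 0²
      offset (v ∷ V) = offset V +² ((+ m) · v)

      Δs-shift⁻ : ∀ ws f v u → Δs ws (λ t → f (t -² v)) u ≡ Δs ws f (u -² v)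
      Δs-shift⁻ [] f v u = refl
      Δs-shift⁻ (w ∷ ws) f v u = cong₂ _-ℤ_ (trans (Δs-shift⁻ ws f v (u +² w)) (cong (Δs ws f) (sym (-²+² u v w)))) (Δs-shift⁻ ws f v u)

      -- Each factor X^(m x) - X^(m v) is X^(m v) times the difference operator for m (v - x); the
      -- monomials accumulate in `offset`.
      steps≡Δs : ∀ x V f u → steps x V f u ≡ Δs (map (λ v → (+ m) · (v -² x)) V) f (u -² offset V)
      steps≡Δs x [] f u = cong f (sym (-²-identityʳ u))
      steps≡Δs x (v ∷ V) f u = begin
        steps x V (step x v f) u                          ≡⟨ steps≡Δs x V (step x v f) u ⟩
        Δs ws (step x v f) (u -² offset V)                ≡⟨ Δs-cong ws step≡Δ (u -² offset V) ⟩
        Δs ws (λ t → Δ w f (t -² mv)) (u -² offset V)     ≡⟨ Δs-shift⁻ ws (Δ w f) mv (u -² offset V) ⟩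
        Δs ws (Δ w f) ((u -² offset V) -² mv)             ≡⟨ Δs-Δ ws w f _ ⟩
        Δ w (Δs ws f) ((u -² offset V) -² mv)             ≡⟨ cong (Δ w (Δs ws f)) (sym (-²-+² u (offset V) mv)) ⟩
        Δ w (Δs ws f) (u -² (offset V +² mv))             ∎
        where
        open ≡-Reasoning
        ws = map (λ v → (+ m) · (v -² x)) V
        w = (+ m) · (v -² x)
        mv = (+ m) · v
        step≡Δ : ∀ t → step x v f t ≡ Δ w f (t -² mv)
        step≡Δ t = cong (λ s → f s -ℤ f (t -² mv))
          (sym (trans (cong ((t -² mv) +²_) (·-distribˡ-² (+ m) v x)) (-²+²-² t mv ((+ m) · x))))

    -- Vandermonde elimination: the equations are Σ k Y^j X^e z = 0 with Y = X^(m e), so multiplying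
    -- by the product of the X^(m x) - X^(m e) over all e ≠ x isolates the coefficient at x.
    eliminate : ∀ G x → ¬ (coef G x ≡ + 0) → ∀ z → (∀ j → Vanishes (act (dilate (suc (j * m)) G) z)) →
                Vanishes (Δs (gaps G x m) z)
    eliminate G x k≢0 z h u = begin
      Δs (gaps G x m) z u                                       ≡⟨ cong (Δs (gaps G x m) z) (sym back) ⟩
      Δs (gaps G x m) z ((u′ -² offset V) -² x)                 ≡⟨ sym (Δs-shift⁻ (gaps G x m) z x (u′ -² offset V)) ⟩
      Δs (gaps G x m) (λ t → z (t -² x)) (u′ -² offset V)       ≡⟨ sym (steps≡Δs x V (E x) u′) ⟩
      F x u′                                                    ≡⟨ zero-factor (trans (sym (total-survivor F x G dies u′)) (total-steps V E G start 0 u′)) ⟩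
      + 0                                                       ∎
      where
      open ≡-Reasoning
      V = others G x
      u′ = (u +² x) +² offset V
      back : (u′ -² offset V) -² x ≡ u
      back = trans (cong (_-² x) (-²-cancel+² (u +² x) (offset V))) (-²-cancel+² u x)
      E : ℤ² → Fun
      E y t = z (t -² y)
      F : ℤ² → Fun
      F y = steps y V (E y)
      dies : ∀ {y} → y ∈ map proj₂ G → ¬ (y ≡ x) → Vanishes (F y)
      dies {y} y∈ y≢x = steps-∈ (∈-filter⁺ (λ v → ¬? (v ≟² x)) y∈ y≢x) (E y)
      zero-factor : coef G x *ℤ F x u′ ≡ + 0 → F x u′ ≡ + 0
      zero-factor eq with ℤₚ.i*j≡0⇒i≡0∨j≡0 (coef G x) eq
      ... | inj₁ k≡0 = contradiction k≡0 k≢0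
      ... | inj₂ f≡0 = f≡0
      total≡act : ∀ H j t → total E H j t ≡ act (dilate (suc (j * m)) H) z t
      total≡act [] j t = refl
      total≡act ((k , y) ∷ H) j t = cong₂ (λ a b → k *ℤ z a +ℤ b)
        (trans (sym (-²-+² t ((+ (j * m)) · y) y)) (cong (t -²_) (trans (+²-comm ((+ (j * m)) · y) y)
          (sym (trans (·-distribʳ (+ 1) (+ (j * m)) y) (cong (_+² ((+ (j * m)) · y)) (1· y)))))))
        (total≡act H j t)
      start : ∀ j t → total E G j t ≡ + 0
      start j t = trans (total≡act G j t) (h j t)

  -- The dilated equations for `c` have unknown constants on the right. One difference in an
  -- arbitrary direction `w` makes them homogeneous, so that elimination applies to `Δ w c`.
  annihilated-by-gaps : ∀ G {c} → (∀ u → ∣ c u ∣ ≤ 1) → Const (act G c) → ∀ x → ¬ (coef G x ≡ + 0) → ∀ w →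
    Vanishes (Δs (gaps G x ((weight G + weight G) !)) (Δ w c))
  annihilated-by-gaps G {c} bounded const x k≢0 w =
    Elimination.eliminate _ G x k≢0 (Δ w c) λ j u →
      trans (act-Δ (dilate (suc (j * _)) G) w c u)
        (ℤₚ.i≡j⇒i-j≡0 (dilate-progression bounded G const j (u +² w) u))

  gaps-nonzero : ∀ G x n → All (λ w → ¬ (w ≡ 0²)) (gaps G x (n !))
  gaps-nonzero G x n = Allₚ.map⁺ (All.map nonzero (Allₚ.all-filter (λ v → ¬? (v ≟² x)) (map proj₂ G)))
    where
    open import Data.Nat.Properties using (_!≢0)
    open import Data.Nat using (≢-nonZero⁻¹)
    cancel : ∀ a b → + (n !) *ℤ (a -ℤ b) ≡ + 0 → a ≡ b
    cancel a b eq with ℤₚ.i*j≡0⇒i≡0∨j≡0 (+ (n !)) eq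
    ... | inj₁ n!≡0 = contradiction (ℤₚ.+-injective n!≡0) (≢-nonZero⁻¹ (n !) {{n !≢0}})
    ... | inj₂ eq′ = ℤₚ.i-j≡0⇒i≡j a b eq′
    nonzero : ∀ {v} → ¬ (v ≡ x) → ¬ ((+ (n !)) · (v -² x) ≡ 0²)
    nonzero {a , b} v≢x eq = v≢x (cong₂ _,_ (cancel a (proj₁ x) (cong proj₁ eq)) (cancel b (proj₂ x) (cong proj₂ eq)))

-- Unimodular bases adapted to a direction

module Bases where
  open Plane
  open import Data.Integer using (ℤ; +_; -[1+_]; ∣_∣; _+_; _*_; -_; _-_)
  import Data.Integer.Properties as ℤₚ
  open import Data.Integer.Tactic.RingSolver using (solve-∀)
  open import Data.Nat as ℕ using (ℕ; zero; suc)
  import Data.Nat.Properties as ℕₚ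
  open import Data.Nat.Divisibility using (divides)
  open import Data.Nat.GCD using (GCD; module Bézout)
  open import Data.Product using (∃; ∃₂; _×_; _,_; proj₁; proj₂)
  open import Relation.Nullary using (contradiction)
  open import Relation.Binary.PropositionalEquality

  -- Here `d` is the primitive vector along `w`. Storing the predecessor of the index keeps the
  -- index visibly positive for divisions with remainder. Lines in direction `w` are the rows of
  -- constant second coordinate of `point`.
  record Basis (w : ℤ²) : Set where
    field
      index-1 : ℕ
      d d′ : ℤ²
      multiple : w ≡ (+ suc index-1) · d
      unimodular : cross d d′ ≡ + 1

    index : ℕ
    index = suc index-1

    point : ℤ → ℤ → ℤ²
    point i t = i · d +² t · d′

    point-+ : ∀ i t j s → point (i + j) (t + s) ≡ point i t +² point j s
    point-+ i t j s = cong₂ _,_ (l i t j s (proj₁ d) (proj₁ d′)) (l i t j s (proj₂ d) (proj₂ d′))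
      where l : ∀ i t j s x y → (i + j) * x + (t + s) * y ≡ (i * x + t * y) + (j * x + s * y)
            l = solve-∀

    coordinates : ∀ u → u ≡ point (cross u d′) (cross d u)
    coordinates (x , y) = cong₂ _,_
      (trans (trans (sym (ℤₚ.*-identityʳ x)) (cong (x *_) (sym unimodular))) (l₁ (proj₁ d) (proj₂ d) (proj₁ d′) (proj₂ d′) x y))
      (trans (trans (sym (ℤₚ.*-identityʳ y)) (cong (y *_) (sym unimodular))) (l₂ (proj₁ d) (proj₂ d) (proj₁ d′) (proj₂ d′) x y))
      where
      l₁ : ∀ a b a′ b′ x y → x * (a * b′ - b * a′) ≡ (x * b′ - y * a′) * a + (a * y - b * x) * a′
      l₁ = solve-∀
      l₂ : ∀ a b a′ b′ x y → y * (a * b′ - b * a′) ≡ (x * b′ - y * a′) * b + (a * y - b * x) * b′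
      l₂ = solve-∀

  private
    sign-abs : ∀ a → ∃ λ s → s * s ≡ + 1 × a ≡ s * + ∣ a ∣
    sign-abs (+ n) = + 1 , refl , sym (ℤₚ.*-identityˡ (+ n))
    sign-abs -[1+ n ] = -[1+ 0 ] , refl , sym (ℤₚ.-1*i≡-i (+ suc n))

    bezout : ∀ {g m n} → Bézout.Identity g m n → ∃₂ λ X Y → X * + m + Y * + n ≡ + g
    bezout {g} {m} {n} (Bézout.+- x y eq) = + x , - + y , (begin
        + x * + m + - + y * + n                      ≡⟨ cong (_+ - + y * + n) (sym (ℤₚ.pos-* x m)) ⟩
        + (x ℕ.* m) + - + y * + n                    ≡⟨ cong (λ k → + k + - + y * + n) (sym eq) ⟩
        + g + + (y ℕ.* n) + - + y * + n              ≡⟨ cong (λ k → + g + k + - + y * + n) (ℤₚ.pos-* y n) ⟩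
        + g + + y * + n + - + y * + n                ≡⟨ l (+ g) (+ y) (+ n) ⟩
        + g                                          ∎)
      where
      open ≡-Reasoning
      l : ∀ g y n → g + y * n + - y * n ≡ g
      l = solve-∀
    bezout {g} {m} {n} (Bézout.-+ x y eq) = - + x , + y , (begin
        - + x * + m + + y * + n                      ≡⟨ cong (λ k → - + x * + m + k) (sym (ℤₚ.pos-* y n)) ⟩
        - + x * + m + + (y ℕ.* n)                    ≡⟨ cong (λ k → - + x * + m + + k) (sym eq) ⟩
        - + x * + m + (+ g + + (x ℕ.* m))            ≡⟨ cong (λ k → - + x * + m + (+ g + k)) (ℤₚ.pos-* x m) ⟩
        - + x * + m + (+ g + + x * + m)              ≡⟨ l (+ g) (+ x) (+ m) ⟩
        + g                                          ∎)
      where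
      open ≡-Reasoning
      l : ∀ g x m → - x * m + (g + x * m) ≡ g
      l = solve-∀

  -- abstract, lest with-abstractions unfold the extended Euclidean algorithm
  abstract
    basis : ∀ w → ¬ (w ≡ 0²) → Basis w
    basis (a , b) w≢0 with sign-abs a | sign-abs b | Bézout.lemma ∣ a ∣ ∣ b ∣
    ... | s , ss , a≡ | r , rr , b≡ | Bézout.result g gcd id with GCD.commonDivisor gcd | bezout id
    ...   | divides p p≡ , divides q q≡ | X , Y , XY = from g p≡ q≡ XY
      where
      from : ∀ g → ∣ a ∣ ≡ p ℕ.* g → ∣ b ∣ ≡ q ℕ.* g → X * + ∣ a ∣ + Y * + ∣ b ∣ ≡ + g → Basis (a , b)
      from zero p≡ q≡ _ = contradiction (cong₂ _,_ (ℤₚ.∣i∣≡0⇒i≡0 (trans p≡ (ℕₚ.*-zeroʳ p))) (ℤₚ.∣i∣≡0⇒i≡0 (trans q≡ (ℕₚ.*-zeroʳ q)))) w≢0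
      from (suc g) p≡ q≡ XY = record
        { index-1 = g
        -- The signs s and r square to 1 and reduce everything to absolute values. The determinant
        -- becomes X p + Y q, which is 1 after cancelling the gcd in Bézout's identity X |a| + Y |b|
        -- = g.
        ; d = s * + p , r * + q
        ; d′ = - (r * Y) , s * X
        ; multiple = cong₂ _,_ (scaled s p a≡ p≡) (scaled r q b≡ q≡)
        ; unimodular = ℤₚ.*-cancelʳ-≡ _ _ (+ suc g) (begin
            (s * + p * (s * X) - r * + q * (- (r * Y))) * + suc g
              ≡⟨ l s r (+ p) (+ q) X Y (+ suc g) ⟩
            (s * s) * (X * (+ p * + suc g)) + (r * r) * (Y * (+ q * + suc g))
              ≡⟨ cong₂ (λ e f → e * (X * (+ p * + suc g)) + f * (Y * (+ q * + suc g))) ss rr ⟩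
            + 1 * (X * (+ p * + suc g)) + + 1 * (Y * (+ q * + suc g))
              ≡⟨ cong₂ (λ e f → + 1 * (X * e) + + 1 * (Y * f)) (quotient-eq p p≡) (quotient-eq q q≡) ⟩
            + 1 * (X * + ∣ a ∣) + + 1 * (Y * + ∣ b ∣)
              ≡⟨ cong₂ _+_ (ℤₚ.*-identityˡ (X * + ∣ a ∣)) (ℤₚ.*-identityˡ (Y * + ∣ b ∣)) ⟩
            X * + ∣ a ∣ + Y * + ∣ b ∣
              ≡⟨ XY ⟩
            + suc g
              ≡⟨ sym (ℤₚ.*-identityˡ (+ suc g)) ⟩
            + 1 * + suc g ∎)
        }
        where
        open ≡-Reasoning
        l : ∀ s r p q X Y g → (s * p * (s * X) - r * q * (- (r * Y))) * g ≡ (s * s) * (X * (p * g)) + (r * r) * (Y * (q * g))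
        l = solve-∀
        quotient-eq : ∀ {c} p → c ≡ p ℕ.* suc g → + p * + suc g ≡ + c
        quotient-eq p eq = trans (sym (ℤₚ.pos-* p (suc g))) (cong +_ (sym eq))
        l′ : ∀ s p g → s * (p * g) ≡ g * (s * p)
        l′ = solve-∀
        scaled : ∀ s p {a} → a ≡ s * + ∣ a ∣ → ∣ a ∣ ≡ p ℕ.* suc g → a ≡ + suc g * (s * + p)
        scaled s p a≡ p≡ = trans a≡ (trans (cong (s *_) (sym (quotient-eq p p≡))) (l′ s (+ p) (+ suc g)))

-- Rows of a polynomial and the propagation of zeros

module Rows {c ℓ} (R : CommutativeRing c ℓ) where
  open CommutativeRing R hiding (zero)
  open IntegersIn R using (solve; _:=_; _:+_; _:*_; :-_)
  open import Data.Integer using (ℤ; +_) renaming (_-_ to _-ℤ_; _+_ to _+ℤ_)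
  open import Data.Integer.Tactic.RingSolver using (solve-∀)
  open import Data.Nat as ℕ using (ℕ; zero; suc; _≤_; _<_; _∸_; s≤s)
  import Data.Nat.Properties as ℕₚ
  open import Data.Nat.Induction using (<-rec)
  open import Data.List using (List; []; _∷_)
  open import Data.List.Relation.Unary.All using (All; []; _∷_)
  open import Data.Product using (∃; _×_; _,_)
  open import Relation.Nullary using (Dec; yes; no; contradiction)
  open import Relation.Binary.Definitions using (tri<; tri≈; tri>)
  import Relation.Binary.PropositionalEquality as ≡
  open ≡ using (_≡_)
  open import Relation.Binary.Reasoning.Setoid setoid
  open import Algebra.Properties.Semiring.Exp semiring using (_^_)
  open import Algebra.Properties.CommutativeSemigroup +-commutativeSemigroup using (interchange)

  -- A term (k , α , τ) stands for k X^(α d + τ d′) in a basis d, d′.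
  RowTerms : Set c
  RowTerms = List (Carrier × ℕ × ℕ)

  -- Truncated subtraction is harmless: the recurrence is assumed only from row h on, where no
  -- height `τ` exceeds the row number.
  rowAct : RowTerms → (ℤ → ℕ → Carrier) → ℤ → ℕ → Carrier
  rowAct [] y i t = 0#
  rowAct ((k , α , τ) ∷ G) y i t = k * y (i -ℤ + α) (t ∸ τ) + rowAct G y i t

  only : {P : Set} → Dec P → Carrier → Carrier
  only (yes _) k = k
  only (no _) k = 0#

  -- Row j as a polynomial in X^d, evaluated at ω. If all these values vanish, X^d - ω divides the
  -- whole polynomial.
  row : RowTerms → Carrier → ℕ → Carrier
  row [] ω j = 0#
  row ((k , α , τ) ∷ G) ω j = only (τ ℕ.≟ j) (k * ω ^ α) + row G ω j

  rowSum : RowTerms → Carrier → (ℕ → Carrier) → Carrier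
  rowSum [] ω F = 0#
  rowSum ((k , α , τ) ∷ G) ω F = k * ω ^ α * F τ + rowSum G ω F

  HeightAtMost : ℕ → RowTerms → Set c
  HeightAtMost h = All λ (k , α , τ) → τ ≤ h

  sumTo : ℕ → (ℕ → Carrier) → Carrier
  sumTo zero f = 0#
  sumTo (suc n) f = sumTo n f + f n

  sumTo-0 : ∀ n f → (∀ k → k < n → f k ≈ 0#) → sumTo n f ≈ 0#
  sumTo-0 zero f h = refl
  sumTo-0 (suc n) f h = trans (+-cong (sumTo-0 n f λ k k<n → h k (ℕₚ.m<n⇒m<1+n k<n)) (h n ℕₚ.≤-refl)) (+-identityˡ 0#)

  sumTo-one : ∀ n f j → j < n → (∀ k → k < n → ¬ (k ≡ j) → f k ≈ 0#) → sumTo n f ≈ f j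
  sumTo-one (suc n) f j j<1+n h with j ℕ.≟ n
  ... | yes ≡.refl = trans (+-congʳ (sumTo-0 n f λ k k<n → h k (ℕₚ.m<n⇒m<1+n k<n) (ℕₚ.<⇒≢ k<n))) (+-identityˡ _)
  ... | no j≢n = trans (+-cong (sumTo-one n f j (ℕₚ.≤∧≢⇒< (ℕₚ.≤-pred j<1+n) j≢n) λ k k<n → h k (ℕₚ.m<n⇒m<1+n k<n)) (h n ℕₚ.≤-refl (λ n≡j → j≢n (≡.sym n≡j)))) (+-identityʳ _)

  sumTo-+ : ∀ n f g → sumTo n (λ k → f k + g k) ≈ sumTo n f + sumTo n g
  sumTo-+ zero f g = sym (+-identityˡ _)
  sumTo-+ (suc n) f g = trans (+-congʳ (sumTo-+ n f g)) (interchange _ _ _ _)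

  sumTo-cong : ∀ n {f g} → (∀ k → f k ≈ g k) → sumTo n f ≈ sumTo n g
  sumTo-cong zero h = refl
  sumTo-cong (suc n) h = +-cong (sumTo-cong n h) (h n)

  rowSum-grouped : ∀ {h} G ω F → HeightAtMost h G → rowSum G ω F ≈ sumTo (suc h) (λ k → row G ω k * F k)
  rowSum-grouped {h} [] ω F [] = sym (sumTo-0 (suc h) _ λ k _ → zeroˡ _)
  rowSum-grouped {h} ((k , α , τ) ∷ G) ω F (τ≤h ∷ hs) = begin
    k * ω ^ α * F τ + rowSum G ω F
      ≈⟨ +-cong (sym single) (rowSum-grouped G ω F hs) ⟩
    sumTo (suc h) (λ j → only (τ ℕ.≟ j) (k * ω ^ α) * F j) + sumTo (suc h) (λ j → row G ω j * F j)
      ≈⟨ sym (sumTo-+ (suc h) _ _) ⟩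
    sumTo (suc h) (λ j → only (τ ℕ.≟ j) (k * ω ^ α) * F j + row G ω j * F j)
      ≈⟨ sumTo-cong (suc h) (λ j → sym (distribʳ _ _ _)) ⟩
    sumTo (suc h) (λ j → (only (τ ℕ.≟ j) (k * ω ^ α) + row G ω j) * F j) ∎
    where
    hit : only (τ ℕ.≟ τ) (k * ω ^ α) ≈ k * ω ^ α
    hit with τ ℕ.≟ τ
    ... | yes _ = refl
    ... | no τ≢τ = contradiction ≡.refl τ≢τ
    miss : ∀ j → ¬ (j ≡ τ) → only (τ ℕ.≟ j) (k * ω ^ α) ≈ 0#
    miss j j≢τ with τ ℕ.≟ j
    ... | yes τ≡j = contradiction (≡.sym τ≡j) j≢τ
    ... | no _ = refl
    single : sumTo (suc h) (λ j → only (τ ℕ.≟ j) (k * ω ^ α) * F j) ≈ k * ω ^ α * F τ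
    single = trans (sumTo-one (suc h) _ τ (s≤s τ≤h) λ j _ j≢τ → trans (*-congʳ (miss j j≢τ)) (zeroˡ _)) (*-congʳ hit)

  eigen : Carrier → (ℤ → Carrier) → ℤ → Carrier
  eigen ω y i = y (i -ℤ + 1) + - (ω * y i)

  eigens : List Carrier → (ℤ → Carrier) → ℤ → Carrier
  eigens [] y = y
  eigens (ω ∷ ωs) y = eigens ωs (eigen ω y)

  shift-power : ∀ ω (y : ℤ → Carrier) → (∀ i → eigen ω y i ≈ 0#) → ∀ α i → y (i -ℤ + α) ≈ ω ^ α * y i
  shift-power ω y h zero i = trans (reflexive (≡.cong y (l i))) (sym (*-identityˡ _))
    where l : ∀ i → i -ℤ + 0 ≡ i
          l = solve-∀
  shift-power ω y h (suc α) i = begin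
    y (i -ℤ + suc α)              ≡⟨ ≡.cong y (l i (+ α)) ⟩
    y ((i -ℤ + α) -ℤ + 1)         ≈⟨ solve 2 (λ a b → a := (a :+ :- b) :+ b) refl _ _ ⟩
    eigen ω y (i -ℤ + α) + ω * y (i -ℤ + α)  ≈⟨ trans (+-congʳ (h (i -ℤ + α))) (+-identityˡ _) ⟩
    ω * y (i -ℤ + α)              ≈⟨ *-congˡ (shift-power ω y h α i) ⟩
    ω * (ω ^ α * y i)             ≈⟨ sym (*-assoc _ _ _) ⟩
    ω * ω ^ α * y i               ∎
    where l : ∀ i a → i -ℤ (+ 1 +ℤ a) ≡ (i -ℤ a) -ℤ + 1
          l = solve-∀

  rowAct-eigen : ∀ G ω y i t → rowAct G (λ i t → eigen ω (λ i → y i t) i) i t ≈ eigen ω (λ i → rowAct G y i t) i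
  rowAct-eigen [] ω y i t = solve 1 (λ ω → con (+ 0) := con (+ 0) :+ :- (ω :* con (+ 0))) refl ω
    where open IntegersIn R using (con)
  rowAct-eigen ((k , α , τ) ∷ G) ω y i t = begin
    k * (y ((i -ℤ + α) -ℤ + 1) (t ∸ τ) + - (ω * y (i -ℤ + α) (t ∸ τ))) + rowAct G _ i t
      ≈⟨ +-cong (*-congˡ (+-congʳ (reflexive (≡.cong (λ j → y j (t ∸ τ)) (l i (+ α)))))) (rowAct-eigen G ω y i t) ⟩
    k * (y ((i -ℤ + 1) -ℤ + α) (t ∸ τ) + - (ω * y (i -ℤ + α) (t ∸ τ))) + (rowAct G y (i -ℤ + 1) t + - (ω * rowAct G y i t))
      ≈⟨ solve 6 (λ k a ω b r s → k :* (a :+ :- (ω :* b)) :+ (r :+ :- (ω :* s)) := (k :* a :+ r) :+ :- (ω :* (k :* b :+ s))) refl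
           k _ ω _ _ _ ⟩
    (k * y ((i -ℤ + 1) -ℤ + α) (t ∸ τ) + rowAct G y (i -ℤ + 1) t) + - (ω * (k * y (i -ℤ + α) (t ∸ τ) + rowAct G y i t)) ∎
    where l : ∀ i a → (i -ℤ a) -ℤ + 1 ≡ (i -ℤ + 1) -ℤ a
          l = solve-∀

  rowAct-power : ∀ G ω y i t → (∀ τ i → eigen ω (λ i → y i τ) i ≈ 0#) → rowAct G y i t ≈ rowSum G ω (λ τ → y i (t ∸ τ))
  rowAct-power [] ω y i t h = refl
  rowAct-power ((k , α , τ) ∷ G) ω y i t h =
    +-cong (trans (*-congˡ (shift-power ω (λ i → y i (t ∸ τ)) (h (t ∸ τ)) α i)) (sym (*-assoc _ _ _))) (rowAct-power G ω y i t h)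

  -- The two assumptions hold for the double-negated equality of any field.
  module Propagation
    (stable : ∀ {x y} → ¬ ¬ (x ≈ y) → x ≈ y)
    (integral : ∀ {x y} → ¬ (x ≈ 0#) → x * y ≈ 0# → y ≈ 0#)
    where

    -- Were no index the least nonzero one, strong induction with stability would make all values
    -- zero. Only a double negation results, since vanishing cannot be tested.
    least-nonzero : ∀ {h} (f : ℕ → Carrier) → ¬ (∀ k → k ≤ h → f k ≈ 0#) →
      ¬ ¬ (∃ λ k → k ≤ h × ¬ (f k ≈ 0#) × (∀ j → j < k → f j ≈ 0#))
    least-nonzero {h} f nonzero none = nonzero (<-rec (λ k → k ≤ h → f k ≈ 0#) λ k below k≤h →
      stable λ fk≉0 → none (k , k≤h , fk≉0 , λ j j<k → below j<k (ℕₚ.≤-trans (ℕₚ.<⇒≤ j<k) k≤h)))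

    -- Applying X^d - ω gives a function that satisfies the same hypotheses with one factor fewer,
    -- so by induction it is zero. Hence X^d acts on `y` as ω, and the recurrence becomes one in t
    -- alone with coefficients `row G ω k`; its lowest nonzero coefficient expresses a row by
    -- earlier ones.
    propagate : ∀ {h} G → HeightAtMost h G →
      (∀ ω → ¬ (ω ≈ 0#) → ¬ (∀ k → k ≤ h → row G ω k ≈ 0#)) →
      ∀ ωs y →
      (∀ i t → h ≤ t → rowAct G y i t ≈ 0#) →
      (∀ i t → eigens ωs (λ i → y i t) i ≈ 0#) →
      (∀ i t → t < h → y i t ≈ 0#) →
      ∀ i t → y i t ≈ 0#
    propagate G height good [] y recur ann start i t = ann i t
    propagate {h} G height good (ω ∷ ωs) y recur ann start i t = stable λ y≉0 →
      let ω≉0 : ¬ (ω ≈ 0#)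
          ω≉0 ω≈0 = y≉0 (ω≈0⇒ ω≈0)
      in least-nonzero (row G ω) (good ω ω≉0) λ (k , k≤h , row≉0 , below) →
        y≉0 (<-rec (λ t → y i t ≈ 0#) (λ t earlier → next k k≤h row≉0 below t (λ s s<t → earlier s<t)) t)
      where
      isEigen : ∀ t i → eigen ω (λ i → y i t) i ≈ 0#
      isEigen t i = propagate G height good ωs (λ i t → eigen ω (λ i → y i t) i)
        (λ i t h≤t → trans (rowAct-eigen G ω y i t)
          (trans (+-cong (recur _ t h≤t) (-‿cong (trans (*-congˡ (recur i t h≤t)) (zeroʳ ω)))) (-‿inverseʳ 0#)))
        ann
        (λ i t t<h → trans (+-cong (start _ t t<h) (-‿cong (trans (*-congˡ (start i t t<h)) (zeroʳ ω)))) (-‿inverseʳ 0#))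
        i t
      -- Nothing is assumed about the rows at ω = 0, but then the translation X^d kills `y`, and
      -- translations are invertible.
      ω≈0⇒ : ω ≈ 0# → y i t ≈ 0#
      ω≈0⇒ ω≈0 = begin
        y i t                          ≡⟨ ≡.cong (λ j → y j t) (l i) ⟩
        y ((i +ℤ + 1) -ℤ + 1) t        ≈⟨ shift-power ω (λ i → y i t) (isEigen t) 1 (i +ℤ + 1) ⟩
        ω * 1# * y (i +ℤ + 1) t        ≈⟨ *-congʳ (trans (*-congʳ ω≈0) (zeroˡ 1#)) ⟩
        0# * y (i +ℤ + 1) t            ≈⟨ zeroˡ _ ⟩
        0#                             ∎
        where l : ∀ i → i ≡ (i +ℤ + 1) -ℤ + 1
              l = solve-∀
      next : ∀ k → k ≤ h → ¬ (row G ω k ≈ 0#) → (∀ j → j < k → row G ω j ≈ 0#) →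
             ∀ t → (∀ s → s < t → y i s ≈ 0#) → y i t ≈ 0#
      next k k≤h row≉0 below t earlier with t ℕ.<? h
      ... | yes t<h = start i t t<h
      -- The recurrence is read in row t + k, so that coefficient k meets row t: lower coefficients
      -- vanish, and higher ones meet rows before t.
      ... | no t≮h = integral row≉0 (begin
        row G ω k * y i t                                   ≡⟨ ≡.cong (λ s → row G ω k * y i s) (≡.sym (ℕₚ.m+n∸n≡m t k)) ⟩
        row G ω k * y i (t ℕ.+ k ∸ k)                        ≈⟨ sym (sumTo-one (suc h) _ k (s≤s k≤h) other) ⟩
        sumTo (suc h) (λ j → row G ω j * y i (t ℕ.+ k ∸ j))  ≈⟨ sym (rowSum-grouped G ω (λ τ → y i (t ℕ.+ k ∸ τ)) height) ⟩
        rowSum G ω (λ τ → y i (t ℕ.+ k ∸ τ))                 ≈⟨ sym (rowAct-power G ω y i (t ℕ.+ k) isEigen) ⟩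
        rowAct G y i (t ℕ.+ k)                               ≈⟨ recur i (t ℕ.+ k) (ℕₚ.≤-trans (ℕₚ.≮⇒≥ t≮h) (ℕₚ.m≤m+n t k)) ⟩
        0#                                                  ∎)
        where
        h≤t = ℕₚ.≮⇒≥ t≮h
        other : ∀ j → j < suc h → ¬ (j ≡ k) → row G ω j * y i (t ℕ.+ k ∸ j) ≈ 0#
        other j (s≤s j≤h) j≢k with ℕₚ.<-cmp j k
        ... | tri< j<k _ _ = trans (*-congʳ (below j j<k)) (zeroˡ _)
        ... | tri≈ _ j≡k _ = contradiction j≡k j≢k
        ... | tri> _ _ k<j = trans (*-congˡ (earlier _ lt)) (zeroʳ _)
          where
          lt : t ℕ.+ k ∸ j < t
          lt = ≡.subst (t ℕ.+ k ∸ j <_) (ℕₚ.m+n∸n≡m t k) (ℕₚ.∸-monoʳ-< k<j (ℕₚ.≤-trans j≤h (ℕₚ.≤-trans h≤t (ℕₚ.m≤m+n t k))))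

-- Splitting a polynomial in one shift over K

module Roots {c ℓ} (K : ACF0 c ℓ) where
  open ACF0 K hiding (zero)
  open IntegersIn commRing using (solve; _:=_; _:+_; _:*_; :-_; con)
  open Rows commRing using (eigen; eigens)
  open import Data.Integer using (ℤ; +_) renaming (_-_ to _-ℤ_; _+_ to _+ℤ_)
  open import Data.Integer.Tactic.RingSolver using (solve-∀)
  open import Data.Nat using (zero; suc)
  open import Data.List using (List; []; _∷_; _∷ʳ_; length; replicate)
  open import Data.List.Properties using (length-replicate)
  open import Data.Product using (∃; ∃₂; _×_; _,_)
  import Relation.Binary.PropositionalEquality as ≡
  open ≡ using (_≡_)
  open import Relation.Binary.Reasoning.Setoid setoid

  integral : ∀ {x y} → ¬ (x ≈ 0#) → x * y ≈ 0# → y ≈ 0#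
  integral {x} {y} x≉0 xy≈0 with inverse x x≉0
  ... | x⁻¹ , eq = begin
    y               ≈⟨ sym (*-identityˡ y) ⟩
    1# * y          ≈⟨ *-congʳ (sym eq) ⟩
    x * x⁻¹ * y     ≈⟨ solve 3 (λ x i y → x :* i :* y := i :* (x :* y)) refl x x⁻¹ y ⟩
    x⁻¹ * (x * y)   ≈⟨ *-congˡ xy≈0 ⟩
    x⁻¹ * 0#        ≈⟨ zeroʳ _ ⟩
    0#              ∎

  polyAct : List Carrier → (ℤ → Carrier) → ℤ → Carrier
  polyAct [] y i = 0#
  polyAct (k ∷ ks) y i = k * y i + polyAct ks y (i -ℤ + 1)

  -- Synthetic division by X - t: the partial values of Horner's scheme are the coefficients of the
  -- quotient.
  quotient : Carrier → List Carrier → Carrier → List Carrier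
  quotient t [] lead = []
  quotient t (k ∷ ks) lead = evalU (ks ∷ʳ lead) t ∷ quotient t ks lead

  division : ∀ t ks lead y i → polyAct (ks ∷ʳ lead) y i ≈ polyAct (quotient t ks lead) (eigen t y) i + evalU (ks ∷ʳ lead) t * y i
  division t [] lead y i = solve 3 (λ l t y → l :* y :+ con (+ 0) := con (+ 0) :+ (l :+ t :* con (+ 0)) :* y) refl lead t (y i)
  division t (k ∷ ks) lead y i = begin
    k * y i + polyAct (ks ∷ʳ lead) y (i -ℤ + 1)     ≈⟨ +-congˡ (division t ks lead y (i -ℤ + 1)) ⟩
    k * y i + (q + v * y (i -ℤ + 1))
      ≈⟨ solve 6 (λ k a q v b t → k :* a :+ (q :+ v :* b) := v :* (b :+ :- (t :* a)) :+ q :+ (k :+ t :* v) :* a) refl k (y i) q v (y (i -ℤ + 1)) t ⟩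
    v * eigen t y i + q + (k + t * v) * y i         ∎
    where
    q = polyAct (quotient t ks lead) (eigen t y) (i -ℤ + 1)
    v = evalU (ks ∷ʳ lead) t

  -- Lets `split` recurse: the degree drops by one and the leading coefficient stays nonzero.
  quotient-lead : ∀ t k ks lead → ∃₂ λ ks′ lead′ → quotient t (k ∷ ks) lead ≡ ks′ ∷ʳ lead′ × lead′ ≈ lead × length ks′ ≡ length ks
  quotient-lead t k [] lead = [] , _ , ≡.refl , trans (+-congˡ (zeroʳ t)) (+-identityʳ lead) , ≡.refl
  quotient-lead t k (k₁ ∷ ks) lead with quotient-lead t k₁ ks lead
  ... | ks′ , lead′ , eq , lead≈ , len = evalU (k₁ ∷ (ks ∷ʳ lead)) t ∷ ks′ , lead′ , ≡.cong (evalU (k₁ ∷ (ks ∷ʳ lead)) t ∷_) eq , lead≈ , ≡.cong suc len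

  split : ∀ n ks lead → length ks ≡ n → ¬ (lead ≈ 0#) →
    ∃ λ ωs → ∀ y → (∀ i → polyAct (ks ∷ʳ lead) y i ≈ 0#) → ∀ i → eigens ωs y i ≈ 0#
  split zero [] lead len lead≉0 = [] , λ y h i → integral lead≉0 (trans (sym (+-identityʳ _)) (h i))
  split (suc n) (k ∷ ks) lead len lead≉0 with algClosed k ks lead lead≉0
  ... | t , root with quotient-lead t k ks lead
  ...   | ks′ , lead′ , eq , lead≈ , len′ with split n ks′ lead′ (≡.trans len′ (suc-injective len)) (λ l≈0 → lead≉0 (trans (sym lead≈) l≈0))
    where open import Data.Nat.Properties using (suc-injective)
  ...     | ωs , factors = t ∷ ωs , λ y h → factors (eigen t y) λ i → begin
      polyAct (ks′ ∷ʳ lead′) (eigen t y) i              ≡⟨ ≡.cong (λ q → polyAct q (eigen t y) i) (≡.sym eq) ⟩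
      polyAct q (eigen t y) i                           ≈⟨ sym (trans (+-congˡ (trans (*-congʳ root) (zeroˡ _))) (+-identityʳ _)) ⟩
      polyAct q (eigen t y) i + evalU (k ∷ (ks ∷ʳ lead)) t * y i   ≈⟨ sym (division t (k ∷ ks) lead y i) ⟩
      polyAct (k ∷ (ks ∷ʳ lead)) y i                    ≈⟨ h i ⟩
      0#                                                ∎
      where q = quotient t (k ∷ ks) lead

  roots-of-unity : ∀ n → ∃ λ ωs → ∀ y → (∀ i → y (i -ℤ + suc n) ≈ y i) → ∀ i → eigens ωs y i ≈ 0#
  roots-of-unity n with split (suc n) (- 1# ∷ replicate n 0#) 1# (≡.cong suc (length-replicate n)) 1≉0
  ... | ωs , factors = ωs , λ y h → factors y λ i → begin
      - 1# * y i + polyAct (replicate n 0# ∷ʳ 1#) y (i -ℤ + 1)   ≈⟨ +-congˡ (trans (power n y (i -ℤ + 1)) (trans (reflexive (≡.cong y (l i (+ n)))) (h i))) ⟩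
      - 1# * y i + y i                                          ≈⟨ trans (+-congʳ (trans (sym (-‿distribˡ-* 1# (y i))) (-‿cong (*-identityˡ (y i))))) (-‿inverseˡ (y i)) ⟩
      0#                                                        ∎
    where
    open import Algebra.Properties.Ring ring using (-‿distribˡ-*)
    l : ∀ i n → (i -ℤ + 1) -ℤ n ≡ i -ℤ (+ 1 +ℤ n)
    l = solve-∀
    power : ∀ n y i → polyAct (replicate n 0# ∷ʳ 1#) y i ≈ y (i -ℤ + n)
    power zero y i = trans (trans (+-identityʳ _) (*-identityˡ _)) (reflexive (≡.cong y (l₀ i)))
      where l₀ : ∀ i → i ≡ i -ℤ + 0
            l₀ = solve-∀
    power (suc n) y i = trans (trans (+-cong (zeroˡ _) (power n y (i -ℤ + 1))) (+-identityˡ _)) (reflexive (≡.cong y (l i (+ n))))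

-- Periods, and the pigeonhole principle for windows of rows

module Periods where
  open Plane
  open Bases
  open import Data.Integer using (ℤ; +_; -[1+_]; ∣_∣; _+_; _*_; -_; _-_; _/ℕ_; _%ℕ_)
  import Data.Integer as ℤ
  import Data.Integer.Properties as ℤₚ
  open import Data.Integer.DivMod using (a≡a%ℕn+[a/ℕn]*n; n%ℕd<d)
  open import Data.Integer.Tactic.RingSolver using (solve-∀)
  open import Data.Nat as ℕ using (ℕ; zero; suc; _≤_; _<_; _^_; s≤s)
  import Data.Nat.Properties as ℕₚ
  open import Data.Fin using (Fin; toℕ; fromℕ<; combine; remQuot; funToFin; finToFun)
  import Data.Fin.Properties as Finₚ
  open import Data.Product using (∃₂; _×_; _,_; proj₁; proj₂)
  open import Relation.Binary.PropositionalEquality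

  Periodic : ∀ {a} {A : Set a} → (ℤ² → A) → ℤ² → Set a
  Periodic f v = ∀ u → f (u +² v) ≡ f u

  module _ {a} {A : Set a} {f : ℤ² → A} where

    periodic-+ : ∀ {v w} → Periodic f v → Periodic f w → Periodic f (v +² w)
    periodic-+ {v} {w} p q u = trans (cong f (sym (+²-assoc u v w))) (trans (q (u +² v)) (p u))

    periodic-neg : ∀ {v} → Periodic f v → ∀ u → f (u -² v) ≡ f u
    periodic-neg {v} p u = trans (sym (p (u -² v))) (cong f (+²-cancel-² u v))

    periodic-ℕ· : ∀ {v} → Periodic f v → ∀ n → Periodic f ((+ n) · v)
    periodic-ℕ· {v} p zero u = cong f (trans (cong (u +²_) (0· v)) (+²-identityʳ u))
    periodic-ℕ· {v} p (suc n) u = trans (cong (λ x → f (u +² x)) (trans (·-distribʳ (+ 1) (+ n) v) (cong (_+² ((+ n) · v)) (1· v))))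
      (periodic-+ p (periodic-ℕ· p n) u)

    periodic-· : ∀ {v} → Periodic f v → ∀ k → Periodic f (k · v)
    periodic-· {v} p (+ n) = periodic-ℕ· p n
    periodic-· {v} p -[1+ n ] u = trans (cong f (negated u v)) (periodic-neg (periodic-ℕ· p (suc n)) u)
      where
      negated : ∀ u v → u +² (-[1+ n ] · v) ≡ u -² ((+ suc n) · v)
      negated (a , b) (c , d) = cong₂ _,_ (l a c) (l b d)
        where l : ∀ a c → a + -[1+ n ] * c ≡ a - + suc n * c
              l a c = cong (λ x → a + x) (sym (ℤₚ.neg-distribˡ-* (+ suc n) c))

  encode : ℕ → ℤ → ℕ
  encode B x = ∣ x + + B ∣

  encode< : ∀ {B} x → ∣ x ∣ ≤ B → encode B x < suc (B ℕ.+ B)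
  encode< {B} x h = s≤s (ℕₚ.≤-trans (ℤₚ.∣i+j∣≤∣i∣+∣j∣ x (+ B)) (ℕₚ.+-monoˡ-≤ B h))

  -B≤ : ∀ {B} x → ∣ x ∣ ≤ B → - + B ℤ.≤ x
  -B≤ {B} (+ n) h = ℤₚ.neg-≤-pos {B} {n}
  -B≤ -[1+ n ] h = ℤₚ.neg-mono-≤ (ℤ.+≤+ h)

  shift-nonneg : ∀ {B} x → ∣ x ∣ ≤ B → + ∣ x + + B ∣ ≡ x + + B
  shift-nonneg {B} x h = ℤₚ.0≤i⇒+∣i∣≡i (subst (ℤ._≤ x + + B) (ℤₚ.+-inverseˡ (+ B)) (ℤₚ.+-monoˡ-≤ (+ B) (-B≤ x h)))

  encode-injective : ∀ {B} x y → ∣ x ∣ ≤ B → ∣ y ∣ ≤ B → encode B x ≡ encode B y → x ≡ y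
  encode-injective {B} x y hx hy eq = begin
    x                ≡⟨ l x (+ B) ⟩
    x + + B - + B    ≡⟨ cong (_- + B) (trans (sym (shift-nonneg x hx)) (trans (cong +_ eq) (shift-nonneg y hy))) ⟩
    y + + B - + B    ≡⟨ sym (l y (+ B)) ⟩
    y                ∎
    where
    open ≡-Reasoning
    l : ∀ x b → x ≡ x + b - b
    l = solve-∀

  -- The number of ways to fill h rows of n cells with integers from -B to B.
  windows : ℕ → ℕ → ℕ → ℕ
  windows B h n = suc (B ℕ.+ B) ^ (h ℕ.* n)

  module _ {w} (basis : Basis w) {f : ℤ² → ℤ} {B} (bounded : ∀ u → ∣ f u ∣ ≤ B) (periodic : Periodic f w) where
    open Basis basis

    along-row : ∀ x t → f (point x t) ≡ f (point (+ (x %ℕ index)) t)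
    along-row x t = trans (cong f split) (periodic-· periodic (x /ℕ index) (point (+ (x %ℕ index)) t))
      where
      rearrange : ∀ r q n d t d′ → (r + q * n) * d + t * d′ ≡ (r * d + t * d′) + q * (n * d)
      rearrange = solve-∀
      split : point x t ≡ point (+ (x %ℕ index)) t +² ((x /ℕ index) · w)
      split = trans (cong (λ y → point y t) (a≡a%ℕn+[a/ℕn]*n x index))
        (trans (cong₂ _,_ (rearrange (+ (x %ℕ index)) (x /ℕ index) (+ index) (proj₁ d) t (proj₁ d′)) (rearrange (+ (x %ℕ index)) (x /ℕ index) (+ index) (proj₂ d) t (proj₂ d′)))
          (cong (λ v → point (+ (x %ℕ index)) t +² ((x /ℕ index) · v)) (sym multiple)))

    module _ (h : ℕ) (t₀ : ℤ) where
      private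
        at : ℕ → ℕ → ℕ → ℤ²
        at k τ x = point (+ x) (t₀ + + (k ℕ.+ τ))

        cell : ℕ → Fin h × Fin index → ℤ
        cell k (τ , x) = f (at k (toℕ τ) (toℕ x))

        window : ℕ → Fin (h ℕ.* index) → Fin (suc (B ℕ.+ B))
        window k c = fromℕ< (encode< (cell k (remQuot {h} index c)) (bounded _))

        value : ∀ k a b → toℕ (window k (combine a b)) ≡ encode B (cell k (a , b))
        value k a b = trans (Finₚ.toℕ-fromℕ< (encode< (cell k (remQuot {h} index (combine a b))) (bounded _)))
          (cong (λ ab → encode B (cell k ab)) (Finₚ.remQuot-combine a b))

        same-cells : ∀ i j → funToFin (window i) ≡ funToFin (window j) → ∀ a b → cell j (a , b) ≡ cell i (a , b)
        same-cells i j eq a b = encode-injective (cell j (a , b)) (cell i (a , b)) (bounded _) (bounded _)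
          (trans (sym (value j a b)) (trans (cong toℕ (sym windows≡)) (value i a b)))
          where
          windows≡ : window i (combine a b) ≡ window j (combine a b)
          windows≡ = trans (sym (Finₚ.finToFun-funToFin (window i) (combine a b)))
            (trans (cong (λ k → finToFun k (combine a b)) eq) (Finₚ.finToFun-funToFin (window j) (combine a b)))

        same-rows : ∀ i j → funToFin (window i) ≡ funToFin (window j) →
          ∀ x τ → τ < h → f (point x (t₀ + + (j ℕ.+ τ))) ≡ f (point x (t₀ + + (i ℕ.+ τ)))
        same-rows i j eq x τ τ<h = begin
          f (point x (t₀ + + (j ℕ.+ τ)))     ≡⟨ along-row x (t₀ + + (j ℕ.+ τ)) ⟩
          f (at j τ (x %ℕ index))            ≡⟨ cong₂ (λ τ x → f (at j τ x)) (sym (Finₚ.toℕ-fromℕ< τ<h)) (sym (Finₚ.toℕ-fromℕ< x<)) ⟩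
          cell j (fromℕ< τ<h , fromℕ< x<)    ≡⟨ same-cells i j eq (fromℕ< τ<h) (fromℕ< x<) ⟩
          cell i (fromℕ< τ<h , fromℕ< x<)    ≡⟨ cong₂ (λ τ x → f (at i τ x)) (Finₚ.toℕ-fromℕ< τ<h) (Finₚ.toℕ-fromℕ< x<) ⟩
          f (at i τ (x %ℕ index))            ≡⟨ sym (along-row x (t₀ + + (i ℕ.+ τ))) ⟩
          f (point x (t₀ + + (i ℕ.+ τ)))     ∎
          where
          open ≡-Reasoning
          x< = n%ℕd<d x index

      -- A row of period w = index d is known from `index` consecutive cells, so among one more
      -- starting height than there are fillings two agree. The bound on j later makes the periods
      -- computable.
      repeated-window : ∃₂ λ i j → i < j × j ≤ windows B h index ×
        (∀ x τ → τ < h → f (point x (t₀ + + (j ℕ.+ τ))) ≡ f (point x (t₀ + + (i ℕ.+ τ))))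
      repeated-window with Finₚ.pigeonhole (ℕₚ.n<1+n (windows B h index)) (λ k → funToFin (window (toℕ k)))
      ... | i , j , i<j , eq = toℕ i , toℕ j , i<j , ℕₚ.≤-pred (Finₚ.toℕ<n j) , same-rows (toℕ i) (toℕ j) eq

  module _ {w} (basis : Basis w) where
    open Basis basis

    -- If v = x d + y d′, then index m v = (x m) w + (y index) (m d′), because w = index d.
    lattice-periodic : ∀ {a} {A : Set a} {f : ℤ² → A} m → Periodic f w → Periodic f ((+ m) · d′) →
      ∀ v → Periodic f ((+ (index ℕ.* m)) · v)
    lattice-periodic {f = f} m p q v = subst (Periodic f) (sym eq)
      (periodic-+ (periodic-· p (cross v d′ * + m)) (periodic-· q (cross d v * + index)))
      where
      l : ∀ n m a b x y → (n * m) * (a * x + b * y) ≡ (a * m) * (n * x) + (b * n) * (m * y)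
      l = solve-∀
      eq : (+ (index ℕ.* m)) · v ≡ (cross v d′ * + m) · w +² (cross d v * + index) · ((+ m) · d′)
      eq = trans (cong₂ _·_ (ℤₚ.pos-* index m) (coordinates v))
        (trans (cong₂ _,_ (l (+ index) (+ m) (cross v d′) (cross d v) (proj₁ d) (proj₁ d′)) (l (+ index) (+ m) (cross v d′) (cross d v) (proj₂ d) (proj₂ d′)))
          (cong (λ u → (cross v d′ * + m) · u +² (cross d v * + index) · ((+ m) · d′)) (sym multiple)))

-- Line factors X^d - ω of an integer polynomial

module LineFactors {c ℓ} (K : ACF0 c ℓ) where
  open ACF0 K hiding (zero)
  open Laurent K
  open IntegersIn commRing
  open Plane
  open Bases
  open Rows commRing
  open Action commRing using (act; act-cong; act-+; act-++; act-mul; mul)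
  open Differences using (coef)
  open Periods using (shift-nonneg)
  open import Data.Integer as ℤ using (ℤ)
  import Data.Integer.Properties as ℤₚ
  open import Data.Integer.Tactic.RingSolver using (solve-∀)
  open import Data.Nat as ℕ using (ℕ; zero; suc; _≤_)
  import Data.Nat.Properties as ℕₚ
  open import Data.List using (List; []; _∷_; _++_; map)
  open import Data.List.Properties using (map-cong)
  open import Data.List.Relation.Unary.All as All using (All; []; _∷_)
  open import Data.Product using (∃; _×_; _,_; proj₁; proj₂)
  open import Data.Sum using (_⊎_; inj₁; inj₂)
  open import Relation.Nullary using (yes; no; contradiction)
  import Relation.Binary.PropositionalEquality as ≡
  open ≡ using (_≡_)
  open import Relation.Binary.Reasoning.Setoid setoid
  open import Algebra.Properties.Semiring.Exp semiring using (_^_)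
  open import Algebra.Properties.Ring ring using (-0#≈0#)

  Terms : Set
  Terms = List (ℤ × ℤ²)

  embed : Terms → LPoly
  embed = map λ (k , e) → fromℤ k , e

  coeff-embed : ∀ G x → coeff (embed G) x ≈ fromℤ (coef G x)
  coeff-embed [] x = refl
  coeff-embed ((k , e) ∷ G) x with e ≟² x
  ... | yes _ = trans (+-congˡ (coeff-embed G x)) (sym (fromℤ-+ k (coef G x)))
  ... | no _ = coeff-embed G x

  -- A polynomial acting on this function returns its own coefficients, so identities between
  -- operators become identities between coefficients.
  δ : ℤ² → Carrier
  δ u = only (u ≟² 0²) 1#

  coeff≈act : ∀ p x → coeff p x ≈ act p δ x
  coeff≈act [] x = refl
  coeff≈act ((k , e) ∷ p) x with e ≟² x | (x -² e) ≟² 0²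
  ... | yes _ | yes _ = +-cong (sym (*-identityʳ k)) (coeff≈act p x)
  ... | yes ≡.refl | no ≢0 = contradiction (-²-self e) ≢0
  ... | no e≢x | yes ≡0 = contradiction (-²≡0⇒≡ x e ≡0) e≢x
  ... | no _ | no _ = trans (coeff≈act p x) (sym (trans (+-congʳ (zeroʳ k)) (+-identityˡ _)))

  *L≡mul : ∀ p q → p *L q ≡ mul p q
  *L≡mul [] q = ≡.refl
  *L≡mul (t ∷ p) q = ≡.cong₂ _++_ (map-cong (λ _ → ≡.refl) q) (*L≡mul p q)

  coeff-*L : ∀ p q x → coeff (p *L q) x ≈ act p (act q δ) x
  coeff-*L p q x = begin
    coeff (p *L q) x        ≡⟨ ≡.cong (λ l → coeff l x) (*L≡mul p q) ⟩
    coeff (mul p q) x       ≈⟨ coeff≈act (mul p q) x ⟩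
    act (mul p q) δ x       ≈⟨ act-mul p q δ x ⟩
    act p (act q δ) x       ∎

  binomial : ℤ² → Carrier → LPoly
  binomial d ω = (1# , d) ∷ (- ω , 0²) ∷ []

  act-binomial : ∀ d ω z u → act (binomial d ω) z u ≈ z (u -² d) + - (ω * z u)
  act-binomial d ω z u = trans (+-cong (*-identityˡ _) (trans (+-identityʳ _) (*-congˡ (reflexive (≡.cong z (-²-identityʳ u))))))
    (solve 3 (λ a ω b → a :+ :- ω :* b := a :+ :- (ω :* b)) refl _ ω _)

  binomial-support : ∀ d ω x → InSupp x (binomial d ω) → x ≡ d ⊎ x ≡ 0²
  binomial-support d ω x supp with d ≟² x
  ... | yes d≡x = inj₁ (≡.sym d≡x)
  ... | no _ with 0² ≟² x
  ...   | yes 0≡x = inj₂ (≡.sym 0≡x)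
  ...   | no _ = contradiction refl supp

  binomial-line : ∀ d ω w → ¬ (d ≡ 0²) → ¬ (w ≡ 0²) → Parallel d w → ¬ (ω ≈ 0#) → IsLinePoly (binomial d ω) w
  binomial-line d ω w d≢0 w≢0 d∥w ω≉0 = w≢0 , (d , 0² , d≢0 , d-in , 0-in) , λ e₁ e₂ s₁ s₂ →
      along e₁ e₂ (binomial-support d ω e₁ s₁) (binomial-support d ω e₂ s₂)
    where
    d-in : InSupp d (binomial d ω)
    d-in eq with d ≟² d
    ... | no d≢d = d≢d ≡.refl
    ... | yes _ with 0² ≟² d
    ...   | yes 0≡d = d≢0 (≡.sym 0≡d)
    ...   | no _ = 1≉0 (trans (sym (+-identityʳ 1#)) eq)
    0-in : InSupp 0² (binomial d ω)
    0-in eq with d ≟² 0²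
    ... | yes d≡0 = d≢0 d≡0
    ... | no _ = ω≉0 (begin
          ω              ≈⟨ solve 1 (λ ω → ω := :- (:- ω :+ con (ℤ.+ 0))) refl ω ⟩
          - (- ω + 0#)   ≈⟨ -‿cong eq ⟩
          - 0#           ≈⟨ -0#≈0# ⟩
          0#             ∎)
    self : ∀ a b x y → (a ℤ.- a) ℤ.* y ℤ.- (b ℤ.- b) ℤ.* x ≡ ℤ.+ 0
    self = solve-∀
    flip : ∀ a b x y → (ℤ.+ 0 ℤ.- a) ℤ.* y ℤ.- (ℤ.+ 0 ℤ.- b) ℤ.* x ≡ ℤ.- (a ℤ.* y ℤ.- b ℤ.* x)
    flip = solve-∀
    along : ∀ e₁ e₂ → e₁ ≡ d ⊎ e₁ ≡ 0² → e₂ ≡ d ⊎ e₂ ≡ 0² → Parallel (e₁ -² e₂) w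
    along _ _ (inj₁ ≡.refl) (inj₁ ≡.refl) = self (proj₁ d) (proj₂ d) (proj₁ w) (proj₂ w)
    along _ _ (inj₁ ≡.refl) (inj₂ ≡.refl) = ≡.trans (≡.cong (λ v → cross v w) (-²-identityʳ d)) d∥w
    along _ _ (inj₂ ≡.refl) (inj₁ ≡.refl) = ≡.trans (flip (proj₁ d) (proj₂ d) (proj₁ w) (proj₂ w)) (≡.cong ℤ.-_ d∥w)
    along _ _ (inj₂ ≡.refl) (inj₂ ≡.refl) = ≡.refl

  module Along {w} (basis : Basis w) where
    open Basis basis

    abscissa ordinate : ℤ² → ℤ
    abscissa e = cross e d′
    ordinate e = cross d e

    -- A crude bound for all exponent coordinates in the basis. Translating by it makes both
    -- coordinates natural numbers of at most twice its size, the height used for the rows.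
    spread : Terms → ℕ
    spread [] = 0
    spread ((k , e) ∷ G) = (ℤ.∣ abscissa e ∣ ℕ.+ ℤ.∣ ordinate e ∣) ℕ.+ spread G

    Within : ℕ → ℤ × ℤ² → Set
    Within S (k , e) = ℤ.∣ abscissa e ∣ ≤ S × ℤ.∣ ordinate e ∣ ≤ S

    within : ∀ G → All (Within (spread G)) G
    within [] = []
    within ((k , e) ∷ G) =
      ( ℕₚ.≤-trans (ℕₚ.m≤m+n ℤ.∣ abscissa e ∣ ℤ.∣ ordinate e ∣) (ℕₚ.m≤m+n _ (spread G))
      , ℕₚ.≤-trans (ℕₚ.m≤n+m ℤ.∣ ordinate e ∣ ℤ.∣ abscissa e ∣) (ℕₚ.m≤m+n _ (spread G)))
      ∷ All.map (λ (a , b) → ℕₚ.≤-trans a (ℕₚ.m≤n+m _ _) , ℕₚ.≤-trans b (ℕₚ.m≤n+m _ _)) (within G)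

    module Shifted (S : ℕ) where

      α τ : ℤ² → ℕ
      α e = ℤ.∣ abscissa e ℤ.+ ℤ.+ S ∣
      τ e = ℤ.∣ ordinate e ℤ.+ ℤ.+ S ∣

      origin : ℤ²
      origin = point (ℤ.+ S) (ℤ.+ S)

      rows : Terms → RowTerms
      rows = map λ (k , e) → fromℤ k , α e , τ e

      rows-height : ∀ G → All (Within S) G → HeightAtMost (S ℕ.+ S) (rows G)
      rows-height [] [] = []
      rows-height ((k , e) ∷ G) ((_ , b) ∷ hs) = ℕₚ.≤-trans (ℤₚ.∣i+j∣≤∣i∣+∣j∣ (ordinate e) (ℤ.+ S)) (ℕₚ.+-monoˡ-≤ S b) ∷ rows-height G hs

      -- The start of row t with the translation by `origin` undone.
      base : ℕ → ℤ²
      base t = ((ℤ.+ t) · d′) -² origin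

      decompose : ∀ k e → Within S (k , e) → base (τ e) +² ((ℤ.+ α e) · d) ≡ e
      decompose k e (a≤ , b≤) = ≡.trans (≡.cong₂ (λ i j → ((j · d′) -² origin) +² (i · d)) (shift-nonneg (abscissa e) a≤) (shift-nonneg (ordinate e) b≤))
        (≡.trans (≡.cong₂ _,_ (l (abscissa e) (ordinate e) (ℤ.+ S) (proj₁ d) (proj₁ d′)) (l (abscissa e) (ordinate e) (ℤ.+ S) (proj₂ d) (proj₂ d′))) (≡.sym (coordinates e)))
        where
        l : ∀ a b s x y → ((b ℤ.+ s) ℤ.* y ℤ.- (s ℤ.* x ℤ.+ s ℤ.* y)) ℤ.+ (a ℤ.+ s) ℤ.* x ≡ a ℤ.* x ℤ.+ b ℤ.* y
        l = solve-∀

      module _ (ω : Carrier) where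

        -- k (X^(α d) - ω^α) X^b divided by X^d - ω
        geometric : Carrier → ℕ → ℤ² → LPoly
        geometric k zero b = []
        geometric k (suc n) b = (k * ω ^ n , b) ∷ geometric k n (b +² d)

        act-geometric : ∀ k n b z u → act (binomial d ω) (act (geometric k n b) z) u ≈
          k * z (u -² (b +² ((ℤ.+ n) · d))) + - (k * ω ^ n * z (u -² b))
        act-geometric k zero b z u = begin
          act (binomial d ω) (λ _ → 0#) u     ≈⟨ act-binomial d ω (λ _ → 0#) u ⟩
          0# + - (ω * 0#)                     ≈⟨ solve 3 (λ ω k y → con (ℤ.+ 0) :+ :- (ω :* con (ℤ.+ 0)) := k :* y :+ :- (k :* y)) refl ω k (z (u -² b)) ⟩
          k * z (u -² b) + - (k * z (u -² b))
            ≈⟨ +-cong (*-congˡ (reflexive (≡.cong (λ v → z (u -² v)) (≡.sym (≡.trans (≡.cong (b +²_) (0· d)) (+²-identityʳ b))))))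
                      (-‿cong (*-congʳ (sym (*-identityʳ k)))) ⟩
          k * z (u -² (b +² ((ℤ.+ 0) · d))) + - (k * 1# * z (u -² b)) ∎
        act-geometric k (suc n) b z u = begin
          act (binomial d ω) (λ v → k * ω ^ n * z (v -² b) + y v) u
            ≈⟨ act-+ (binomial d ω) (λ v → k * ω ^ n * z (v -² b)) y u ⟩
          act (binomial d ω) (λ v → k * ω ^ n * z (v -² b)) u + act (binomial d ω) y u
            ≈⟨ +-cong (act-binomial d ω (λ v → k * ω ^ n * z (v -² b)) u) (act-geometric k n (b +² d) z u) ⟩
          (k * ω ^ n * z ((u -² d) -² b) + - (ω * (k * ω ^ n * z (u -² b)))) +
            (k * z (u -² ((b +² d) +² ((ℤ.+ n) · d))) + - (k * ω ^ n * z (u -² (b +² d))))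
            ≈⟨ +-cong (+-congʳ (*-congˡ (reflexive (≡.cong z (≡.trans (-²-comm u d b) (≡.sym (-²-+² u b d)))))))
                 (+-congʳ (*-congˡ (reflexive (≡.cong (λ v → z (u -² v)) end)))) ⟩
          (k * ω ^ n * z (u -² (b +² d)) + - (ω * (k * ω ^ n * z (u -² b)))) +
            (k * z (u -² (b +² ((ℤ.+ suc n) · d))) + - (k * ω ^ n * z (u -² (b +² d))))
            ≈⟨ solve 6 (λ k p ω a c e → (k :* p :* a :+ :- (ω :* (k :* p :* c))) :+ (k :* e :+ :- (k :* p :* a)) := k :* e :+ :- (k :* (ω :* p) :* c))
                 refl k (ω ^ n) ω _ _ _ ⟩
          k * z (u -² (b +² ((ℤ.+ suc n) · d))) + - (k * (ω * ω ^ n) * z (u -² b)) ∎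
          where
          y = act (geometric k n (b +² d)) z
          end : (b +² d) +² ((ℤ.+ n) · d) ≡ b +² ((ℤ.+ suc n) · d)
          end = ≡.trans (+²-assoc b d _) (≡.cong (b +²_) (≡.sym (≡.trans (·-distribʳ (ℤ.+ 1) (ℤ.+ n) d) (≡.cong (_+² ((ℤ.+ n) · d)) (1· d)))))

        cofactor : Terms → LPoly
        cofactor [] = []
        cofactor ((k , e) ∷ G) = geometric (fromℤ k) (α e) (base (τ e)) ++ cofactor G

        -- Division with remainder by X^d - ω, term by term: the remainder replaces X^(α d) by ω^α.
        -- Grouped by height, its coefficients are the values of the rows at ω, so it vanishes when
        -- they do.
        act-cofactor : ∀ G → All (Within S) G → ∀ z u →
          act (binomial d ω) (act (cofactor G) z) u ≈ act (embed G) z u + - rowSum (rows G) ω (λ t → z (u -² base t))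
        act-cofactor [] [] z u = trans (act-binomial d ω (λ _ → 0#) u)
          (solve 1 (λ ω → con (ℤ.+ 0) :+ :- (ω :* con (ℤ.+ 0)) := con (ℤ.+ 0) :+ :- con (ℤ.+ 0)) refl ω)
        act-cofactor ((k , e) ∷ G) (within-e ∷ hs) z u = begin
          act (binomial d ω) (act (g ++ cofactor G) z) u
            ≈⟨ act-cong (binomial d ω) (act-++ g (cofactor G) z) u ⟩
          act (binomial d ω) (λ v → act g z v + act (cofactor G) z v) u
            ≈⟨ act-+ (binomial d ω) (act g z) (act (cofactor G) z) u ⟩
          act (binomial d ω) (act g z) u + act (binomial d ω) (act (cofactor G) z) u
            ≈⟨ +-cong (act-geometric (fromℤ k) (α e) (base (τ e)) z u) (act-cofactor G hs z u) ⟩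
          (fromℤ k * z (u -² (base (τ e) +² ((ℤ.+ α e) · d))) + - (fromℤ k * ω ^ α e * z (u -² base (τ e)))) + (s + - r)
            ≈⟨ +-congʳ (+-congʳ (*-congˡ (reflexive (≡.cong (λ v → z (u -² v)) (decompose k e within-e))))) ⟩
          (fromℤ k * z (u -² e) + - (fromℤ k * ω ^ α e * z (u -² base (τ e)))) + (s + - r)
            ≈⟨ solve 4 (λ a b s r → (a :+ :- b) :+ (s :+ :- r) := (a :+ s) :+ :- (b :+ r)) refl _ _ s r ⟩
          (fromℤ k * z (u -² e) + s) + - (fromℤ k * ω ^ α e * z (u -² base (τ e)) + r) ∎
          where
          g = geometric (fromℤ k) (α e) (base (τ e))
          s = act (embed G) z u
          r = rowSum (rows G) ω (λ t → z (u -² base t))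

        divides : ∀ G → All (Within S) G → (∀ j → j ≤ S ℕ.+ S → row (rows G) ω j ≈ 0#) → binomial d ω ∣L embed G
        divides G hs rows≈0 = cofactor G , λ x → begin
          coeff (binomial d ω *L cofactor G) x               ≈⟨ coeff-*L (binomial d ω) (cofactor G) x ⟩
          act (binomial d ω) (act (cofactor G) δ) x          ≈⟨ act-cofactor G hs δ x ⟩
          act (embed G) δ x + - rowSum (rows G) ω (F x)      ≈⟨ +-cong (sym (coeff≈act (embed G) x)) (-‿cong (vanishing x)) ⟩
          coeff (embed G) x + - 0#                           ≈⟨ trans (+-congˡ -0#≈0#) (+-identityʳ _) ⟩
          coeff (embed G) x                                  ∎
          where
          F : ℤ² → ℕ → Carrier
          F x t = δ (x -² base t)
          vanishing : ∀ x → rowSum (rows G) ω (F x) ≈ 0#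
          vanishing x = trans (rowSum-grouped (rows G) ω (F x) (rows-height G hs))
            (sumTo-0 _ _ λ j j<1+h → trans (*-congʳ (rows≈0 j (ℕₚ.≤-pred j<1+h))) (zeroˡ _))

  -- X^d - ω divides G for some ω ≠ 0, where d is the primitive vector in direction w
  Bad : Terms → ∀ {w} → Basis w → Set _
  Bad G basis = ∃ λ ω → ¬ (ω ≈ 0#) × (∀ j → j ≤ spread G ℕ.+ spread G → row (rows G) ω j ≈ 0#)
    where open Along basis using (spread; module Shifted)
          open Shifted (spread G) using (rows)

  bad-line-factor : ∀ G {w} (basis : Basis w) → ¬ (w ≡ 0²) → Bad G basis → ∃ λ h → IsLinePoly h w × h ∣L embed G
  bad-line-factor G {w} basis w≢0 (ω , ω≉0 , rows≈0) =
    binomial d ω , binomial-line d ω w d≢0 w≢0 d∥w ω≉0 , divides ω G (within G) rows≈0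
    where
    open Basis basis
    open Along basis
    open Shifted (spread G)
    d≢0 : ¬ (d ≡ 0²)
    d≢0 d≡0 = w≢0 (≡.trans multiple (≡.trans (≡.cong ((ℤ.+ index) ·_) d≡0) (≡.cong₂ _,_ (ℤₚ.*-zeroʳ (ℤ.+ index)) (ℤₚ.*-zeroʳ (ℤ.+ index)))))
    l : ∀ x y n → x ℤ.* (n ℤ.* y) ℤ.- y ℤ.* (n ℤ.* x) ≡ ℤ.+ 0
    l = solve-∀
    d∥w : Parallel d w
    d∥w = ≡.trans (≡.cong (cross d) multiple) (l (proj₁ d) (proj₂ d) (ℤ.+ index))

-- Making equality stable

module DoubleNegation {c ℓ} (R : CommutativeRing c ℓ) where
  open CommutativeRing R
  open import Data.Product using (_,_)

  -- Equality in an arbitrary field need not be stable; this makes it so without changing the operations.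
  stabilised : CommutativeRing c ℓ
  stabilised = record
    { Carrier = Carrier ; _≈_ = λ x y → ¬ ¬ (x ≈ y) ; _+_ = _+_ ; _*_ = _*_ ; -_ = -_ ; 0# = 0# ; 1# = 1#
    ; isCommutativeRing = record
      { isRing = record
        { +-isAbelianGroup = record
          { isGroup = record
            { isMonoid = record
              { isSemigroup = record
                { isMagma = record
                  { isEquivalence = record
                    { refl = λ n → n refl ; sym = λ p n → p λ p → n (sym p) ; trans = λ p q n → p λ p → q λ q → n (trans p q) }
                  ; ∙-cong = λ p q n → p λ p → q λ q → n (+-cong p q) }
                ; assoc = λ x y z n → n (+-assoc x y z) }
              ; identity = (λ x n → n (+-identityˡ x)) , (λ x n → n (+-identityʳ x)) }
            ; inverse = (λ x n → n (-‿inverseˡ x)) , (λ x n → n (-‿inverseʳ x))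
            ; ⁻¹-cong = λ p n → p λ p → n (-‿cong p) }
          ; comm = λ x y n → n (+-comm x y) }
        ; *-cong = λ p q n → p λ p → q λ q → n (*-cong p q)
        ; *-assoc = λ x y z n → n (*-assoc x y z)
        ; *-identity = (λ x n → n (*-identityˡ x)) , (λ x n → n (*-identityʳ x))
        ; distrib = (λ x y z n → n (distribˡ x y z)) , (λ x y z n → n (distribʳ x y z)) }
      ; *-comm = λ x y n → n (*-comm x y) } }

  module Original = Rows R
  module Stable = Rows stabilised
  open import Algebra.Properties.Semiring.Exp semiring using (_^_)
  import Algebra.Properties.Semiring.Exp (CommutativeRing.semiring stabilised) as StableExp
  open import Data.Nat as ℕ using (ℕ; zero; suc)
  open import Data.List using ([]; _∷_)
  open import Relation.Nullary using (yes; no)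
  open import Relation.Binary.PropositionalEquality as ≡ using (_≡_)

  -- The operations are shared, but functions defined by recursion over the two rings coincide only
  -- after an induction.
  eigens≡ : ∀ ωs y i → Stable.eigens ωs y i ≡ Original.eigens ωs y i
  eigens≡ [] y i = ≡.refl
  eigens≡ (ω ∷ ωs) y i = eigens≡ ωs (Original.eigen ω y) i

  rowAct≡ : ∀ G y i t → Stable.rowAct G y i t ≡ Original.rowAct G y i t
  rowAct≡ [] y i t = ≡.refl
  rowAct≡ ((k , α , τ) ∷ G) y i t = ≡.cong (_ +_) (rowAct≡ G y i t)

  ^≡ : ∀ x n → x StableExp.^ n ≡ x ^ n
  ^≡ x zero = ≡.refl
  ^≡ x (suc n) = ≡.cong (x *_) (^≡ x n)

  row≡ : ∀ G ω j → Stable.row G ω j ≡ Original.row G ω j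
  row≡ [] ω j = ≡.refl
  row≡ ((k , α , τ) ∷ G) ω j with τ ℕ.≟ j
  ... | yes _ = ≡.cong₂ (λ p r → k * p + r) (^≡ ω α) (row≡ G ω j)
  ... | no _ = ≡.cong (0# +_) (row≡ G ω j)

-- Rigidity of periodic functions killed by G

module Rigidity {κ ℓ} (K : ACF0 κ ℓ) where
  open ACF0 K hiding (zero)
  open IntegersIn commRing
  open Plane
  open Bases
  open LineFactors K
  open Rows commRing using (rowAct)
  open DoubleNegation commRing
  open Differences using (Δ; act-Δ; Δ-0; Vanishes)
  open Periods
  open import Data.Integer as ℤ using (ℤ)
  import Data.Integer.Properties as ℤₚ
  module ℤAct = Action ℤₚ.+-*-commutativeRing
  open import Data.Integer.Tactic.RingSolver using (solve-∀)
  open import Data.Nat as ℕ using (ℕ; zero; suc; _≤_; _<_; s≤s; _∸_; _!)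
  import Data.Nat.Properties as ℕₚ
  open import Data.Nat.Divisibility using (quotient; m∣n⇒n≡quotient*m)
  open import Data.List using ([]; _∷_)
  open import Data.List.Relation.Unary.All using (All; []; _∷_)
  open import Data.Product using (_,_; proj₁; proj₂)
  open import Data.Sum using (inj₂)
  open import Relation.Nullary using (yes; no; contradiction)
  open import Relation.Nullary.Decidable using (decidable-stable)
  open import Relation.Binary.PropositionalEquality as ≡ using (_≡_)

  fromℤ-injective : ∀ k → fromℤ k ≈ 0# → k ≡ ℤ.+ 0
  fromℤ-injective (ℤ.+ zero) eq = ≡.refl
  fromℤ-injective (ℤ.+ suc n) eq = contradiction eq (char0 n)
  fromℤ-injective ℤ.-[1+ n ] eq = contradiction (trans (sym (-‿involutive _)) (trans (-‿cong eq) -0#≈0#)) (char0 n)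
    where open import Algebra.Properties.Ring ring using (-‿involutive; -0#≈0#)

  -- The double-negation shift, for a bounded range. It turns rows that vanish only up to double
  -- negation into a refutation of `¬ Bad`.
  finite-¬¬ : ∀ n {P : ℕ → Set ℓ} → (∀ k → k < n → ¬ ¬ P k) → ¬ ¬ (∀ k → k < n → P k)
  finite-¬¬ zero h none = none λ k ()
  finite-¬¬ (suc n) {P} h none = finite-¬¬ n (λ k k<n → h k (ℕₚ.m<n⇒m<1+n k<n)) λ below → h n ℕₚ.≤-refl λ Pn →
    none λ k k<1+n → case-≤ k k<1+n below Pn
    where
    case-≤ : ∀ k → k < suc n → (∀ k → k < n → P k) → P n → P k
    case-≤ k k<1+n below Pn with k ℕ.≟ n
    ... | yes ≡.refl = Pn
    ... | no k≢n = below k (ℕₚ.≤∧≢⇒< (ℕₚ.≤-pred k<1+n) k≢n)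

  module _ {w} (basis : Basis w) where
    open Basis basis
    open Along basis

    -- From row 2 S on the truncated subtraction is exact, so the row recurrence is the action of G,
    -- up to the translation that made the exponents nonnegative.
    rowAct-embedded : ∀ S G → All (Within S) G → ∀ (φ : ℤ² → ℤ) c x t → S ℕ.+ S ≤ t →
      rowAct (Shifted.rows S G) (λ x t → fromℤ (φ (point x (c ℤ.+ ℤ.+ t)))) x t ≈
      fromℤ (ℤAct.act G φ (point x (c ℤ.+ ℤ.+ t) -² Shifted.origin S))
    rowAct-embedded S [] [] φ c x t h≤t = refl
    rowAct-embedded S ((k , e) ∷ G) (within-e@(a≤ , b≤) ∷ hs) φ c x t h≤t = trans
      (+-cong (trans (*-congˡ (reflexive (≡.cong (λ v → fromℤ (φ v)) here))) (sym (fromℤ-* k _))) (rowAct-embedded S G hs φ c x t h≤t))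
      (sym (fromℤ-+ (k ℤ.* φ ((point x (c ℤ.+ ℤ.+ t) -² Shifted.origin S) -² e)) _))
      where
      open Shifted S using (α; τ; origin)
      τ≤t : τ e ≤ t
      τ≤t = ℕₚ.≤-trans (ℕₚ.≤-trans (ℤₚ.∣i+j∣≤∣i∣+∣j∣ (ordinate e) (ℤ.+ S)) (ℕₚ.+-monoˡ-≤ S b≤)) h≤t
      monus : ℤ.+ (t ∸ τ e) ≡ ℤ.+ t ℤ.- (ordinate e ℤ.+ ℤ.+ S)
      monus = ≡.trans (≡.sym (ℤₚ.⊖-≥ τ≤t)) (≡.trans (≡.sym (ℤₚ.m-n≡m⊖n t (τ e))) (≡.cong (λ i → ℤ.+ t ℤ.- i) (shift-nonneg (ordinate e) b≤)))
      l : ∀ x a s c t b y z → (x ℤ.- (a ℤ.+ s)) ℤ.* y ℤ.+ (c ℤ.+ (t ℤ.- (b ℤ.+ s))) ℤ.* z ≡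
                              ((x ℤ.* y ℤ.+ (c ℤ.+ t) ℤ.* z) ℤ.- (s ℤ.* y ℤ.+ s ℤ.* z)) ℤ.- (a ℤ.* y ℤ.+ b ℤ.* z)
      l = solve-∀
      here : point (x ℤ.- ℤ.+ α e) (c ℤ.+ ℤ.+ (t ∸ τ e)) ≡ (point x (c ℤ.+ ℤ.+ t) -² origin) -² e
      here = ≡.trans (≡.cong₂ (λ a b → point (x ℤ.- a) (c ℤ.+ b)) (shift-nonneg (abscissa e) a≤) monus)
        (≡.trans (≡.cong₂ _,_ (l x (abscissa e) (ℤ.+ S) c (ℤ.+ t) (ordinate e) (proj₁ d) (proj₁ d′))
                             (l x (abscissa e) (ℤ.+ S) c (ℤ.+ t) (ordinate e) (proj₂ d) (proj₂ d′)))
          (≡.cong ((point x (c ℤ.+ ℤ.+ t) -² origin) -²_) (≡.sym (coordinates e))))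

    -- Period w means that X^(index d) - 1 kills every row, and this splits into linear factors over
    -- `K`; without a `Bad` ω, `propagate` applies. An integer equation is decidable, so its proof
    -- in `K` may be doubly negated.
    upward : ∀ G → ¬ Bad G basis → ∀ {φ} → Periodic φ w → Vanishes (ℤAct.act G φ) → ∀ c →
      (∀ x t → t < spread G ℕ.+ spread G → φ (point x (c ℤ.+ ℤ.+ t)) ≡ ℤ.+ 0) →
      ∀ x t → φ (point x (c ℤ.+ ℤ.+ t)) ≡ ℤ.+ 0
    upward G good {φ} periodic annihilated c start x t =
      decidable-stable (_ ℤ.≟ _) λ ≢0 → zero-in-K λ ≈0 → ≢0 (fromℤ-injective (φ (point x (c ℤ.+ ℤ.+ t))) ≈0)
      where
      S = spread G
      ωs = proj₁ (Roots.roots-of-unity K index-1)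
      y : ℤ → ℕ → Carrier
      y x t = fromℤ (φ (point x (c ℤ.+ ℤ.+ t)))
      step-back : ∀ x t → point (x ℤ.- ℤ.+ index) t ≡ point x t -² w
      step-back x t = ≡.trans (≡.cong₂ _,_ (l x (ℤ.+ index) t (proj₁ d) (proj₁ d′)) (l x (ℤ.+ index) t (proj₂ d) (proj₂ d′)))
                        (≡.cong (point x t -²_) (≡.sym multiple))
        where l : ∀ x n t a b → (x ℤ.- n) ℤ.* a ℤ.+ t ℤ.* b ≡ (x ℤ.* a ℤ.+ t ℤ.* b) ℤ.- n ℤ.* a
              l = solve-∀
      zero-in-K : ¬ ¬ (y x t ≈ 0#)
      zero-in-K = Stable.Propagation.propagate
        (λ p n → p λ q → q n)
        (λ x≉0 xy≈0 n → x≉0 λ x≈0 → xy≈0 λ xy≈0 → n (Roots.integral K x≈0 xy≈0))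
        (Shifted.rows S G) (Shifted.rows-height S G (within G))
        (λ ω ω≉0 rows≈0 → finite-¬¬ (suc (S ℕ.+ S)) (λ k k< n → rows≈0 k (ℕₚ.≤-pred k<) λ eq → n (trans (reflexive (≡.sym (row≡ (Shifted.rows S G) ω k))) eq))
          λ rows≈0 → ω≉0 λ ω≈0 → good (ω , ω≈0 , λ j j≤ → rows≈0 j (s≤s j≤)))
        ωs y
        (λ x t h≤t n → n (trans (reflexive (rowAct≡ (Shifted.rows S G) y x t))
          (trans (rowAct-embedded S G (within G) φ c x t h≤t) (reflexive (≡.cong fromℤ (annihilated _))))))
        (λ x t n → n (trans (reflexive (eigens≡ ωs (λ x → y x t) x))
          (proj₂ (Roots.roots-of-unity K index-1) (λ x → y x t)
            (λ x → reflexive (≡.cong fromℤ (≡.trans (≡.cong φ (step-back x (c ℤ.+ ℤ.+ t))) (periodic-neg periodic _)))) x)))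
        (λ x t t<h n → n (reflexive (≡.cong fromℤ (start x t t<h))))
        x t

    rowCount : Terms → ℕ → ℕ
    rowCount G B = windows B (spread G ℕ.+ spread G) index

    -- The pigeonhole period depends on the function but is at most `rowCount`, hence divides its
    -- factorial; the index comes from `lattice-periodic`.
    period : Terms → ℕ → ℕ
    period G B = index ℕ.* (rowCount G B) !

    period-nonzero : ∀ G B → ¬ (period G B ≡ 0)
    period-nonzero G B eq with ℕₚ.m*n≡0⇒m≡0∨n≡0 index {(rowCount G B) !} eq
    ... | inj₂ eq′ = ℕ.≢-nonZero⁻¹ ((rowCount G B) !) {{rowCount G B ℕₚ.!≢0}} eq′

    module _ (G : Terms) (good : ¬ Bad G basis) {f : ℤ² → ℤ} {B} (bounded : ∀ u → ℤ.∣ f u ∣ ≤ B)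
             (periodic : Periodic f w) (annihilated : Vanishes (ℤAct.act G f)) where
      private
        M = rowCount G B
        h = spread G ℕ.+ spread G

      -- Starting the pigeonhole M rows below row t makes a common period M! valid in row t.
      row-periodic-from : ∀ x t i j q → i < j → j ≤ M → M ! ≡ q ℕ.* (j ∸ i) →
        (∀ x τ → τ < h → f (point x ((t ℤ.- ℤ.+ M) ℤ.+ ℤ.+ (j ℕ.+ τ))) ≡ f (point x ((t ℤ.- ℤ.+ M) ℤ.+ ℤ.+ (i ℕ.+ τ)))) →
        f (point x t +² ((ℤ.+ (M !)) · d′)) ≡ f (point x t)
      row-periodic-from x t i j q i<j j≤M M!≡ same =
        ≡.trans (≡.cong f target) (≡.trans (repeat q (M ∸ i)) (≡.cong f (≡.sym source)))
        where
        p = j ∸ i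
        c = (t ℤ.- ℤ.+ M) ℤ.+ ℤ.+ i
        v = (ℤ.+ p) · d′
        up : ∀ x s r → point x (c ℤ.+ s) +² (r · d′) ≡ point x (c ℤ.+ (s ℤ.+ r))
        up x s r = ≡.cong₂ _,_ (l x c s r (proj₁ d) (proj₁ d′)) (l x c s r (proj₂ d) (proj₂ d′))
          where l : ∀ x c s p a b → x ℤ.* a ℤ.+ (c ℤ.+ s) ℤ.* b ℤ.+ p ℤ.* b ≡ x ℤ.* a ℤ.+ (c ℤ.+ (s ℤ.+ p)) ℤ.* b
                l = solve-∀
        raise : ∀ s → point x (c ℤ.+ ℤ.+ s) +² v ≡ point x (c ℤ.+ ℤ.+ (s ℕ.+ p))
        raise s = up x (ℤ.+ s) (ℤ.+ p)
        low : ∀ x s → f (point x (c ℤ.+ ℤ.+ s)) ≡ f (point x ((t ℤ.- ℤ.+ M) ℤ.+ ℤ.+ (i ℕ.+ s)))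
        low x s = ≡.cong (λ r → f (point x r)) (ℤₚ.+-assoc (t ℤ.- ℤ.+ M) (ℤ.+ i) (ℤ.+ s))
        high : ∀ x s → f (point x (c ℤ.+ ℤ.+ s) +² v) ≡ f (point x ((t ℤ.- ℤ.+ M) ℤ.+ ℤ.+ (j ℕ.+ s)))
        high x s = ≡.cong f (≡.trans (up x (ℤ.+ s) (ℤ.+ p))
          (≡.cong (point x) (≡.trans (l′ (t ℤ.- ℤ.+ M) (ℤ.+ i) (ℤ.+ p) (ℤ.+ s)) (≡.cong (λ n → (t ℤ.- ℤ.+ M) ℤ.+ (ℤ.+ n ℤ.+ ℤ.+ s)) (ℕₚ.m+[n∸m]≡n (ℕₚ.<⇒≤ i<j))))))
          where l′ : ∀ m i p s → (m ℤ.+ i) ℤ.+ (s ℤ.+ p) ≡ m ℤ.+ ((i ℤ.+ p) ℤ.+ s)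
                l′ = solve-∀
        -- The difference `Δ v f` is again of period w and killed by G. It vanishes on the h rows of
        -- the repeated window, hence on all rows above them.
        above : ∀ x s → Δ v f (point x (c ℤ.+ ℤ.+ s)) ≡ ℤ.+ 0
        above = upward G good {Δ v f}
          (λ u → ≡.cong₂ ℤ._-_ (≡.trans (≡.cong f (≡.trans (+²-assoc u w v) (≡.trans (≡.cong (u +²_) (+²-comm w v)) (≡.sym (+²-assoc u v w))))) (periodic (u +² v))) (periodic u))
          (λ u → ≡.trans (act-Δ G v f u) (Δ-0 v annihilated u)) c
          (λ x s s<h → ℤₚ.i≡j⇒i-j≡0 (≡.trans (high x s) (≡.trans (same x s s<h) (≡.sym (low x s)))))
        repeat : ∀ q s → f (point x (c ℤ.+ ℤ.+ (s ℕ.+ q ℕ.* p))) ≡ f (point x (c ℤ.+ ℤ.+ s))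
        repeat zero s = ≡.cong (λ s → f (point x (c ℤ.+ ℤ.+ s))) (ℕₚ.+-identityʳ s)
        repeat (suc q) s = ≡.trans (≡.cong (λ s → f (point x (c ℤ.+ ℤ.+ s))) (≡.sym (ℕₚ.+-assoc s p (q ℕ.* p))))
          (≡.trans (repeat q (s ℕ.+ p)) (≡.trans (≡.cong f (≡.sym (raise s))) (ℤₚ.i-j≡0⇒i≡j _ _ (above x s))))
        i≤M : i ≤ M
        i≤M = ℕₚ.≤-trans (ℕₚ.<⇒≤ i<j) j≤M
        t≡ : t ≡ c ℤ.+ ℤ.+ (M ∸ i)
        t≡ = ≡.trans (l t (ℤ.+ M)) (≡.trans (≡.cong (λ n → (t ℤ.- ℤ.+ M) ℤ.+ ℤ.+ n) (≡.sym (ℕₚ.m+[n∸m]≡n i≤M))) (≡.sym (ℤₚ.+-assoc (t ℤ.- ℤ.+ M) (ℤ.+ i) (ℤ.+ (M ∸ i)))))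
          where l : ∀ t m → t ≡ (t ℤ.- m) ℤ.+ m
                l = solve-∀
        source : point x t ≡ point x (c ℤ.+ ℤ.+ (M ∸ i))
        source = ≡.cong (point x) t≡
        target : point x t +² ((ℤ.+ (M !)) · d′) ≡ point x (c ℤ.+ ℤ.+ ((M ∸ i) ℕ.+ q ℕ.* p))
        target = ≡.trans (≡.cong₂ (λ r m → point x r +² ((ℤ.+ m) · d′)) t≡ M!≡)
          (up x (ℤ.+ (M ∸ i)) (ℤ.+ (q ℕ.* p)))

      row-periodic : ∀ x t → f (point x t +² ((ℤ.+ (M !)) · d′)) ≡ f (point x t)
      row-periodic x t =
        let i , j , i<j , j≤M , same = repeated-window basis bounded periodic h (t ℤ.- ℤ.+ M)
            p∣M! = Binomials.≤⇒∣! (ℕₚ.m<n⇒0<n∸m i<j) (ℕₚ.≤-trans (ℕₚ.m∸n≤m j i) j≤M)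
        in row-periodic-from x t i j (quotient p∣M!) i<j j≤M (m∣n⇒n≡quotient*m p∣M!) same

    rigid : ∀ G → ¬ Bad G basis → ∀ {f B} → (∀ u → ℤ.∣ f u ∣ ≤ B) → Periodic f w → Vanishes (ℤAct.act G f) →
      ∀ v → Periodic f ((ℤ.+ period G B) · v)
    rigid G good {f} {B} bounded periodic annihilated = lattice-periodic basis ((rowCount G B) !) periodic λ u →
      ≡.subst (λ u → f (u +² ((ℤ.+ ((rowCount G B) !)) · d′)) ≡ f u) (≡.sym (coordinates u))
        (row-periodic G good bounded periodic annihilated (cross u d′) (cross d u))

-- Trading binomials for parallel ones

module Reduction {κ ℓ} (K : ACF0 κ ℓ) where
  open Plane
  open Bases
  open Dilation using (Fun; act; Const; small-multiple)
  open Differences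
  open Periods
  open LineFactors K using (Bad; Terms)
  open Rigidity K using (rigid; period; period-nonzero)
  open import Data.Integer using (ℤ; +_; ∣_∣; _+_; _*_; -_; _-_)
  import Data.Integer as ℤ
  import Data.Integer.Properties as ℤₚ
  open import Data.Integer.Tactic.RingSolver using (solve-∀)
  open import Data.Nat as ℕ using (ℕ; zero; suc; _≤_; _^_)
  import Data.Nat.Properties as ℕₚ
  open import Data.List using (List; []; _∷_; _++_; map; length)
  open import Data.List.Properties using (length-++; length-map; ++-identityʳ)
  open import Data.List.Relation.Unary.All as All using (All; []; _∷_)
  open import Data.Product using (∃; Σ; _,_; proj₁; proj₂)
  open import Data.Sum using (_⊎_; inj₁; inj₂; [_,_]′)
  open import Relation.Nullary using (yes; no; contradiction)
  open import Relation.Binary.PropositionalEquality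

  Direction : Set
  Direction = Σ ℤ² λ w → ¬ (w ≡ 0²)

  direction-basis : (w : Direction) → Basis (proj₁ w)
  direction-basis (w , w≢0) = basis w w≢0

  Δ-vanishes⇒periodic : ∀ {w z} → Vanishes (Δ w z) → Periodic z w
  Δ-vanishes⇒periodic h u = ℤₚ.i-j≡0⇒i≡j _ _ (h u)

  periodic⇒Δ-vanishes : ∀ {w z} → Periodic z w → Vanishes (Δ w z)
  periodic⇒Δ-vanishes h u = ℤₚ.i≡j⇒i-j≡0 (h u)

  linear-growth : ∀ v z → Periodic (Δ v z) v → ∀ n u → z (u +² ((+ n) · v)) ≡ z u + + n * Δ v z u
  linear-growth v z p zero u = trans (cong z (trans (cong (u +²_) (0· v)) (+²-identityʳ u))) (sym (ℤₚ.+-identityʳ (z u)))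
  linear-growth v z p (suc n) u = begin
    z (u +² ((+ suc n) · v))                         ≡⟨ cong (λ t → z (u +² t)) (trans (·-distribʳ (+ 1) (+ n) v) (cong (_+² ((+ n) · v)) (1· v))) ⟩
    z (u +² (v +² ((+ n) · v)))                      ≡⟨ cong z (sym (+²-assoc u v ((+ n) · v))) ⟩
    z ((u +² v) +² ((+ n) · v))                      ≡⟨ linear-growth v z p n (u +² v) ⟩
    z (u +² v) + + n * Δ v z (u +² v)                ≡⟨ cong (λ t → z (u +² v) + + n * t) (p u) ⟩
    z (u +² v) + + n * Δ v z u                       ≡⟨ l (z (u +² v)) (z u) (+ n) ⟩
    z u + + suc n * Δ v z u                          ∎
    where
    open ≡-Reasoning
    l : ∀ a b n → a + n * (a - b) ≡ b + (+ 1 + n) * (a - b)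
    l = solve-∀

  -- Along v the function grows linearly with slope `Δ v z`. After 2 B + 1 steps a nonzero slope
  -- would exceed 2 B, the largest possible difference of values.
  bounded-periodic : ∀ {v z B} → (∀ u → ∣ z u ∣ ≤ B) → Periodic (Δ v z) v → Periodic z v
  bounded-periodic {v} {z} {B} bounded p = Δ-vanishes⇒periodic λ u → vanishes u
    where
    N = suc (B ℕ.+ B)
    vanishes : Vanishes (Δ v z)
    vanishes u with ℤₚ.i*j≡0⇒i≡0∨j≡0 (+ N) (small-multiple (+ N) (Δ v z u) (B ℕ.+ B) bound ℕₚ.≤-refl)
      where
      open ℕₚ.≤-Reasoning
      l : ∀ a b → b ≡ (a + b) - a
      l = solve-∀
      bound : ∣ + N * Δ v z u ∣ ≤ B ℕ.+ B
      bound = begin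
        ∣ + N * Δ v z u ∣                              ≡⟨ cong ∣_∣ (trans (l (z u) (+ N * Δ v z u)) (cong (_- z u) (sym (linear-growth v z p N u)))) ⟩
        ∣ z (u +² ((+ N) · v)) - z u ∣                 ≤⟨ ℤₚ.∣i-j∣≤∣i∣+∣j∣ (z (u +² ((+ N) · v))) (z u) ⟩
        ∣ z (u +² ((+ N) · v)) ∣ ℕ.+ ∣ z u ∣           ≤⟨ ℕₚ.+-mono-≤ (bounded _) (bounded u) ⟩
        B ℕ.+ B                                        ∎
    ... | inj₂ eq = eq

  Δ-bounded : ∀ w z {B} → (∀ u → ∣ z u ∣ ≤ B) → ∀ u → ∣ Δ w z u ∣ ≤ B ℕ.+ B
  Δ-bounded w z bounded u = ℕₚ.≤-trans (ℤₚ.∣i-j∣≤∣i∣+∣j∣ (z (u +² w)) (z u)) (ℕₚ.+-mono-≤ (bounded _) (bounded u))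

  -- Each factor for k v may be replaced by one for its multiple N v. A repeated factor for the same
  -- vector is then removed by boundedness, one at a time.
  collapse : ∀ v N ks → All (λ k → ∃ λ q → N ≡ q * k) ks → ∀ {z B} → (∀ u → ∣ z u ∣ ≤ B) →
    Vanishes (Δs (map (_· v) ks) z) → Periodic z (N · v)
  collapse v N [] [] bounded h u = trans (h (u +² (N · v))) (sym (h u))
  collapse v N (k ∷ ks) ((q , N≡) ∷ qs) {z} bounded h =
    bounded-periodic bounded (collapse v N ks qs (Δ-bounded (N · v) z bounded) λ u →
      trans (Δs-Δ (map (_· v) ks) (N · v) z u)
        (periodic⇒Δ-vanishes (subst (Periodic (Δs (map (_· v) ks) z)) (trans (sym (·-assoc q k v)) (cong (_· v) (sym N≡)))
          (periodic-· (Δ-vanishes⇒periodic h) q)) u))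

  product : List ℤ → ℤ
  product [] = + 1
  product (k ∷ ks) = k * product ks

  divides-product : ∀ ks → All (λ k → ∃ λ q → product ks ≡ q * k) ks
  divides-product [] = []
  divides-product (k ∷ ks) = (product ks , ℤₚ.*-comm k (product ks)) ∷
    All.map (λ {k′} (q , eq) → k * q , trans (cong (k *_) eq) (sym (ℤₚ.*-assoc k q k′))) (divides-product ks)

  product-nonzero : ∀ ks → All (λ k → ¬ (k ≡ + 0)) ks → ¬ (product ks ≡ + 0)
  product-nonzero [] [] ()
  product-nonzero (k ∷ ks) (k≢0 ∷ h) eq = [ k≢0 , product-nonzero ks h ]′ (ℤₚ.i*j≡0⇒i≡0∨j≡0 k eq)

  module _ (G : Terms) (gaps : List Direction) (w* : Direction) where

    private
      module B* = Basis (direction-basis w*)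
      v* = proj₁ w*
      s = length gaps

    -- The second alternative cannot be tested; this is why `factor` branches on parallelism alone.
    Compatible : Direction → Set _
    Compatible w = Parallel (proj₁ w) v* ⊎ ¬ Bad G (direction-basis w)

    -- the coefficient k such that a period w of a difference of c gives the period k w*
    factor : Direction → ℤ
    factor w with cross (proj₁ w) v* ℤ.≟ + 0
    ... | yes _ = cross (proj₁ w) B*.d′
    ... | no _ = + period (direction-basis w) G (2 ^ s)

    parallel-on-axis : ∀ w → Parallel w v* → w ≡ cross w B*.d′ · B*.d
    parallel-on-axis w p = trans (B*.coordinates w) (trans (cong (λ t → B*.point (cross w B*.d′) t) zero-ordinate)
        (trans (cong ((cross w B*.d′ · B*.d) +²_) (0· B*.d′)) (+²-identityʳ _)))
      where
      l : ∀ n a b x y → n * (a * y - b * x) ≡ - (x * (n * b) - y * (n * a))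
      l = solve-∀
      scaled : + B*.index * cross B*.d w ≡ + 0
      scaled = trans (l (+ B*.index) (proj₁ B*.d) (proj₂ B*.d) (proj₁ w) (proj₂ w)) (cong -_ (trans (cong (cross w) (sym B*.multiple)) p))
      zero-ordinate : cross B*.d w ≡ + 0
      zero-ordinate with ℤₚ.i*j≡0⇒i≡0∨j≡0 (+ B*.index) scaled
      ... | inj₂ eq = eq

    -- If w = k d is parallel to w* = index d, then index w = k w*. Otherwise w carries no line
    -- factor, and rigidity yields a period along w* too.
    factor-period : ∀ w → Compatible w → ∀ {z} → (∀ u → ∣ z u ∣ ≤ 2 ^ s) → Vanishes (act G z) →
      Periodic z (proj₁ w) → Periodic z (factor w · v*)
    factor-period w compatible {z} bounded annihilated p with cross (proj₁ w) v* ℤ.≟ + 0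
    ... | yes ∥ = subst (Periodic z) same (periodic-· p (+ B*.index))
      where
      k = cross (proj₁ w) B*.d′
      same : (+ B*.index) · proj₁ w ≡ k · v*
      same = trans (cong ((+ B*.index) ·_) (parallel-on-axis (proj₁ w) ∥)) (trans (sym (·-assoc (+ B*.index) k B*.d))
        (trans (cong (_· B*.d) (ℤₚ.*-comm (+ B*.index) k)) (trans (·-assoc k (+ B*.index) B*.d) (cong (k ·_) (sym B*.multiple)))))
    ... | no ∦ with compatible
    ...   | inj₁ ∥ = contradiction ∥ ∦
    ...   | inj₂ good = rigid (direction-basis w) G good bounded p annihilated v*

    factor-nonzero : ∀ w → ¬ (factor w ≡ + 0)
    factor-nonzero w with cross (proj₁ w) v* ℤ.≟ + 0
    ... | yes ∥ = λ eq → proj₂ w (trans (parallel-on-axis (proj₁ w) ∥) (trans (cong (_· B*.d) eq) (0· B*.d)))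
    ... | no _ = λ eq → period-nonzero (direction-basis w) G (2 ^ s) (ℤₚ.+-injective eq)

    -- The list of multiples of `w*` obtained so far is never empty: it starts with the difference
    -- that turned the constant G c into 0.
    collect : ℤ → List ℤ → List Direction → List ℤ
    collect k ks [] = k ∷ ks
    collect k ks (w ∷ todo) = collect (factor w) (k ∷ ks) todo

    collect-nonzero : ∀ k ks todo → All (λ k → ¬ (k ≡ + 0)) (k ∷ ks) → All (λ k → ¬ (k ≡ + 0)) (collect k ks todo)
    collect-nonzero k ks [] h = h
    collect-nonzero k ks (w ∷ todo) h = collect-nonzero (factor w) (k ∷ ks) todo (factor-nonzero w ∷ h)

    abstract
      multiplier : ℤ
      multiplier = product (collect (+ 1) [] gaps)

      multiplier-nonzero : ¬ (multiplier ≡ + 0)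
      multiplier-nonzero = product-nonzero _ (collect-nonzero (+ 1) [] gaps ((λ ()) ∷ []))

    commonPeriod : Direction
    commonPeriod = multiplier · v* , λ eq → proj₂ w* (cong₂ _,_ (cancel (proj₁ v*) (cong proj₁ eq)) (cancel (proj₂ v*) (cong proj₂ eq)))
      where
      cancel : ∀ x → multiplier * x ≡ + 0 → x ≡ + 0
      cancel x eq = [ (λ m≡0 → contradiction m≡0 multiplier-nonzero) , (λ x≡0 → x≡0) ]′ (ℤₚ.i*j≡0⇒i≡0∨j≡0 multiplier eq)

    module _ {c : Fun} (bounded : ∀ u → ∣ c u ∣ ≤ 1) (const : Const (act G c)) where

      -- Let y be `c` under all binomials but that of w. It is bounded, has period w, and is killed
      -- by G because a difference remains that annihilates the constant G c; so `factor-period`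
      -- exchanges w for a multiple of w*.
      collect-period : ∀ k ks todo → All Compatible todo → length ks ℕ.+ length todo ≡ s →
        Vanishes (Δs (map (_· v*) (k ∷ ks) ++ map proj₁ todo) c) →
        Vanishes (Δs (map (_· v*) (collect k ks todo)) c)
      collect-period k ks [] [] len h = subst (λ ws → Vanishes (Δs ws c)) (++-identityʳ (map (_· v*) (k ∷ ks))) h
      collect-period k ks (w ∷ todo) (ok ∷ oks) len h =
        collect-period (factor w) (k ∷ ks) todo oks (trans (sym (ℕₚ.+-suc (length ks) (length todo))) len)
          (periodic⇒Δ-vanishes (factor-period w ok y-bounded y-annihilated (Δ-vanishes⇒periodic y-periodic)))
        where
        ws = map (_· v*) (k ∷ ks) ++ map proj₁ todo
        y = Δs ws c
        -- There are s + 1 binomials in all, the gaps and the initial difference; s are left without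
        -- w, and each at most doubles the bound 1 on `c`.
        ws-length : length ws ≡ s
        ws-length = trans (length-++ (map (_· v*) (k ∷ ks)))
          (trans (cong₂ ℕ._+_ (length-map (_· v*) (k ∷ ks)) (length-map proj₁ todo)) (trans (sym (ℕₚ.+-suc (length ks) (length todo))) len))
        y-bounded : ∀ u → ∣ y u ∣ ≤ 2 ^ s
        y-bounded u = ℕₚ.≤-trans (Δs-bounded ws bounded u) (ℕₚ.≤-reflexive (trans (ℕₚ.*-identityʳ _) (cong (2 ^_) ws-length)))
        y-annihilated : Vanishes (act G y)
        y-annihilated u = trans (act-Δs G ws c u) (ℤₚ.i≡j⇒i-j≡0 (Δs-const (map (_· v*) ks ++ map proj₁ todo) const (u +² (k · v*)) u))
        y-periodic : Vanishes (Δ (proj₁ w) y)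
        y-periodic u = trans (sym (Δs-move (map (_· v*) (k ∷ ks)) (proj₁ w) (map proj₁ todo) c u)) (h u)

      abstract
        common-period : All Compatible gaps → Vanishes (Δs (map proj₁ gaps) (Δ v* c)) → Periodic c (multiplier · v*)
        common-period compatible h = collapse v* multiplier (collect (+ 1) [] gaps) (divides-product (collect (+ 1) [] gaps)) bounded
          (collect-period (+ 1) [] gaps compatible refl λ u → trans (cong (λ v → Δ v (Δs (map proj₁ gaps) c) u) (1· v*))
            (trans (sym (Δs-Δ (map proj₁ gaps) v* c u)) (h u)))

-- Folding a periodic covering, and the finite search

module PeriodicCoverings where
  open Plane
  open Bases
  open Periods
  open import Data.Bool using (Bool; true; false; if_then_else_)
  open import Data.Integer using (ℤ; +_; ∣_∣; _+_; _*_; -_; _-_; _/ℕ_; _%ℕ_)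
  import Data.Integer as ℤ
  import Data.Integer.Properties as ℤₚ
  open import Data.Integer.DivMod using (a≡a%ℕn+[a/ℕn]*n; n%ℕd<d)
  open import Data.Integer.Tactic.RingSolver using (solve-∀)
  open import Data.Nat as ℕ using (ℕ; zero; suc; _≤_; _<_; z≤n; s≤s; _∸_; _!; _%_; _/_)
  import Data.Nat.Properties as ℕₚ
  open import Data.Nat.DivMod using (m≡m%n+[m/n]*n; m%n<n; m<n⇒m%n≡m; [m+n]%n≡m%n)
  open import Data.Nat.Divisibility using (_∣_; quotient; m∣n⇒n≡quotient*m)
  open import Data.Nat.Induction using (<-rec)
  open import Data.Fin using (Fin; zero; suc; toℕ; fromℕ<; combine; remQuot; funToFin; finToFun)
  import Data.Fin.Properties as Finₚ
  open import Data.List using (List; []; _∷_)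
  open import Data.List.Relation.Unary.All as All using (All; []; _∷_)
  open import Data.Product using (∃; _×_; _,_; proj₁; proj₂)
  open import Relation.Nullary using (Dec; yes; no)
  open import Relation.Nullary.Decidable using (map′)
  open import Relation.Binary.PropositionalEquality

  indicator : Configuration → ℤ² → ℤ
  indicator c u = if c u then + 1 else + 0

  indicator-bounded : ∀ c u → ∣ indicator c u ∣ ≤ 1
  indicator-bounded c u with c u
  ... | true = s≤s z≤n
  ... | false = z≤n

  indicator-injective : ∀ c u v → indicator c u ≡ indicator c v → c u ≡ c v
  indicator-injective c u v eq with c u | c v
  ... | true | true = refl
  ... | false | false = refl

  count-cong : ∀ D c c′ u u′ → All (λ d → c (u +² d) ≡ c′ (u′ +² d)) D → count D c u ≡ count D c′ u′
  count-cong [] c c′ u u′ [] = refl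
  count-cong (d ∷ D) c c′ u u′ (eq ∷ eqs) with c (u +² d) | c′ (u′ +² d)
  ... | true | true = cong suc (count-cong D c c′ u u′ eqs)
  ... | false | false = count-cong D c c′ u u′ eqs

  covering-at : ∀ {D b a c c′} u u′ → All (λ d → c (u +² d) ≡ c′ (u′ +² d)) D → c u ≡ c′ u′ →
    count D c′ u′ ≡ (if c′ u′ then b else a) → count D c u ≡ (if c u then b else a)
  covering-at {D} {b} {a} {c} {c′} u u′ eqs eq h =
    trans (count-cong D c c′ u u′ eqs) (trans h (cong (if_then b else a) (sym eq)))

  -- Two residues of x differ by a multiple of p + 1 that is at most p in absolute value, hence
  -- zero.
  %-unique : ∀ x p r q → r ≤ p → x ≡ + r + q * + suc p → x %ℕ suc p ≡ r
  %-unique x p r q r≤p eq = ℤₚ.+-injective (ℤₚ.i-j≡0⇒i≡j (+ r′) (+ r)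
      (trans difference (Dilation.small-multiple (+ suc p) (q - q′) p bound ℕₚ.≤-refl)))
    where
    r′ = x %ℕ suc p
    q′ = x /ℕ suc p
    l : ∀ r r′ q q′ p → r′ - r ≡ p * (q - q′) + ((r′ + q′ * p) - (r + q * p))
    l = solve-∀
    difference : + r′ - + r ≡ + suc p * (q - q′)
    difference = trans (l (+ r) (+ r′) q q′ (+ suc p))
      (trans (cong (λ s → + suc p * (q - q′) + s) (ℤₚ.i≡j⇒i-j≡0 (trans (sym (a≡a%ℕn+[a/ℕn]*n x (suc p))) eq))) (ℤₚ.+-identityʳ _))
    bound : ∣ + suc p * (q - q′) ∣ ≤ p
    bound = begin
      ∣ + suc p * (q - q′) ∣    ≡⟨ cong ∣_∣ (sym difference) ⟩
      ∣ + r′ - + r ∣            ≡⟨ cong ∣_∣ (ℤₚ.m-n≡m⊖n r′ r) ⟩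
      ∣ r′ ℤ.⊖ r ∣              ≤⟨ ℤₚ.∣m⊝n∣≤m⊔n r′ r ⟩
      r′ ℕ.⊔ r                  ≤⟨ ℕₚ.⊔-lub (ℕₚ.≤-pred (n%ℕd<d x (suc p))) r≤p ⟩
      p                         ∎
      where open ℕₚ.≤-Reasoning

  module Periodise {V} (basis : Basis V) (D : List ℤ²) where
    open Basis basis

    spread : List ℤ² → ℕ
    spread [] = 0
    spread (e ∷ D) = ∣ cross d e ∣ ℕ.+ spread D

    within : ∀ D → All (λ e → ∣ cross d e ∣ ≤ spread D) D
    within [] = []
    within (e ∷ D) = ℕₚ.m≤m+n _ _ ∷ All.map (λ h → ℕₚ.≤-trans h (ℕₚ.m≤n+m _ _)) (within D)

    -- The cells u + e with e in D lie at most S rows above or below u, in a band of 2 S + 1 rows.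
    S height : ℕ
    S = spread D
    height = suc (S ℕ.+ S)

    fullPeriod : ℕ
    fullPeriod = index ℕ.* (windows 1 height index) !

    fullPeriod-suc : suc (ℕ.pred fullPeriod) ≡ fullPeriod
    fullPeriod-suc = ℕₚ.suc-pred fullPeriod {{ℕₚ.m*n≢0 index ((windows 1 height index) !) {{_}} {{(windows 1 height index) ℕₚ.!≢0}}}}

    module _ {c : Configuration} (periodic : Periodic c V) (i p : ℕ)
      (same : ∀ x τ → τ < height → c (point x (+ (i ℕ.+ suc p ℕ.+ τ))) ≡ c (point x (+ (i ℕ.+ τ)))) where

      -- The strip of rows i to i + p of `c`, repeated in direction d′.
      folded : Configuration
      folded u = c (point (cross u d′) (+ (i ℕ.+ cross d u %ℕ suc p)))

      -- By `same`, the `height` rows of `c` that follow the strip repeat those at its start. A band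
      -- that begins inside the strip therefore does not notice the fold.
      unfold : ∀ x n → n < suc p ℕ.+ height → c (point x (+ (i ℕ.+ n % suc p))) ≡ c (point x (+ (i ℕ.+ n)))
      unfold x = <-rec _ λ n rec n< → at n rec n< (n ℕ.<? suc p)
        where
        at : ∀ n → (∀ {m} → m < n → m < suc p ℕ.+ height → c (point x (+ (i ℕ.+ m % suc p))) ≡ c (point x (+ (i ℕ.+ m)))) →
             n < suc p ℕ.+ height → Dec (n < suc p) → c (point x (+ (i ℕ.+ n % suc p))) ≡ c (point x (+ (i ℕ.+ n)))
        at n rec n< (yes n<p) = cong (λ r → c (point x (+ (i ℕ.+ r)))) (m<n⇒m%n≡m n<p)
        at n rec n< (no n≮p) = begin
            c (point x (+ (i ℕ.+ n % suc p)))            ≡⟨ cong (λ r → c (point x (+ (i ℕ.+ r)))) (sym same-residue) ⟩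
            c (point x (+ (i ℕ.+ m % suc p)))            ≡⟨ rec m<n (ℕₚ.<-trans m<n n<) ⟩
            c (point x (+ (i ℕ.+ m)))                    ≡⟨ sym (same x m m<height) ⟩
            c (point x (+ (i ℕ.+ suc p ℕ.+ m)))          ≡⟨ cong (λ r → c (point x (+ r))) (trans (ℕₚ.+-assoc i (suc p) m) (cong (i ℕ.+_) m≡)) ⟩
            c (point x (+ (i ℕ.+ n)))                    ∎
          where
          open ≡-Reasoning
          m = n ∸ suc p
          m≡ : suc p ℕ.+ m ≡ n
          m≡ = ℕₚ.m+[n∸m]≡n (ℕₚ.≮⇒≥ n≮p)
          m<n : m < n
          m<n = ℕₚ.≤-trans (s≤s (ℕₚ.m≤n+m m p)) (ℕₚ.≤-reflexive m≡)
          m<height : m < height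
          m<height = ℕₚ.+-cancelˡ-< (suc p) m height (subst (_< suc p ℕ.+ height) (sym m≡) n<)
          same-residue : m % suc p ≡ n % suc p
          same-residue = trans (sym ([m+n]%n≡m%n m (suc p))) (cong (_% suc p) (trans (ℕₚ.+-comm m (suc p)) m≡))

      module _ (u : ℤ²) where

        -- Taken at the lowest row of the band around u, S rows below it, so that every neighbour is
        -- reached by a nonnegative number of steps upwards.
        residue : ℕ
        residue = (cross d u - + S) %ℕ suc p

        -- near u the folded configuration is a translate of c near this cell
        image : ℤ²
        image = point (cross u d′) (+ (i ℕ.+ residue) + + S)

        folded-near : ∀ e → ∣ cross d e ∣ ≤ S → folded (u +² e) ≡ c (image +² e)
        folded-near e e≤ = begin
          c (point (cross (u +² e) d′) (+ (i ℕ.+ cross d (u +² e) %ℕ suc p)))  ≡⟨ cong₂ (λ a r → c (point a (+ (i ℕ.+ r)))) (cross-+ˡ u e d′) residue-e ⟩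
          c (point (cross u d′ + cross e d′) (+ (i ℕ.+ (n % suc p))))          ≡⟨ unfold (cross u d′ + cross e d′) n n< ⟩
          c (point (cross u d′ + cross e d′) (+ (i ℕ.+ n)))                    ≡⟨ cong (λ t → c (point (cross u d′ + cross e d′) t)) ordinate-n ⟩
          c (point (cross u d′ + cross e d′) ((+ (i ℕ.+ residue) + + S) + cross d e))  ≡⟨ cong c (point-+ (cross u d′) (+ (i ℕ.+ residue) + + S) (cross e d′) (cross d e)) ⟩
          c (image +² point (cross e d′) (cross d e))                          ≡⟨ cong (λ v → c (image +² v)) (sym (coordinates e)) ⟩
          c (image +² e)                                                       ∎
          where
          open ≡-Reasoning
          r = ∣ cross d e + + S ∣
          n = residue ℕ.+ r
          +r≡ : + r ≡ cross d e + + S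
          +r≡ = shift-nonneg (cross d e) e≤
          n< : n < suc p ℕ.+ height
          n< = ℕₚ.+-mono-<-≤ (n%ℕd<d (cross d u - + S) (suc p)) (ℕₚ.≤-trans (ℤₚ.∣i+j∣≤∣i∣+∣j∣ (cross d e) (+ S)) (ℕₚ.≤-trans (ℕₚ.+-monoˡ-≤ S e≤) (ℕₚ.n≤1+n _)))
          ordinate-n : + (i ℕ.+ n) ≡ (+ (i ℕ.+ residue) + + S) + cross d e
          ordinate-n = trans (cong +_ (sym (ℕₚ.+-assoc i residue r))) (trans (cong (λ s → + (i ℕ.+ residue) + s) +r≡) (l (+ (i ℕ.+ residue)) (cross d e) (+ S)))
            where l : ∀ a e s → a + (e + s) ≡ (a + s) + e
                  l = solve-∀
          Q = (cross d u - + S) /ℕ suc p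
          residue-e : cross d (u +² e) %ℕ suc p ≡ n % suc p
          residue-e = %-unique (cross d (u +² e)) p (n % suc p) (+ (n / suc p) + Q) (ℕₚ.≤-pred (m%n<n n (suc p))) (begin
            cross d (u +² e)                                        ≡⟨ cross-+ʳ d u e ⟩
            cross d u + cross d e                                   ≡⟨ l₁ (cross d u) (cross d e) (+ S) ⟩
            (cross d u - + S) + (cross d e + + S)                   ≡⟨ cong₂ _+_ (a≡a%ℕn+[a/ℕn]*n (cross d u - + S) (suc p)) (sym +r≡) ⟩
            (+ residue + Q * + suc p) + + r                         ≡⟨ l₂ (+ residue) (Q * + suc p) (+ r) ⟩
            + n + Q * + suc p                                       ≡⟨ cong (λ m → + m + Q * + suc p) (m≡m%n+[m/n]*n n (suc p)) ⟩
            + (n % suc p) + + (n / suc p ℕ.* suc p) + Q * + suc p   ≡⟨ cong (λ m → + (n % suc p) + m + Q * + suc p) (ℤₚ.pos-* (n / suc p) (suc p)) ⟩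
            + (n % suc p) + + (n / suc p) * + suc p + Q * + suc p   ≡⟨ l₃ (+ (n % suc p)) (+ (n / suc p)) Q (+ suc p) ⟩
            + (n % suc p) + (+ (n / suc p) + Q) * + suc p           ∎)
            where
            l₁ : ∀ t e s → t + e ≡ (t - s) + (e + s)
            l₁ = solve-∀
            l₂ : ∀ a b c → (a + b) + c ≡ (a + c) + b
            l₂ = solve-∀
            l₃ : ∀ a b q m → a + b * m + q * m ≡ a + (b + q) * m
            l₃ = solve-∀

      folded-covering : ∀ {b a} → IsCovering D b a c → IsCovering D b a folded
      folded-covering {b} {a} covering u = covering-at {D} {b} {a} {folded} {c} u (image u)
        (All.map (λ {e} → folded-near u e) (within D)) centre (covering (image u))
        where
        centre : folded u ≡ c (image u)
        centre = trans (cong folded (sym (+²-identityʳ u)))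
          (trans (folded-near u 0² (subst (_≤ S) (sym (cong ∣_∣ (l (proj₁ d) (proj₂ d)))) z≤n)) (cong c (+²-identityʳ (image u))))
          where l : ∀ a b → a * + 0 - b * + 0 ≡ + 0
                l = solve-∀

      folded-along : Periodic folded V
      folded-along u = trans (cong₂ (λ a t → c (point a (+ (i ℕ.+ t %ℕ suc p)))) abscissa-V ordinate-V)
        (trans (cong c (shift (+ (i ℕ.+ cross d u %ℕ suc p)))) (periodic _))
        where
        abscissa-V : cross (u +² V) d′ ≡ cross u d′ + + index
        abscissa-V = trans (cross-+ˡ u V d′) (cong (_+_ (cross u d′))
          (trans (cong (λ v → cross v d′) multiple) (trans (l (+ index) (proj₁ d) (proj₂ d) (proj₁ d′) (proj₂ d′)) (trans (cong (+ index *_) unimodular) (ℤₚ.*-identityʳ _)))))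
          where l : ∀ n a b x y → (n * a) * y - (n * b) * x ≡ n * (a * y - b * x)
                l = solve-∀
        ordinate-V : cross d (u +² V) ≡ cross d u
        ordinate-V = trans (cross-+ʳ d u V) (trans (cong (_+_ (cross d u)) (trans (cong (cross d) multiple) (l (+ index) (proj₁ d) (proj₂ d)))) (ℤₚ.+-identityʳ _))
          where l : ∀ n a b → a * (n * b) - b * (n * a) ≡ + 0
                l = solve-∀
        shift : ∀ t → point (cross u d′ + + index) t ≡ point (cross u d′) t +² V
        shift t = trans (cong₂ _,_ (l (cross u d′) (+ index) t (proj₁ d) (proj₁ d′)) (l (cross u d′) (+ index) t (proj₂ d) (proj₂ d′)))
          (cong (point (cross u d′) t +²_) (sym multiple))
          where l : ∀ a n t x y → (a + n) * x + t * y ≡ (a * x + t * y) + n * x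
                l = solve-∀

      folded-across : Periodic folded ((+ suc p) · d′)
      folded-across u = cong₂ (λ a r → c (point a (+ (i ℕ.+ r)))) abscissa-same
        (%-unique (cross d (u +² ((+ suc p) · d′))) p (cross d u %ℕ suc p) (cross d u /ℕ suc p + + 1) (ℕₚ.≤-pred (n%ℕd<d (cross d u) (suc p))) ordinate-up)
        where
        abscissa-same : cross (u +² ((+ suc p) · d′)) d′ ≡ cross u d′
        abscissa-same = trans (cross-+ˡ u ((+ suc p) · d′) d′) (trans (cong (_+_ (cross u d′)) (l (+ suc p) (proj₁ d′) (proj₂ d′))) (ℤₚ.+-identityʳ _))
          where l : ∀ n x y → (n * x) * y - (n * y) * x ≡ + 0
                l = solve-∀
        ordinate-up : cross d (u +² ((+ suc p) · d′)) ≡ + (cross d u %ℕ suc p) + (cross d u /ℕ suc p + + 1) * + suc p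
        ordinate-up = trans (cross-+ʳ d u ((+ suc p) · d′))
          (trans (cong₂ _+_ (a≡a%ℕn+[a/ℕn]*n (cross d u) (suc p)) (trans (l (+ suc p) (proj₁ d) (proj₂ d) (proj₁ d′) (proj₂ d′)) (trans (cong (+ suc p *_) unimodular) (ℤₚ.*-identityʳ _))))
            (l′ (+ (cross d u %ℕ suc p)) (cross d u /ℕ suc p) (+ suc p)))
          where l : ∀ n a b x y → a * (n * y) - b * (n * x) ≡ n * (a * y - b * x)
                l = solve-∀
                l′ : ∀ r q n → (r + q * n) + n ≡ r + (q + + 1) * n
                l′ = solve-∀

    -- In contrast to `rigid`, line factors in direction V are allowed, and `c` is replaced by a
    -- folding of the strip between two equal windows. The strip height is at most the number of
    -- windows, so the factorial is a period in every case.
    periodise : ∀ {b a c} → IsCovering D b a c → Periodic c V →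
      ∃ λ c′ → IsCovering D b a c′ × (∀ v → Periodic c′ ((+ fullPeriod) · v))
    periodise {b} {a} {c} covering periodic = folded periodic i p same , folded-covering periodic i p same covering ,
        lattice-periodic basis ((windows 1 height index) !) (folded-along periodic i p same)
          (subst (λ n → Periodic (folded periodic i p same) n) (sym across≡) (periodic-· (folded-across periodic i p same) (+ quotient p∣)))
      where
      periodicχ : Periodic (indicator c) V
      periodicχ u = cong (if_then + 1 else + 0) (periodic u)
      window = repeated-window basis (indicator-bounded c) periodicχ height (+ 0)
      i = proj₁ window
      j = proj₁ (proj₂ window)
      i<j = proj₁ (proj₂ (proj₂ window))
      j≤ = proj₁ (proj₂ (proj₂ (proj₂ window)))
      gap = ℕₚ.m≤n⇒∃[o]m+o≡n i<j
      p = proj₁ gap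
      j≡ : i ℕ.+ suc p ≡ j
      j≡ = trans (ℕₚ.+-suc i p) (proj₂ gap)
      same : ∀ x τ → τ < height → c (point x (+ (i ℕ.+ suc p ℕ.+ τ))) ≡ c (point x (+ (i ℕ.+ τ)))
      same x τ τ<h = indicator-injective c _ _ (trans (cong (λ k → indicator c (point x (+ (k ℕ.+ τ)))) j≡)
        (trans (cong (λ t → indicator c (point x t)) (sym (ℤₚ.+-identityˡ (+ (j ℕ.+ τ)))))
          (trans (proj₂ (proj₂ (proj₂ (proj₂ window))) x τ τ<h) (cong (λ t → indicator c (point x t)) (ℤₚ.+-identityˡ (+ (i ℕ.+ τ)))))))
      p∣ : suc p ∣ (windows 1 height index) !
      p∣ = Binomials.≤⇒∣! (s≤s z≤n) (ℕₚ.≤-trans (ℕₚ.≤-trans (ℕₚ.m≤n+m (suc p) i) (ℕₚ.≤-reflexive j≡)) j≤)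
      across≡ : (+ ((windows 1 height index) !)) · d′ ≡ (+ quotient p∣) · ((+ suc p) · d′)
      across≡ = trans (cong (_· d′) (trans (cong +_ (m∣n⇒n≡quotient*m p∣)) (ℤₚ.pos-* (quotient p∣) (suc p)))) (·-assoc (+ quotient p∣) (+ suc p) d′)

  module FiniteSearch (D : List ℤ²) (b a L-1 : ℕ) where
    L = suc L-1

    LatticePeriodic : Configuration → Set
    LatticePeriodic c = ∀ v → Periodic c ((+ L) · v)

    reduce : ℤ² → ℤ²
    reduce (x , y) = + (x %ℕ L) , + (y %ℕ L)

    reduced : ∀ u → ∃ λ v → u ≡ reduce u +² ((+ L) · v)
    reduced (x , y) = (x /ℕ L , y /ℕ L) , cong₂ _,_
      (trans (a≡a%ℕn+[a/ℕn]*n x L) (cong (λ s → + (x %ℕ L) + s) (ℤₚ.*-comm (x /ℕ L) (+ L))))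
      (trans (a≡a%ℕn+[a/ℕn]*n y L) (cong (λ s → + (y %ℕ L) + s) (ℤₚ.*-comm (y /ℕ L) (+ L))))

    covering? : ∀ c → LatticePeriodic c → Dec (IsCovering D b a c)
    covering? c periodic = map′ spread-out (λ h i j → h _) (Finₚ.all? λ i → Finₚ.all? λ j → count D c (cell i j) ℕ.≟ _)
      where
      cell : Fin L → Fin L → ℤ²
      cell i j = + toℕ i , + toℕ j
      spread-out : (∀ i j → count D c (cell i j) ≡ (if c (cell i j) then b else a)) → IsCovering D b a c
      spread-out h u@(x , y) = covering-at {D} {b} {a} {c} {c} u (reduce u)
          (All.universal (λ d → trans (cong (λ s → c (s +² d)) u≡) (trans (cong c (swap d)) (periodic v (reduce u +² d)))) D)
          (trans (cong c u≡) (periodic v (reduce u)))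
          (subst (λ r → count D c r ≡ (if c r then b else a))
            (cong₂ (λ i j → + i , + j) (Finₚ.toℕ-fromℕ< (n%ℕd<d x L)) (Finₚ.toℕ-fromℕ< (n%ℕd<d y L)))
            (h (fromℕ< (n%ℕd<d x L)) (fromℕ< (n%ℕd<d y L))))
        where
        v = proj₁ (reduced u)
        u≡ = proj₂ (reduced u)
        swap : ∀ d → (reduce u +² ((+ L) · v)) +² d ≡ (reduce u +² d) +² ((+ L) · v)
        swap d = trans (+²-assoc (reduce u) Lv d) (trans (cong (reduce u +²_) (+²-comm Lv d)) (sym (+²-assoc (reduce u) d Lv)))
          where Lv = (+ L) · v

    toBool : Fin 2 → Bool
    toBool zero = false
    toBool (suc _) = true

    fromBool : Bool → Fin 2
    fromBool false = zero
    fromBool true = suc zero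

    toBool-fromBool : ∀ x → toBool (fromBool x) ≡ x
    toBool-fromBool false = refl
    toBool-fromBool true = refl

    cellIndex : ℤ² → Fin (L ℕ.* L)
    cellIndex (x , y) = combine (fromℕ< (n%ℕd<d x L)) (fromℕ< (n%ℕd<d y L))

    decode : Fin (2 ℕ.^ (L ℕ.* L)) → Configuration
    decode k u = toBool (finToFun k (cellIndex u))

    %ℕ-shift : ∀ x y → (x + + L * y) %ℕ L ≡ x %ℕ L
    %ℕ-shift x y = %-unique (x + + L * y) L-1 (x %ℕ L) (x /ℕ L + y) (ℕₚ.≤-pred (n%ℕd<d x L))
      (trans (cong (_+ + L * y) (a≡a%ℕn+[a/ℕn]*n x L)) (l (+ (x %ℕ L)) (x /ℕ L) (+ L) y))
      where l : ∀ r q n y → (r + q * n) + n * y ≡ r + (q + y) * n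
            l = solve-∀

    decode-periodic : ∀ k → LatticePeriodic (decode k)
    decode-periodic k (x , y) (s , t) = cong₂ (λ (i j : Fin L) → toBool (finToFun k (combine i j)))
      (Finₚ.fromℕ<-cong _ _ (%ℕ-shift s x) (n%ℕd<d (s + + L * x) L) (n%ℕd<d s L))
      (Finₚ.fromℕ<-cong _ _ (%ℕ-shift t y) (n%ℕd<d (t + + L * y) L) (n%ℕd<d t L))

    cells : Configuration → Fin (L ℕ.* L) → Fin 2
    cells c k = fromBool (c (+ toℕ (proj₁ (remQuot {L} L k)) , + toℕ (proj₂ (remQuot {L} L k))))

    code : Configuration → Fin (2 ℕ.^ (L ℕ.* L))
    code c = funToFin (cells c)

    decode-code : ∀ c → LatticePeriodic c → decode (code c) ≗ c
    decode-code c periodic u@(x , y) = begin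
      toBool (finToFun (code c) (cellIndex u))         ≡⟨ cong toBool (Finₚ.finToFun-funToFin (cells c) (cellIndex u)) ⟩
      toBool (fromBool (c (cell (remQuot {L} L (cellIndex u)))))   ≡⟨ toBool-fromBool _ ⟩
      c (cell (remQuot {L} L (cellIndex u)))           ≡⟨ cong (λ k → c (cell k)) (Finₚ.remQuot-combine (fromℕ< (n%ℕd<d x L)) (fromℕ< (n%ℕd<d y L))) ⟩
      c (cell (fromℕ< (n%ℕd<d x L) , fromℕ< (n%ℕd<d y L)))  ≡⟨ cong₂ (λ i j → c (+ i , + j)) (Finₚ.toℕ-fromℕ< (n%ℕd<d x L)) (Finₚ.toℕ-fromℕ< (n%ℕd<d y L)) ⟩
      c (reduce u)                                     ≡⟨ sym (periodic (proj₁ (reduced u)) (reduce u)) ⟩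
      c (reduce u +² ((+ L) · proj₁ (reduced u)))      ≡⟨ cong c (sym (proj₂ (reduced u))) ⟩
      c u                                              ∎
      where
      open ≡-Reasoning
      cell : Fin L × Fin L → ℤ²
      cell (i , j) = + toℕ i , + toℕ j

    -- Doubly periodic configurations are enumerated as fillings of an L by L square. Decoding
    -- recovers them only pointwise, which suffices because the condition at a cell inspects
    -- finitely many values.
    search : Dec (∃ λ c → IsCovering D b a c × LatticePeriodic c)
    search = map′ (λ (k , h) → decode k , h , decode-periodic k)
      (λ (c , h , periodic) → code c , λ u → covering-at {D} {b} {a} {decode (code c)} {c} u u
        (All.universal (λ d → decode-code c periodic (u +² d)) D) (decode-code c periodic u) (h u))
      (Finₚ.any? λ k → covering? (decode k) (decode-periodic k))

-- The integer polynomial of a covering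

module Coverings where
  open import Data.Bool using (true; false)
  open import Data.Integer as ℤ using (ℤ; +_)
  import Data.Integer.Properties as ℤP
  open import Data.Integer.Tactic.RingSolver using (solve-∀)
  open import Data.Nat using (ℕ)
  open import Data.Product using (∃; _,_; proj₁; proj₂)
  open import Data.Sum using (_⊎_; inj₁; inj₂)
  open import Data.List using (List; []; _∷_; _++_; map)
  open import Data.List.Membership.Propositional using (_∈_; find; lose)
  open import Data.List.Relation.Unary.Any as Any using (here; there)
  open import Data.List.Relation.Unary.All using (All; []; _∷_)
  open import Relation.Nullary using (¬_; yes; no; ¬?; contradiction)
  open import Relation.Nullary.Decidable using (decidable-stable)
  open import Relation.Binary.PropositionalEquality
  open Plane
  open Dilation using (Terms; act; Const)
  open Differences using (coef)
  open PeriodicCoverings using (indicator)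

  polynomial : List ℤ² → ℕ → ℕ → Terms
  polynomial D b a = map (λ u → + 1 , neg² u) D ++ (ℤ.- (+ b ℤ.- + a) , 0²) ∷ []

  act-count : ∀ D t c u → act (map (λ u → + 1 , neg² u) D ++ t) (indicator c) u ≡ + count D c u ℤ.+ act t (indicator c) u
  act-count [] t c u = sym (ℤP.+-identityˡ _)
  act-count (d ∷ D) t c u rewrite -²-neg² u d | act-count D t c u with c (u +² d)
  ... | true = sym (ℤP.+-assoc (+ 1) (+ count D c u) (act t (indicator c) u))
  ... | false = ℤP.+-identityˡ _

  -- The neighbour count is b on ones and a on zeros; subtracting b - a on the ones leaves a
  -- everywhere.
  covering-const : ∀ D b a c → IsCovering D b a c → Const (act (polynomial D b a) (indicator c))
  covering-const D b a c covering u v = trans (value u) (sym (value v))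
    where
    l₁ : ∀ b a → b ℤ.+ (ℤ.- (b ℤ.- a) ℤ.* + 1 ℤ.+ + 0) ≡ a
    l₁ = solve-∀
    l₀ : ∀ b a → a ℤ.+ (ℤ.- (b ℤ.- a) ℤ.* + 0 ℤ.+ + 0) ≡ a
    l₀ = solve-∀
    value : ∀ u → act (polynomial D b a) (indicator c) u ≡ + a
    value u rewrite act-count D ((ℤ.- (+ b ℤ.- + a) , 0²) ∷ []) c u | covering u | -²-identityʳ u with c u
    ... | true = l₁ (+ b) (+ a)
    ... | false = l₀ (+ b) (+ a)

  coef≢0⇒∈ : ∀ G x → ¬ (coef G x ≡ + 0) → x ∈ map proj₂ G
  coef≢0⇒∈ [] x k≢0 = contradiction refl k≢0
  coef≢0⇒∈ ((k , e) ∷ G) x k≢0 with e ≟² x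
  ... | yes e≡x = here (sym e≡x)
  ... | no _ = there (coef≢0⇒∈ G x k≢0)

  nonzero-coef : ∀ G → (∃ λ x → ¬ (coef G x ≡ + 0)) ⊎ (∀ x → coef G x ≡ + 0)
  nonzero-coef G with Any.any? (λ x → ¬? (coef G x ℤ.≟ + 0)) (map proj₂ G)
  ... | yes any = inj₁ (proj₁ (find any) , proj₂ (proj₂ (find any)))
  ... | no none = inj₂ λ x → decidable-stable (coef G x ℤ.≟ + 0) λ k≢0 → none (lose (coef≢0⇒∈ G x k≢0) k≢0)

-- The decision procedure

module Decision {κ ℓ} (K : ACF0 κ ℓ) (D : List ℤ²) (b a : ℕ)
  (oneDirection : Laurent.LineFactorsAtMostOneDirection K (Laurent.gPoly K D b a)) where
  open import Data.Integer as ℤ using (ℤ; +_)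
  open import Data.Nat as ℕ using (ℕ)
  open import Data.Product using (∃; _×_; _,_; proj₁; proj₂)
  open import Data.Sum using (_⊎_; inj₁; inj₂)
  open import Data.List using (List; []; _∷_; map)
  open import Data.List.Membership.Propositional using (_∈_)
  open import Data.List.Relation.Unary.Any using (here; there)
  open import Data.List.Relation.Unary.All as All using (All; []; _∷_)
  open import Relation.Nullary using (¬_; Dec; yes; no; contradiction)
  open import Relation.Binary.PropositionalEquality
  open Laurent K
  open LineFactors K
  open Reduction K
  open Coverings
  open Dilation using (weight)
  open Differences using (coef; gaps-nonzero; annihilated-by-gaps; Vanishes; Δs; Δ)
  open Periods using (Periodic)
  open PeriodicCoverings
  open Bases
  module F = ACF0 K
  open Action F.commRing using (act-0)

  G : Terms
  G = polynomial D b a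

  coeff-gPoly : ∀ x → coeff (embed G) x F.≈ coeff (gPoly D b a) x
  coeff-gPoly = go D
    where
    open IntegersIn F.commRing using (fromℤ-1; fromℤ-neg)
    go : ∀ D x → coeff (embed (polynomial D b a)) x F.≈ coeff (gPoly D b a) x
    go [] x with 0² ≟² x
    ... | yes _ = F.+-congʳ (fromℤ-neg (+ b ℤ.- + a))
    ... | no _ = F.refl
    go (u ∷ D) x with neg² u ≟² x
    ... | yes _ = F.+-cong fromℤ-1 (go D x)
    ... | no _ = go D x

  divides-gPoly : ∀ h → h ∣L embed G → h ∣L gPoly D b a
  divides-gPoly h (q , eq) = q , λ x → F.trans (eq x) (coeff-gPoly x)

  abstract
    -- The zero polynomial is divisible by x - 1 and by y - 1, line polynomials in two directions
    -- that are not parallel.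
    nonzero : ∃ λ x → ¬ (coef G x ≡ + 0)
    nonzero with nonzero-coef G
    ... | inj₁ x = x
    ... | inj₂ G≡0 = contradiction
        (oneDirection (binomial e₁ F.1#) (binomial e₂ F.1#) e₁ e₂
          (binomial-line e₁ F.1# e₁ (λ ()) (λ ()) refl F.1≉0) (divides-gPoly (binomial e₁ F.1#) (everything (binomial e₁ F.1#)))
          (binomial-line e₂ F.1# e₂ (λ ()) (λ ()) refl F.1≉0) (divides-gPoly (binomial e₂ F.1#) (everything (binomial e₂ F.1#))))
        λ ()
      where
      e₁ e₂ : ℤ²
      e₁ = + 1 , + 0
      e₂ = + 0 , + 1
      everything : ∀ h → h ∣L embed G
      everything h = [] , λ x → F.trans (coeff-*L h [] x) (F.trans (act-0 h (λ _ → F.refl) x)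
        (F.sym (F.trans (coeff-embed G x) (F.reflexive (cong F.fromℤ (G≡0 x))))))

  bad-parallel : ∀ (v w : Direction) → Bad G (direction-basis v) → Bad G (direction-basis w) → Parallel (proj₁ v) (proj₁ w)
  bad-parallel v w bv bw with bad-line-factor G (direction-basis v) (proj₂ v) bv | bad-line-factor G (direction-basis w) (proj₂ w) bw
  ... | h₁ , line₁ , div₁ | h₂ , line₂ , div₂ =
    oneDirection h₁ h₂ (proj₁ v) (proj₁ w) line₁ (divides-gPoly h₁ div₁) line₂ (divides-gPoly h₂ div₂)

  directions : ∀ {ws} → All (λ w → ¬ (w ≡ 0²)) ws → List Direction
  directions [] = []
  directions (w≢0 ∷ h) = (_ , w≢0) ∷ directions h

  map-directions : ∀ {ws} (h : All (λ w → ¬ (w ≡ 0²)) ws) → map proj₁ (directions h) ≡ ws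
  map-directions [] = refl
  map-directions (w≢0 ∷ h) = cong (_ ∷_) (map-directions h)

  n : ℕ
  n = weight G ℕ.+ weight G

  gapDirections : List Direction
  gapDirections = directions (gaps-nonzero G (proj₁ nonzero) n)

  -- The extra direction (1, 0) is arbitrary; it serves the case that no gap direction carries a
  -- line factor, including that of no gaps at all.
  candidates : List Direction
  candidates = ((+ 1 , + 0) , λ ()) ∷ gapDirections

  compatible-period : ∀ w* → All (Compatible G gapDirections w*) gapDirections →
    ∀ c → IsCovering D b a c → Periodic c (proj₁ (commonPeriod G gapDirections w*))
  compatible-period w* compatible c covering u = indicator-injective c _ _
    (common-period G gapDirections w* (indicator-bounded c) const compatible
      (subst (λ ws → Vanishes (Δs ws (Δ (proj₁ w*) (indicator c)))) (sym (map-directions (gaps-nonzero G (proj₁ nonzero) n)))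
        (annihilated-by-gaps G (indicator-bounded c) const (proj₁ nonzero) (proj₂ nonzero) (proj₁ w*))) u)
    where const = covering-const D b a c covering

  -- Either some gap direction carries a line factor, and then all others carrying one are parallel to it, or none does.
  some-compatible : ¬ (∀ w* → w* ∈ candidates → ¬ All (Compatible G gapDirections w*) gapDirections)
  some-compatible none = none _ (here refl) (All.tabulate λ w∈ → inj₂ (good _ w∈))
    where
    good : ∀ w → w ∈ gapDirections → ¬ Bad G (direction-basis w)
    good w w∈ bad = none w (there w∈) (All.universal compatible gapDirections)
      where
      compatible : ∀ v → Compatible G gapDirections w v
      compatible v with cross (proj₁ v) (proj₁ w) ℤ.≟ + 0
      ... | yes ∥ = inj₁ ∥
      ... | no ∦ = inj₂ λ bad′ → ∦ (bad-parallel v w bad′ bad)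

  Existence : Set
  Existence = ∃ λ c → IsCovering D b a c

  -- A failed search excludes all coverings of period V, since any of them could be folded into one
  -- within the range of the search.
  search-period : (V : Direction) → Existence ⊎ (∀ c → IsCovering D b a c → ¬ Periodic c (proj₁ V))
  search-period V = found (FiniteSearch.search D b a (ℕ.pred fullPeriod))
    where
    open Plane
    open Periodise (direction-basis V) D using (fullPeriod; fullPeriod-suc; periodise)
    found : Dec (∃ λ c → IsCovering D b a c × FiniteSearch.LatticePeriodic D b a (ℕ.pred fullPeriod) c) →
      Existence ⊎ (∀ c → IsCovering D b a c → ¬ Periodic c (proj₁ V))
    found (yes (c , covering , _)) = inj₁ (c , covering)
    found (no none) = inj₂ λ c covering periodic →
      let c′ , covering′ , lattice = periodise covering periodic
      in none (c′ , covering′ , λ v → subst (λ L → Periodic c′ ((+ L) · v)) (sym fullPeriod-suc) (lattice v))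

  search-all : ∀ ws → Existence ⊎ (∀ w → w ∈ ws → ∀ c → IsCovering D b a c → ¬ Periodic c (proj₁ (commonPeriod G gapDirections w)))
  search-all [] = inj₂ λ w ()
  search-all (w ∷ ws) = either (search-period (commonPeriod G gapDirections w)) (search-all ws)
    where
    either : Existence ⊎ (∀ c → IsCovering D b a c → ¬ Periodic c (proj₁ (commonPeriod G gapDirections w))) →
      Existence ⊎ (∀ w → w ∈ ws → ∀ c → IsCovering D b a c → ¬ Periodic c (proj₁ (commonPeriod G gapDirections w))) →
      Existence ⊎ (∀ v → v ∈ w ∷ ws → ∀ c → IsCovering D b a c → ¬ Periodic c (proj₁ (commonPeriod G gapDirections v)))
    either (inj₁ e) _ = inj₁ e
    either (inj₂ _) (inj₁ e) = inj₁ e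
    either (inj₂ none) (inj₂ nones) = inj₂ λ { _ (here refl) → none ; v (there v∈) → nones v v∈ }

  decision : Dec Existence
  decision = conclude (search-all candidates)
    where
    conclude : Existence ⊎ (∀ w → w ∈ candidates → ∀ c → IsCovering D b a c → ¬ Periodic c (proj₁ (commonPeriod G gapDirections w))) → Dec Existence
    conclude (inj₁ e) = yes e
    -- The goal here is absurdity, so the compatible candidate may be used although it exists only
    -- up to double negation.
    conclude (inj₂ none) = no λ (c , covering) → some-compatible λ w* w*∈ compatible →
      none w* w*∈ c covering (compatible-period w* compatible c covering)

theorem26 : ∀ {c ℓ : Level} (K : ACF0 c ℓ) →
    (D : List ℤ²) → Unique D → (b a : ℕ) →
    Laurent.LineFactorsAtMostOneDirection K (Laurent.gPoly K D b a) →
    Dec (∃ λ (conf : Configuration) → IsCovering D b a conf)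
theorem26 K D _ b a oneDirection = Decision.decision K D b a oneDirection
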